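{- There exists a group homomorphism $\tau:\mathrm{SL}(2,\mathbf Z)\to\mathcal A^\times$ with the following properties. (a) Letting $E_i$ be the subspace of $E$ spanned by $e_1,\dots,e_{2i}$ ($i\ge0$), the chain $0=E_0\subset E_1\subset E_2\subset\cdots$ is a filtration by $\mathbf C\,\mathrm{SL}(2,\mathbf Z)$-submodules (with $Y$ acting by $\tau(Y)$), and for each $i\in\mathbf N$ the quotient $E_i/E_{i-1}$ is isomorphic to the standard $2$-dimensional $\mathbf C\,\mathrm{SL}(2,\mathbf Z)$-module. (b) $\tau(T)=J_\infty$. (c) $\tau(Y)$ is an integer matrix for every $Y\in\mathrm{SL}(2,\mathbf Z)$. (d) There is a constant $C$ such that $|\tau(S)_{i,j}|\le 2^{Cj}$ for all $i,j\in\mathbf N$.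
   Context: $\mathbf N=\{1,2,\dots\}$. $E$ is the complex vector space with basis $\{e_n\}_{n\in\mathbf N}$; $\mathcal A$ is the ring of $\mathbf N\times\mathbf N$ complex matrices with finitely many nonzero entries in each column, acting on $E$ on the left in this basis. $S=\begin{pmatrix}0&-1\\1&0\end{pmatrix}$, $T=\begin{pmatrix}1&1\\0&1\end{pmatrix}$. $J_\infty$ is the matrix with $(J_\infty)_{i,j}=1$ if $j=i$ or $j=i+1$, and $0$ otherwise. -}

module Defs where

open import Level using (0ℓ)
open import Algebra.Bundles
open import Algebra.Bundles.Raw using (RawGroup)
open import Algebra.Module.Bundles using (LeftModule)
open import Algebra.Module.Morphism.Structures using (module LeftModuleMorphisms)
open import Algebra.Morphism.Bundles using (GroupHomomorphism; RingHomomorphism)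
open import Algebra.Structures
open import Data.Bool.Base using (if_then_else_; _∨_)
open import Data.Fin.Base as Fin using (Fin; toℕ)
open import Data.Integer.Base as ℤ using (ℤ; 0ℤ; 1ℤ; -1ℤ)
import Data.Integer.Properties as ℤₚ
import Data.Integer.Tactic.RingSolver as ℤ-solver
open import Data.Nat.Base as ℕ using (ℕ; zero; suc; _⊔_)
import Data.Nat.Properties as ℕₚ
open import Data.Product using (Σ; Σ-syntax; ∃-syntax; _×_; _,_; proj₁; proj₂)
open import Data.Rational.Base as ℚ using (ℚ; 0ℚ; 1ℚ; ½)
import Data.Rational.Properties as ℚₚ
open import Data.Rational.Unnormalised.Base as ℚᵘ using (mkℚᵘ; *≡*)
import Data.Rational.Unnormalised.Properties as ℚᵘₚ
open import Function.Base using (_∘_)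
open import Relation.Binary.PropositionalEquality as ≡ using (_≡_; cong; cong₂; subst)
open import Relation.Binary.Structures using (IsEquivalence)
open import Relation.Nullary.Decidable using (does; dec-false)
open import Relation.Unary using (Pred; _⊆_)

private
  module RingIdentities (R : CommutativeRing 0ℓ 0ℓ) where
    open CommutativeRing R
    open import Algebra.Properties.Ring ring
    open import Algebra.Properties.AbelianGroup +-abelianGroup using (⁻¹-∙-comm)
    open import Algebra.Properties.CommutativeSemigroup +-commutativeSemigroup using (interchange)
    open import Relation.Binary.Reasoning.Setoid setoid

    sub-add : ∀ a b → (a - b) + b ≈ a
    sub-add a b = trans (+-assoc a (- b) b) (trans (+-congˡ (-‿inverseˡ b)) (+-identityʳ a))

    sum-diff : ∀ a b c d → (a - c) + (b - d) ≈ (a + b) - (c + d)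
    sum-diff a b c d = trans (interchange a (- c) b (- d)) (+-congˡ (⁻¹-∙-comm c d))

    neg-diff : ∀ a b → - (a - b) ≈ (- a) - (- b)
    neg-diff a b = sym (⁻¹-∙-comm a (- b))

    neg-swap : ∀ a b → - (a - b) ≈ b - a
    neg-swap a b = trans (neg-diff a b) (trans (+-comm (- a) (- - b)) (+-congʳ (-‿involutive b)))

    telescope : ∀ a b c → (a - b) + (b - c) ≈ a - c
    telescope a b c = trans (sym (+-assoc (a - b) b (- c))) (+-congʳ (sub-add a b))

    prod-diff : ∀ a b c d → a * (b - d) + d * (a - c) ≈ a * b - c * d
    prod-diff a b c d = begin
      a * (b - d) + d * (a - c)              ≈⟨ +-cong (x[y-z]≈xy-xz a b d) (x[y-z]≈xy-xz d a c) ⟩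
      (a * b - a * d) + (d * a - d * c)      ≈⟨ +-congˡ (+-cong (*-comm d a) (-‿cong (*-comm d c))) ⟩
      (a * b - a * d) + (a * d - c * d)      ≈⟨ telescope (a * b) (a * d) (c * d) ⟩
      a * b - c * d                          ∎

  module ℚ-id = RingIdentities ℚₚ.+-*-commutativeRing

-- Real numbers are Cauchy sequences of rationals; two of them are equal when
-- their difference is a null sequence.

record ℝ : Set where
  constructor mkℝ
  field
    seq    : ℕ → ℚ
    cauchy : ∀ ε → 0ℚ ℚ.< ε → ∃[ N ] ∀ m n → N ℕ.≤ m → N ℕ.≤ n → ℚ.∣ seq m ℚ.- seq n ∣ ℚ.≤ ε
open ℝ public

infix 4 _≈ℝ_ _≤ℝ_

record _≈ℝ_ (x y : ℝ) : Set where
  constructor mk≈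
  field
    close : ∀ ε → 0ℚ ℚ.< ε → ∃[ N ] ∀ n → N ℕ.≤ n → ℚ.∣ seq x n ℚ.- seq y n ∣ ℚ.≤ ε
open _≈ℝ_ public

record _≤ℝ_ (x y : ℝ) : Set where
  constructor mk≤
  field
    below : ∀ ε → 0ℚ ℚ.< ε → ∃[ N ] ∀ n → N ℕ.≤ n → seq x n ℚ.≤ seq y n ℚ.+ ε
open _≤ℝ_ public

private
  Vanishing : (ℕ → ℕ → ℚ) → Set
  Vanishing s = ∀ ε → 0ℚ ℚ.< ε → ∃[ N ] ∀ m n → N ℕ.≤ m → N ℕ.≤ n → ℚ.∣ s m n ∣ ℚ.≤ ε

  Bounded : (ℕ → ℕ → ℚ) → Set
  Bounded s = ∃[ B ] (0ℚ ℚ.< B × ∃[ N ] ∀ m n → N ℕ.≤ m → N ℕ.≤ n → ℚ.∣ s m n ∣ ℚ.≤ B)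

  vanish-resp : ∀ {s t} → (∀ m n → s m n ≡ t m n) → Vanishing s → Vanishing t
  vanish-resp eq vs ε ε>0 with vs ε ε>0
  ... | N , h = N , λ m n p q → subst (λ z → ℚ.∣ z ∣ ℚ.≤ ε) (eq m n) (h m n p q)

  vanish-0 : ∀ {s} → (∀ m n → s m n ≡ 0ℚ) → Vanishing s
  vanish-0 eq ε ε>0 = 0 , λ m n _ _ → subst (λ z → ℚ.∣ z ∣ ℚ.≤ ε) (≡.sym (eq m n)) (ℚₚ.<⇒≤ ε>0)

  half-pos : ∀ ε → 0ℚ ℚ.< ε → 0ℚ ℚ.< ½ ℚ.* ε
  half-pos ε ε>0 = ℚₚ.positive⁻¹ _ {{ℚₚ.pos*pos⇒pos ½ ε {{ℚ.positive ε>0}}}}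

  halves : ∀ ε → ½ ℚ.* ε ℚ.+ ½ ℚ.* ε ≡ ε
  halves ε = ≡.trans (≡.sym (ℚₚ.*-distribʳ-+ ε ½ ½)) (ℚₚ.*-identityˡ ε)

  vanish-+ : ∀ {s t} → Vanishing s → Vanishing t → Vanishing (λ m n → s m n ℚ.+ t m n)
  vanish-+ {s} {t} vs vt ε ε>0
    with N₁ , h₁ ← vs (½ ℚ.* ε) (half-pos ε ε>0)
       | N₂ , h₂ ← vt (½ ℚ.* ε) (half-pos ε ε>0)
    = N₁ ⊔ N₂ , λ m n p q → begin
        ℚ.∣ s m n ℚ.+ t m n ∣         ≤⟨ ℚₚ.∣p+q∣≤∣p∣+∣q∣ (s m n) (t m n) ⟩
        ℚ.∣ s m n ∣ ℚ.+ ℚ.∣ t m n ∣   ≤⟨ ℚₚ.+-mono-≤ (h₁ m n (ℕₚ.m⊔n≤o⇒m≤o N₁ N₂ p) (ℕₚ.m⊔n≤o⇒m≤o N₁ N₂ q))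
                                                     (h₂ m n (ℕₚ.m⊔n≤o⇒n≤o N₁ N₂ p) (ℕₚ.m⊔n≤o⇒n≤o N₁ N₂ q)) ⟩
        ½ ℚ.* ε ℚ.+ ½ ℚ.* ε           ≡⟨ halves ε ⟩
        ε                             ∎
    where open ℚₚ.≤-Reasoning

  vanish-neg : ∀ {s} → Vanishing s → Vanishing (λ m n → ℚ.- s m n)
  vanish-neg {s} vs ε ε>0 with vs ε ε>0
  ... | N , h = N , λ m n p q → subst (ℚ._≤ ε) (≡.sym (ℚₚ.∣-p∣≡∣p∣ (s m n))) (h m n p q)

  vanish-* : ∀ {s t} → Bounded s → Vanishing t → Vanishing (λ m n → s m n ℚ.* t m n)
  vanish-* {s} {t} (B , B>0 , N₁ , h₁) vt ε ε>0
    = N₁ ⊔ N₂ , λ m n p q → begin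
        ℚ.∣ s m n ℚ.* t m n ∣         ≡⟨ ℚₚ.∣p*q∣≡∣p∣*∣q∣ (s m n) (t m n) ⟩
        ℚ.∣ s m n ∣ ℚ.* ℚ.∣ t m n ∣   ≤⟨ ℚₚ.*-monoʳ-≤-nonNeg ℚ.∣ t m n ∣ {{ℚₚ.∣-∣-nonNeg (t m n)}}
                                           (h₁ m n (ℕₚ.m⊔n≤o⇒m≤o N₁ N₂ p) (ℕₚ.m⊔n≤o⇒m≤o N₁ N₂ q)) ⟩
        B ℚ.* ℚ.∣ t m n ∣             ≤⟨ ℚₚ.*-monoˡ-≤-nonNeg B {{ℚₚ.pos⇒nonNeg B}}
                                           (h₂ m n (ℕₚ.m⊔n≤o⇒n≤o N₁ N₂ p) (ℕₚ.m⊔n≤o⇒n≤o N₁ N₂ q)) ⟩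
        B ℚ.* (ℚ.1/ B ℚ.* ε)          ≡⟨ ≡.sym (ℚₚ.*-assoc B (ℚ.1/ B) ε) ⟩
        (B ℚ.* ℚ.1/ B) ℚ.* ε          ≡⟨ cong (ℚ._* ε) (ℚₚ.*-inverseʳ B) ⟩
        1ℚ ℚ.* ε                      ≡⟨ ℚₚ.*-identityˡ ε ⟩
        ε                             ∎
    where
    open ℚₚ.≤-Reasoning
    instance
      B-pos : ℚ.Positive B
      B-pos = ℚ.positive B>0
      B-nz : ℚ.NonZero B
      B-nz = ℚₚ.pos⇒nonZero B
    δ>0 : 0ℚ ℚ.< ℚ.1/ B ℚ.* ε
    δ>0 = ℚₚ.positive⁻¹ _ {{ℚₚ.pos*pos⇒pos (ℚ.1/ B) {{ℚₚ.1/pos⇒pos B}} ε {{ℚ.positive ε>0}}}}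
    N₂ = proj₁ (vt (ℚ.1/ B ℚ.* ε) δ>0)
    h₂ = proj₂ (vt (ℚ.1/ B ℚ.* ε) δ>0)

  0<1 : 0ℚ ℚ.< 1ℚ
  0<1 = ℚₚ.positive⁻¹ 1ℚ

  abstract
    bounded : ∀ x → ∃[ B ] (0ℚ ℚ.< B × ∃[ N ] ∀ n → N ℕ.≤ n → ℚ.∣ seq x n ∣ ℚ.≤ B)
    bounded x with cauchy x 1ℚ 0<1
    ... | N , h = 1ℚ ℚ.+ ℚ.∣ seq x N ∣ , pos , N , λ n p → begin
          ℚ.∣ seq x n ∣                                        ≡⟨ cong ℚ.∣_∣ (≡.sym (ℚ-id.sub-add (seq x n) (seq x N))) ⟩
          ℚ.∣ (seq x n ℚ.- seq x N) ℚ.+ seq x N ∣              ≤⟨ ℚₚ.∣p+q∣≤∣p∣+∣q∣ (seq x n ℚ.- seq x N) (seq x N) ⟩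
          ℚ.∣ seq x n ℚ.- seq x N ∣ ℚ.+ ℚ.∣ seq x N ∣          ≤⟨ ℚₚ.+-monoˡ-≤ ℚ.∣ seq x N ∣ (h n N p ℕₚ.≤-refl) ⟩
          1ℚ ℚ.+ ℚ.∣ seq x N ∣                                 ∎
      where
      open ℚₚ.≤-Reasoning
      pos : 0ℚ ℚ.< 1ℚ ℚ.+ ℚ.∣ seq x N ∣
      pos = ℚₚ.positive⁻¹ _ {{ℚₚ.pos+nonNeg⇒pos 1ℚ ℚ.∣ seq x N ∣ {{ℚₚ.∣-∣-nonNeg (seq x N)}}}}

  boundedˡ : ∀ x → Bounded (λ m _ → seq x m)
  boundedˡ x with bounded x
  ... | B , B>0 , N , h = B , B>0 , N , λ m _ p _ → h m p

  boundedʳ : ∀ x → Bounded (λ _ n → seq x n)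
  boundedʳ x with bounded x
  ... | B , B>0 , N , h = B , B>0 , N , λ _ n _ q → h n q

  vanish⇒≈ : ∀ {x y} → Vanishing (λ n _ → seq x n ℚ.- seq y n) → x ≈ℝ y
  vanish⇒≈ v = mk≈ λ ε ε>0 → proj₁ (v ε ε>0) , λ n p → proj₂ (v ε ε>0) n n p p

  ≈⇒vanish : ∀ {x y} → x ≈ℝ y → Vanishing (λ n _ → seq x n ℚ.- seq y n)
  ≈⇒vanish v ε ε>0 with close v ε ε>0
  ... | N , h = N , λ m _ p _ → h m p

  ≡⇒≈ℝ : ∀ {x y} → (∀ n → seq x n ≡ seq y n) → x ≈ℝ y
  ≡⇒≈ℝ {x} {y} eq = vanish⇒≈ {x} {y} (vanish-0 λ n _ →
    ≡.trans (cong (ℚ._- seq y n) (eq n)) (ℚₚ.+-inverseʳ (seq y n)))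

  abstract
    const-cauchy : ∀ q → Vanishing (λ _ _ → q ℚ.- q)
    const-cauchy q = vanish-0 λ _ _ → ℚₚ.+-inverseʳ q

    +-cauchy : ∀ x y → Vanishing (λ m n → (seq x m ℚ.+ seq y m) ℚ.- (seq x n ℚ.+ seq y n))
    +-cauchy x y = vanish-resp (λ m n → ℚ-id.sum-diff (seq x m) (seq y m) (seq x n) (seq y n))
      (vanish-+ (cauchy x) (cauchy y))

    neg-cauchy : ∀ x → Vanishing (λ m n → (ℚ.- seq x m) ℚ.- (ℚ.- seq x n))
    neg-cauchy x = vanish-resp (λ m n → ℚ-id.neg-diff (seq x m) (seq x n)) (vanish-neg (cauchy x))

    *-cauchy : ∀ x y → Vanishing (λ m n → seq x m ℚ.* seq y m ℚ.- seq x n ℚ.* seq y n)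
    *-cauchy x y = vanish-resp (λ m n → ℚ-id.prod-diff (seq x m) (seq y m) (seq x n) (seq y n))
      (vanish-+ (vanish-* (boundedˡ x) (cauchy y)) (vanish-* (boundedʳ y) (cauchy x)))

fromℚ : ℚ → ℝ
fromℚ q = mkℝ (λ _ → q) (const-cauchy q)

infixl 6 _+ℝ_
infixl 7 _*ℝ_

_+ℝ_ : ℝ → ℝ → ℝ
x +ℝ y = mkℝ (λ n → seq x n ℚ.+ seq y n) (+-cauchy x y)

_*ℝ_ : ℝ → ℝ → ℝ
x *ℝ y = mkℝ (λ n → seq x n ℚ.* seq y n) (*-cauchy x y)

-ℝ_ : ℝ → ℝ
-ℝ x = mkℝ (λ n → ℚ.- seq x n) (neg-cauchy x)

private
  abstract
    ≈ℝ-isEquivalence : IsEquivalence _≈ℝ_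
    ≈ℝ-isEquivalence = record
      { refl  = λ {x} → ≡⇒≈ℝ {x} {x} λ _ → ≡.refl
      ; sym   = λ {x} {y} p → vanish⇒≈ {y} {x}
          (vanish-resp (λ m _ → ℚ-id.neg-swap (seq x m) (seq y m)) (vanish-neg (≈⇒vanish {x} {y} p)))
      ; trans = λ {x} {y} {z} p q → vanish⇒≈ {x} {z}
          (vanish-resp (λ m _ → ℚ-id.telescope (seq x m) (seq y m) (seq z m))
            (vanish-+ (≈⇒vanish {x} {y} p) (≈⇒vanish {y} {z} q)))
      }

    ℝ-isCommutativeRing : IsCommutativeRing _≈ℝ_ _+ℝ_ _*ℝ_ -ℝ_ (fromℚ 0ℚ) (fromℚ 1ℚ)
    ℝ-isCommutativeRing = record
      { isRing = record
        { +-isAbelianGroup = record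
          { isGroup = record
            { isMonoid = record
              { isSemigroup = record
                { isMagma = record
                  { isEquivalence = ≈ℝ-isEquivalence
                  ; ∙-cong = λ {x} {y} {u} {v} p q → vanish⇒≈ {x +ℝ u} {y +ℝ v}
                      (vanish-resp (λ m _ → ℚ-id.sum-diff (seq x m) (seq u m) (seq y m) (seq v m))
                        (vanish-+ (≈⇒vanish {x} {y} p) (≈⇒vanish {u} {v} q)))
                  }
                ; assoc = λ x y z → ≡⇒≈ℝ {(x +ℝ y) +ℝ z} {x +ℝ (y +ℝ z)} λ n → ℚₚ.+-assoc (seq x n) (seq y n) (seq z n)
                }
              ; identity = (λ x → ≡⇒≈ℝ {fromℚ 0ℚ +ℝ x} {x} λ n → ℚₚ.+-identityˡ (seq x n))
                         , (λ x → ≡⇒≈ℝ {x +ℝ fromℚ 0ℚ} {x} λ n → ℚₚ.+-identityʳ (seq x n))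
              }
            ; inverse = (λ x → ≡⇒≈ℝ {(-ℝ x) +ℝ x} {fromℚ 0ℚ} λ n → ℚₚ.+-inverseˡ (seq x n))
                      , (λ x → ≡⇒≈ℝ {x +ℝ (-ℝ x)} {fromℚ 0ℚ} λ n → ℚₚ.+-inverseʳ (seq x n))
            ; ⁻¹-cong = λ {x} {y} p → vanish⇒≈ { -ℝ x} { -ℝ y}
                (vanish-resp (λ m _ → ℚ-id.neg-diff (seq x m) (seq y m)) (vanish-neg (≈⇒vanish {x} {y} p)))
            }
          ; comm = λ x y → ≡⇒≈ℝ {x +ℝ y} {y +ℝ x} λ n → ℚₚ.+-comm (seq x n) (seq y n)
          }
        ; *-cong = λ {x} {y} {u} {v} p q → vanish⇒≈ {x *ℝ u} {y *ℝ v}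
            (vanish-resp (λ m _ → ℚ-id.prod-diff (seq x m) (seq u m) (seq y m) (seq v m))
              (vanish-+ (vanish-* (boundedˡ x) (≈⇒vanish {u} {v} q)) (vanish-* (boundedˡ v) (≈⇒vanish {x} {y} p))))
        ; *-assoc = λ x y z → ≡⇒≈ℝ {(x *ℝ y) *ℝ z} {x *ℝ (y *ℝ z)} λ n → ℚₚ.*-assoc (seq x n) (seq y n) (seq z n)
        ; *-identity = (λ x → ≡⇒≈ℝ {fromℚ 1ℚ *ℝ x} {x} λ n → ℚₚ.*-identityˡ (seq x n))
                     , (λ x → ≡⇒≈ℝ {x *ℝ fromℚ 1ℚ} {x} λ n → ℚₚ.*-identityʳ (seq x n))
        ; distrib = (λ x y z → ≡⇒≈ℝ {x *ℝ (y +ℝ z)} {x *ℝ y +ℝ x *ℝ z} λ n → ℚₚ.*-distribˡ-+ (seq x n) (seq y n) (seq z n))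
                  , (λ x y z → ≡⇒≈ℝ {(y +ℝ z) *ℝ x} {y *ℝ x +ℝ z *ℝ x} λ n → ℚₚ.*-distribʳ-+ (seq x n) (seq y n) (seq z n))
        }
      ; *-comm = λ x y → ≡⇒≈ℝ {x *ℝ y} {y *ℝ x} λ n → ℚₚ.*-comm (seq x n) (seq y n)
      }

ℝ-commutativeRing : CommutativeRing 0ℓ 0ℓ
ℝ-commutativeRing = record { isCommutativeRing = ℝ-isCommutativeRing }

module Complexification (R : CommutativeRing 0ℓ 0ℓ) where
  open CommutativeRing R

  infixl 6 _+ᶜ_
  infixl 7 _*ᶜ_
  infix 4 _≈ᶜ_

  record Complex : Set where
    constructor _+i_
    field
      re im : Carrier
  open Complex public

  record _≈ᶜ_ (z w : Complex) : Set where
    constructor _,ᶜ_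
    field
      re≈ : re z ≈ re w
      im≈ : im z ≈ im w
  open _≈ᶜ_ public

  _+ᶜ_ _*ᶜ_ : Complex → Complex → Complex
  z +ᶜ w = (re z + re w) +i (im z + im w)
  z *ᶜ w = (re z * re w - im z * im w) +i (re z * im w + im z * re w)

  -ᶜ_ : Complex → Complex
  -ᶜ z = (- re z) +i (- im z)

  0ᶜ 1ᶜ : Complex
  0ᶜ = 0# +i 0#
  1ᶜ = 1# +i 0#

  private
    open import Algebra.Properties.Ring ring using (x[y-z]≈xy-xz; [y-z]x≈yx-zx; -0#≈0#)
    open import Algebra.Properties.AbelianGroup +-abelianGroup using (⁻¹-∙-comm)
    open import Algebra.Properties.CommutativeSemigroup +-commutativeSemigroup using (interchange)
    open import Relation.Binary.Reasoning.Setoid setoid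

    shuffle : ∀ p q u v → (p + q) + (u + v) ≈ (p + u) + (v + q)
    shuffle p q u v = trans (interchange p q u v) (+-congˡ (+-comm q v))

    -[x+y] : ∀ x y → - (x + y) ≈ - x - y
    -[x+y] x y = sym (⁻¹-∙-comm x y)

    abstract
      *ᶜ-comm : ∀ z w → z *ᶜ w ≈ᶜ w *ᶜ z
      *ᶜ-comm z w = +-cong (*-comm _ _) (-‿cong (*-comm _ _))
                 ,ᶜ trans (+-comm _ _) (+-cong (*-comm _ _) (*-comm _ _))

      *ᶜ-assoc : ∀ x y z → (x *ᶜ y) *ᶜ z ≈ᶜ x *ᶜ (y *ᶜ z)
      *ᶜ-assoc (a +i b) (c +i d) (e +i f) =
        (begin
          (a * c - b * d) * e - (a * d + b * c) * f
            ≈⟨ +-cong ([y-z]x≈yx-zx e (a * c) (b * d))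
                      (trans (-‿cong (distribʳ f (a * d) (b * c))) (-[x+y] _ _)) ⟩
          (a * c * e - b * d * e) + (- (a * d * f) - b * c * f)
            ≈⟨ shuffle _ _ _ _ ⟩
          (a * c * e - a * d * f) + (- (b * c * f) - b * d * e)
            ≈⟨ +-cong (+-cong (*-assoc a c e) (-‿cong (*-assoc a d f)))
                      (+-cong (-‿cong (*-assoc b c f)) (-‿cong (*-assoc b d e))) ⟩
          (a * (c * e) - a * (d * f)) + (- (b * (c * f)) - b * (d * e))
            ≈⟨ +-cong (x[y-z]≈xy-xz a (c * e) (d * f))
                      (trans (-‿cong (distribˡ b (c * f) (d * e))) (-[x+y] _ _)) ⟨
          a * (c * e - d * f) - b * (c * f + d * e) ∎)
        ,ᶜ
        (begin
          (a * c - b * d) * f + (a * d + b * c) * e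
            ≈⟨ +-cong ([y-z]x≈yx-zx f (a * c) (b * d)) (distribʳ e (a * d) (b * c)) ⟩
          (a * c * f - b * d * f) + (a * d * e + b * c * e)
            ≈⟨ shuffle _ _ _ _ ⟩
          (a * c * f + a * d * e) + (b * c * e - b * d * f)
            ≈⟨ +-cong (+-cong (*-assoc a c f) (*-assoc a d e))
                      (+-cong (*-assoc b c e) (-‿cong (*-assoc b d f))) ⟩
          (a * (c * f) + a * (d * e)) + (b * (c * e) - b * (d * f))
            ≈⟨ +-cong (distribˡ a (c * f) (d * e)) (x[y-z]≈xy-xz b (c * e) (d * f)) ⟨
          a * (c * f + d * e) + b * (c * e - d * f) ∎)

      *ᶜ-distribˡ : ∀ x y z → x *ᶜ (y +ᶜ z) ≈ᶜ (x *ᶜ y) +ᶜ (x *ᶜ z)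
      *ᶜ-distribˡ (a +i b) (c +i d) (e +i f) =
        (begin
          a * (c + e) - b * (d + f)
            ≈⟨ +-cong (distribˡ a c e) (trans (-‿cong (distribˡ b d f)) (-[x+y] _ _)) ⟩
          (a * c + a * e) + (- (b * d) - b * f)
            ≈⟨ interchange _ _ _ _ ⟩
          (a * c - b * d) + (a * e - b * f) ∎)
        ,ᶜ trans (+-cong (distribˡ a d f) (distribˡ b c e)) (interchange _ _ _ _)

      *ᶜ-identityˡ : ∀ z → 1ᶜ *ᶜ z ≈ᶜ z
      *ᶜ-identityˡ (a +i b) =
        (begin
          1# * a - 0# * b   ≈⟨ +-cong (*-identityˡ a) (-‿cong (zeroˡ b)) ⟩
          a - 0#            ≈⟨ +-congˡ -0#≈0# ⟩
          a + 0#            ≈⟨ +-identityʳ a ⟩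
          a                 ∎)
        ,ᶜ trans (+-cong (*-identityˡ b) (zeroˡ a)) (+-identityʳ b)

      ≈ᶜ-isEquivalence : IsEquivalence _≈ᶜ_
      ≈ᶜ-isEquivalence = record
        { refl  = refl ,ᶜ refl
        ; sym   = λ p → sym (re≈ p) ,ᶜ sym (im≈ p)
        ; trans = λ p q → trans (re≈ p) (re≈ q) ,ᶜ trans (im≈ p) (im≈ q)
        }

      Complex-isCommutativeRing : IsCommutativeRing _≈ᶜ_ _+ᶜ_ _*ᶜ_ -ᶜ_ 0ᶜ 1ᶜ
      Complex-isCommutativeRing = record
        { isRing = record
          { +-isAbelianGroup = record
            { isGroup = record
              { isMonoid = record
                { isSemigroup = record
                  { isMagma = record
                    { isEquivalence = ≈ᶜ-isEquivalence
                    ; ∙-cong = λ p q → +-cong (re≈ p) (re≈ q) ,ᶜ +-cong (im≈ p) (im≈ q)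
                    }
                  ; assoc = λ _ _ _ → +-assoc _ _ _ ,ᶜ +-assoc _ _ _
                  }
                ; identity = (λ _ → +-identityˡ _ ,ᶜ +-identityˡ _) , (λ _ → +-identityʳ _ ,ᶜ +-identityʳ _)
                }
              ; inverse = (λ _ → -‿inverseˡ _ ,ᶜ -‿inverseˡ _) , (λ _ → -‿inverseʳ _ ,ᶜ -‿inverseʳ _)
              ; ⁻¹-cong = λ p → -‿cong (re≈ p) ,ᶜ -‿cong (im≈ p)
              }
            ; comm = λ _ _ → +-comm _ _ ,ᶜ +-comm _ _
            }
          ; *-cong = λ p q → +-cong (*-cong (re≈ p) (re≈ q)) (-‿cong (*-cong (im≈ p) (im≈ q)))
                          ,ᶜ +-cong (*-cong (re≈ p) (im≈ q)) (*-cong (im≈ p) (re≈ q))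
          ; *-assoc = *ᶜ-assoc
          ; *-identity = *ᶜ-identityˡ
                       , λ z → ≈ᶜ-trans (*ᶜ-comm z 1ᶜ) (*ᶜ-identityˡ z)
          ; distrib = *ᶜ-distribˡ
                    , λ x y z → ≈ᶜ-trans (*ᶜ-comm (y +ᶜ z) x)
                        (≈ᶜ-trans (*ᶜ-distribˡ x y z)
                          (+-cong (re≈ (*ᶜ-comm x y)) (re≈ (*ᶜ-comm x z))
                        ,ᶜ +-cong (im≈ (*ᶜ-comm x y)) (im≈ (*ᶜ-comm x z))))
          }
        ; *-comm = *ᶜ-comm
        }
        where open IsEquivalence ≈ᶜ-isEquivalence using () renaming (trans to ≈ᶜ-trans)

  abstract
    real-+ : ∀ a b → (a + b) +i 0# ≈ᶜ (a +i 0#) +ᶜ (b +i 0#)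
    real-+ a b = refl ,ᶜ sym (+-identityˡ 0#)

    real-* : ∀ a b → (a * b) +i 0# ≈ᶜ (a +i 0#) *ᶜ (b +i 0#)
    real-* a b = sym (trans (+-congˡ (trans (-‿cong (zeroˡ 0#)) -0#≈0#)) (+-identityʳ (a * b)))
              ,ᶜ sym (trans (+-cong (zeroʳ a) (zeroˡ b)) (+-identityˡ 0#))

  complexRing : CommutativeRing 0ℓ 0ℓ
  complexRing = record { isCommutativeRing = Complex-isCommutativeRing }

open Complexification ℝ-commutativeRing public
  using (_+i_; re; im; re≈; im≈; _,ᶜ_) renaming (Complex to ℂ; _≈ᶜ_ to _≈ℂ_; complexRing to ℂ-commutativeRing)

fromℤ : ℤ → ℂ
fromℤ n = fromℚ (n ℚ./ 1) +i fromℚ 0ℚ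

infix 4 ∣_∣≤_

-- The modulus of z is the non-negative real ρ with ρ² = (re z)² + (im z)²;
-- the real square root is specified rather than computed.
IsModulus : ℂ → ℝ → Set
IsModulus z ρ = fromℚ 0ℚ ≤ℝ ρ × ρ *ℝ ρ ≈ℝ re z *ℝ re z +ℝ im z *ℝ im z

∣_∣≤_ : ℂ → ℝ → Set
∣ z ∣≤ r = ∃[ ρ ] (IsModulus z ρ × ρ ≤ℝ r)

record Unit (M : Monoid 0ℓ 0ℓ) : Set where
  open Monoid M
  field
    value inv : Carrier
    inverseˡ  : inv ∙ value ≈ ε
    inverseʳ  : value ∙ inv ≈ ε
open Unit public using (value; inv)

unitGroup : Monoid 0ℓ 0ℓ → Group 0ℓ 0ℓ
unitGroup M = record
  { Carrier = Unit M
  ; _≈_     = λ u v → value u ≈ value v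
  ; _∙_     = λ u v → record
      { value    = value u ∙ value v
      ; inv      = inv v ∙ inv u
      ; inverseˡ = cancel (Unit.inverseˡ u) (Unit.inverseˡ v)
      ; inverseʳ = cancel (Unit.inverseʳ v) (Unit.inverseʳ u)
      }
  ; ε       = record { value = ε ; inv = ε ; inverseˡ = identityˡ ε ; inverseʳ = identityˡ ε }
  ; _⁻¹     = λ u → record
      { value = inv u ; inv = value u ; inverseˡ = Unit.inverseʳ u ; inverseʳ = Unit.inverseˡ u }
  ; isGroup = record
    { isMonoid = record
      { isSemigroup = record
        { isMagma = record
          { isEquivalence = record { refl = refl ; sym = sym ; trans = trans }
          ; ∙-cong = ∙-cong
          }
        ; assoc = λ _ _ _ → assoc _ _ _
        }
      ; identity = (λ _ → identityˡ _) , (λ _ → identityʳ _)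
      }
    ; inverse = Unit.inverseˡ , Unit.inverseʳ
    ; ⁻¹-cong = λ {u} {v} p → trans (sym (identityʳ _)) (trans (∙-congˡ (sym (Unit.inverseʳ v)))
        (trans (sym (assoc _ _ _)) (trans (∙-congʳ (trans (∙-congˡ (sym p)) (Unit.inverseˡ u))) (identityˡ _))))
    }
  }
  where
  open Monoid M
  cancel : ∀ {a a′ b b′} → a′ ∙ a ≈ ε → b′ ∙ b ≈ ε → (b′ ∙ a′) ∙ (a ∙ b) ≈ ε
  cancel p q = trans (assoc _ _ _) (trans (∙-congˡ (trans (sym (assoc _ _ _))
    (trans (∙-congʳ p) (identityˡ _)))) q)

record SL₂ : Set where
  constructor sl₂
  field
    a b c d : ℤ
    det     : a ℤ.* d ℤ.- b ℤ.* c ≡ 1ℤ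

record _≈SL₂_ (X Y : SL₂) : Set where
  constructor entries≡
  field
    a≡ : SL₂.a X ≡ SL₂.a Y
    b≡ : SL₂.b X ≡ SL₂.b Y
    c≡ : SL₂.c X ≡ SL₂.c Y
    d≡ : SL₂.d X ≡ SL₂.d Y

private
  det-* : ∀ a b c d a′ b′ c′ d′ →
    (a ℤ.* a′ ℤ.+ b ℤ.* c′) ℤ.* (c ℤ.* b′ ℤ.+ d ℤ.* d′) ℤ.- (a ℤ.* b′ ℤ.+ b ℤ.* d′) ℤ.* (c ℤ.* a′ ℤ.+ d ℤ.* c′)
      ≡ (a ℤ.* d ℤ.- b ℤ.* c) ℤ.* (a′ ℤ.* d′ ℤ.- b′ ℤ.* c′)
  det-* = ℤ-solver.solve-∀

  det-inv : ∀ a b c d → d ℤ.* a ℤ.- (ℤ.- b) ℤ.* (ℤ.- c) ≡ a ℤ.* d ℤ.- b ℤ.* c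
  det-inv = ℤ-solver.solve-∀

  row-assoc : ∀ a b a′ b′ c′ d′ e f →
    (a ℤ.* a′ ℤ.+ b ℤ.* c′) ℤ.* e ℤ.+ (a ℤ.* b′ ℤ.+ b ℤ.* d′) ℤ.* f
      ≡ a ℤ.* (a′ ℤ.* e ℤ.+ b′ ℤ.* f) ℤ.+ b ℤ.* (c′ ℤ.* e ℤ.+ d′ ℤ.* f)
  row-assoc = ℤ-solver.solve-∀

  idˡ₁ : ∀ a c → 1ℤ ℤ.* a ℤ.+ 0ℤ ℤ.* c ≡ a
  idˡ₁ = ℤ-solver.solve-∀
  idˡ₂ : ∀ a c → 0ℤ ℤ.* a ℤ.+ 1ℤ ℤ.* c ≡ c
  idˡ₂ = ℤ-solver.solve-∀
  idʳ₁ : ∀ a b → a ℤ.* 1ℤ ℤ.+ b ℤ.* 0ℤ ≡ a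
  idʳ₁ = ℤ-solver.solve-∀
  idʳ₂ : ∀ a b → a ℤ.* 0ℤ ℤ.+ b ℤ.* 1ℤ ≡ b
  idʳ₂ = ℤ-solver.solve-∀

  inv₁ : ∀ a b c d → d ℤ.* a ℤ.+ (ℤ.- b) ℤ.* c ≡ a ℤ.* d ℤ.- b ℤ.* c
  inv₁ = ℤ-solver.solve-∀
  inv₂ : ∀ b d → d ℤ.* b ℤ.+ (ℤ.- b) ℤ.* d ≡ 0ℤ
  inv₂ = ℤ-solver.solve-∀
  inv₃ : ∀ a c → (ℤ.- c) ℤ.* a ℤ.+ a ℤ.* c ≡ 0ℤ
  inv₃ = ℤ-solver.solve-∀
  inv₄ : ∀ a b c d → (ℤ.- c) ℤ.* b ℤ.+ a ℤ.* d ≡ a ℤ.* d ℤ.- b ℤ.* c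
  inv₄ = ℤ-solver.solve-∀
  inv₅ : ∀ a b c d → a ℤ.* d ℤ.+ b ℤ.* (ℤ.- c) ≡ a ℤ.* d ℤ.- b ℤ.* c
  inv₅ = ℤ-solver.solve-∀
  inv₆ : ∀ a b → a ℤ.* (ℤ.- b) ℤ.+ b ℤ.* a ≡ 0ℤ
  inv₆ = ℤ-solver.solve-∀
  inv₇ : ∀ c d → c ℤ.* d ℤ.+ d ℤ.* (ℤ.- c) ≡ 0ℤ
  inv₇ = ℤ-solver.solve-∀
  inv₈ : ∀ a b c d → c ℤ.* (ℤ.- b) ℤ.+ d ℤ.* a ≡ a ℤ.* d ℤ.- b ℤ.* c
  inv₈ = ℤ-solver.solve-∀

_*SL₂_ : SL₂ → SL₂ → SL₂
sl₂ a b c d δ *SL₂ sl₂ a′ b′ c′ d′ δ′ = sl₂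
  (a ℤ.* a′ ℤ.+ b ℤ.* c′) (a ℤ.* b′ ℤ.+ b ℤ.* d′)
  (c ℤ.* a′ ℤ.+ d ℤ.* c′) (c ℤ.* b′ ℤ.+ d ℤ.* d′)
  (≡.trans (det-* a b c d a′ b′ c′ d′) (cong₂ ℤ._*_ δ δ′))

SL₂ℤ : Group 0ℓ 0ℓ
SL₂ℤ = record
  { Carrier = SL₂
  ; _≈_     = _≈SL₂_
  ; _∙_     = _*SL₂_
  ; ε       = sl₂ 1ℤ 0ℤ 0ℤ 1ℤ ≡.refl
  ; _⁻¹     = λ { (sl₂ a b c d δ) → sl₂ d (ℤ.- b) (ℤ.- c) a (≡.trans (det-inv a b c d) δ) }
  ; isGroup = record
    { isMonoid = record
      { isSemigroup = record
        { isMagma = record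
          { isEquivalence = record
            { refl  = entries≡ ≡.refl ≡.refl ≡.refl ≡.refl
            ; sym   = λ { (entries≡ p q r s) → entries≡ (≡.sym p) (≡.sym q) (≡.sym r) (≡.sym s) }
            ; trans = λ { (entries≡ p q r s) (entries≡ p′ q′ r′ s′) →
                entries≡ (≡.trans p p′) (≡.trans q q′) (≡.trans r r′) (≡.trans s s′) }
            }
          ; ∙-cong = λ { (entries≡ p q r s) (entries≡ p′ q′ r′ s′) → entries≡
              (cong₂ ℤ._+_ (cong₂ ℤ._*_ p p′) (cong₂ ℤ._*_ q r′))
              (cong₂ ℤ._+_ (cong₂ ℤ._*_ p q′) (cong₂ ℤ._*_ q s′))
              (cong₂ ℤ._+_ (cong₂ ℤ._*_ r p′) (cong₂ ℤ._*_ s r′))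
              (cong₂ ℤ._+_ (cong₂ ℤ._*_ r q′) (cong₂ ℤ._*_ s s′)) }
          }
        ; assoc = λ { (sl₂ a b c d _) (sl₂ a′ b′ c′ d′ _) (sl₂ a″ b″ c″ d″ _) → entries≡
            (row-assoc a b a′ b′ c′ d′ a″ c″) (row-assoc a b a′ b′ c′ d′ b″ d″)
            (row-assoc c d a′ b′ c′ d′ a″ c″) (row-assoc c d a′ b′ c′ d′ b″ d″) }
        }
      ; identity = (λ { (sl₂ a b c d _) → entries≡ (idˡ₁ a c) (idˡ₁ b d) (idˡ₂ a c) (idˡ₂ b d) })
                 , (λ { (sl₂ a b c d _) → entries≡ (idʳ₁ a b) (idʳ₂ a b) (idʳ₁ c d) (idʳ₂ c d) })
      }
    ; inverse = (λ { (sl₂ a b c d δ) → entries≡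
                  (≡.trans (inv₁ a b c d) δ) (inv₂ b d) (inv₃ a c) (≡.trans (inv₄ a b c d) δ) })
              , (λ { (sl₂ a b c d δ) → entries≡
                  (≡.trans (inv₅ a b c d) δ) (inv₆ a b) (inv₇ c d) (≡.trans (inv₈ a b c d) δ) })
    ; ⁻¹-cong = λ { (entries≡ p q r s) → entries≡ s (cong ℤ.-_ q) (cong ℤ.-_ r) p }
    }
  }

S T : SL₂
S = sl₂ 0ℤ -1ℤ 1ℤ 0ℤ ≡.refl
T = sl₂ 1ℤ 1ℤ 0ℤ 1ℤ ≡.refl

module LinearAlgebra (K : CommutativeRing 0ℓ 0ℓ) where
  open CommutativeRing K hiding (zero) renaming (Carrier to 𝕂)
  open import Algebra.Properties.Ring ring using (-0#≈0#)

  VectorSpace : Set₁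
  VectorSpace = LeftModule ring 0ℓ 0ℓ

  module _ (V : VectorSpace) where
    open LeftModule V
    open import Algebra.Properties.CommutativeMonoid.Sum +ᴹ-commutativeMonoid using (sum)

    Span : ∀ {n} → (Fin n → Carrierᴹ) → Pred Carrierᴹ 0ℓ
    Span {n} f v = Σ[ c ∈ (Fin n → 𝕂) ] v ≈ᴹ sum (λ k → c k *ₗ f k)

  -- A module over the group algebra K G is given by its underlying K-module
  -- together with the K-linear action of G.
  record GModule (G : Group 0ℓ 0ℓ) : Set₁ where
    open Group G using (_∙_; ε) renaming (Carrier to ∣G∣; _≈_ to _≈ᴳ_)
    field
      space : VectorSpace
    open LeftModule space public
    infixr 7 _▷_
    field
      _▷_     : ∣G∣ → Carrierᴹ → Carrierᴹ
      ▷-cong  : ∀ {g h v w} → g ≈ᴳ h → v ≈ᴹ w → g ▷ v ≈ᴹ h ▷ w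
      ▷-+ᴹ    : ∀ g v w → g ▷ (v +ᴹ w) ≈ᴹ (g ▷ v) +ᴹ (g ▷ w)
      ▷-*ₗ    : ∀ g c v → g ▷ (c *ₗ v) ≈ᴹ c *ₗ (g ▷ v)
      ▷-ε     : ∀ v → ε ▷ v ≈ᴹ v
      ▷-∙     : ∀ g h v → (g ∙ h) ▷ v ≈ᴹ g ▷ (h ▷ v)

  module _ {G : Group 0ℓ 0ℓ} where

    record IsSubmodule (V : GModule G) (P : Pred (GModule.Carrierᴹ V) 0ℓ) : Set where
      open GModule V
      field
        resp : ∀ {v w} → v ≈ᴹ w → P v → P w
        0∈   : P 0ᴹ
        +∈   : ∀ {v w} → P v → P w → P (v +ᴹ w)
        *∈   : ∀ c {v} → P v → P (c *ₗ v)
        ▷∈   : ∀ g {v} → P v → P (g ▷ v)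

      -∈ : ∀ {v} → P v → P (-ᴹ v)
      -∈ {v} p = resp (uniqueʳ‿-ᴹ v ((- 1#) *ₗ v) eq) (*∈ (- 1#) p)
        where
        open import Relation.Binary.Reasoning.Setoid ≈ᴹ-setoid
        eq : v +ᴹ (- 1#) *ₗ v ≈ᴹ 0ᴹ
        eq = begin
          v +ᴹ (- 1#) *ₗ v           ≈⟨ +ᴹ-congʳ (*ₗ-identityˡ v) ⟨
          1# *ₗ v +ᴹ (- 1#) *ₗ v     ≈⟨ *ₗ-distribʳ v 1# (- 1#) ⟨
          (1# + - 1#) *ₗ v           ≈⟨ *ₗ-congʳ (-‿inverseʳ 1#) ⟩
          0# *ₗ v                    ≈⟨ *ₗ-zeroˡ v ⟩
          0ᴹ                         ∎

    submodule : ∀ (V : GModule G) {P} → IsSubmodule V P → GModule G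
    submodule V {P} isSub = record
      { space = record
        { Carrierᴹ = Σ Carrierᴹ P
        ; _≈ᴹ_ = λ v w → proj₁ v ≈ᴹ proj₁ w
        ; _+ᴹ_ = λ { (v , p) (w , q) → v +ᴹ w , +∈ p q }
        ; _*ₗ_ = λ { c (v , p) → c *ₗ v , *∈ c p }
        ; 0ᴹ   = 0ᴹ , 0∈
        ; -ᴹ_  = λ { (v , p) → -ᴹ v , -∈ p }
        ; isLeftModule = record
          { isLeftSemimodule = record
            { +ᴹ-isCommutativeMonoid = record
              { isMonoid = record
                { isSemigroup = record
                  { isMagma = record
                    { isEquivalence = record { refl = ≈ᴹ-refl ; sym = ≈ᴹ-sym ; trans = ≈ᴹ-trans }
                    ; ∙-cong = +ᴹ-cong
                    }
                  ; assoc = λ _ _ _ → +ᴹ-assoc _ _ _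
                  }
                ; identity = (λ _ → +ᴹ-identityˡ _) , (λ _ → +ᴹ-identityʳ _)
                }
              ; comm = λ _ _ → +ᴹ-comm _ _
              }
            ; isPreleftSemimodule = record
              { *ₗ-cong = *ₗ-cong
              ; *ₗ-zeroˡ = λ _ → *ₗ-zeroˡ _
              ; *ₗ-distribʳ = λ _ _ _ → *ₗ-distribʳ _ _ _
              ; *ₗ-identityˡ = λ _ → *ₗ-identityˡ _
              ; *ₗ-assoc = λ _ _ _ → *ₗ-assoc _ _ _
              ; *ₗ-zeroʳ = λ _ → *ₗ-zeroʳ _
              ; *ₗ-distribˡ = λ _ _ _ → *ₗ-distribˡ _ _ _
              }
            }
          ; -ᴹ‿cong = -ᴹ‿cong
          ; -ᴹ‿inverse = (λ _ → -ᴹ‿inverseˡ _) , (λ _ → -ᴹ‿inverseʳ _)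
          }
        }
      ; _▷_    = λ { g (v , p) → g ▷ v , ▷∈ g p }
      ; ▷-cong = ▷-cong
      ; ▷-+ᴹ   = λ _ _ _ → ▷-+ᴹ _ _ _
      ; ▷-*ₗ   = λ _ _ _ → ▷-*ₗ _ _ _
      ; ▷-ε    = λ _ → ▷-ε _
      ; ▷-∙    = λ _ _ _ → ▷-∙ _ _ _
      }
      where
      open GModule V
      open IsSubmodule isSub

    -- The carrier is unchanged: v and w are identified when v - w lies in P.
    quotient : ∀ (V : GModule G) {P} → IsSubmodule V P → GModule G
    quotient V {P} isSub = record
      { space = record
        { Carrierᴹ = Carrierᴹ
        ; _≈ᴹ_ = _∼_
        ; _+ᴹ_ = _+ᴹ_
        ; _*ₗ_ = _*ₗ_
        ; 0ᴹ   = 0ᴹ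
        ; -ᴹ_  = -ᴹ_
        ; isLeftModule = record
          { isLeftSemimodule = record
            { +ᴹ-isCommutativeMonoid = record
              { isMonoid = record
                { isSemigroup = record
                  { isMagma = record
                    { isEquivalence = record
                      { refl  = ≈⇒∼ ≈ᴹ-refl
                      ; sym   = λ p → resp (neg-swap _ _) (-∈ p)
                      ; trans = λ p q → resp (telescope _ _ _) (+∈ p q)
                      }
                    ; ∙-cong = λ p q → resp (sum-diff _ _ _ _) (+∈ p q)
                    }
                  ; assoc = λ _ _ _ → ≈⇒∼ (+ᴹ-assoc _ _ _)
                  }
                ; identity = (λ _ → ≈⇒∼ (+ᴹ-identityˡ _)) , (λ _ → ≈⇒∼ (+ᴹ-identityʳ _))
                }
              ; comm = λ _ _ → ≈⇒∼ (+ᴹ-comm _ _)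
              }
            ; isPreleftSemimodule = record
              { *ₗ-cong = λ {c} {d} {v} {w} p q → ∼-trans (≈⇒∼ (*ₗ-congʳ p)) (resp (*-diff d v w) (*∈ d q))
              ; *ₗ-zeroˡ = λ _ → ≈⇒∼ (*ₗ-zeroˡ _)
              ; *ₗ-distribʳ = λ _ _ _ → ≈⇒∼ (*ₗ-distribʳ _ _ _)
              ; *ₗ-identityˡ = λ _ → ≈⇒∼ (*ₗ-identityˡ _)
              ; *ₗ-assoc = λ _ _ _ → ≈⇒∼ (*ₗ-assoc _ _ _)
              ; *ₗ-zeroʳ = λ _ → ≈⇒∼ (*ₗ-zeroʳ _)
              ; *ₗ-distribˡ = λ _ _ _ → ≈⇒∼ (*ₗ-distribˡ _ _ _)
              }
            }
          ; -ᴹ‿cong = λ p → resp (≈ᴹ-sym (⁻¹-∙-comm _ _)) (-∈ p)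
          ; -ᴹ‿inverse = (λ _ → ≈⇒∼ (-ᴹ‿inverseˡ _)) , (λ _ → ≈⇒∼ (-ᴹ‿inverseʳ _))
          }
        }
      ; _▷_    = _▷_
      ; ▷-cong = λ {g} {h} {v} {w} p q → ∼-trans (≈⇒∼ (▷-cong p ≈ᴹ-refl)) (resp (▷-diff h v w) (▷∈ h q))
      ; ▷-+ᴹ   = λ _ _ _ → ≈⇒∼ (▷-+ᴹ _ _ _)
      ; ▷-*ₗ   = λ _ _ _ → ≈⇒∼ (▷-*ₗ _ _ _)
      ; ▷-ε    = λ _ → ≈⇒∼ (▷-ε _)
      ; ▷-∙    = λ _ _ _ → ≈⇒∼ (▷-∙ _ _ _)
      }
      where
      open GModule V
      open IsSubmodule isSub
      open import Algebra.Properties.AbelianGroup +ᴹ-abelianGroup using (⁻¹-∙-comm; ⁻¹-involutive)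
      open import Algebra.Properties.CommutativeSemigroup
        (CommutativeMonoid.commutativeSemigroup +ᴹ-commutativeMonoid) using (interchange)

      _∼_ : Carrierᴹ → Carrierᴹ → Set
      v ∼ w = P (v +ᴹ -ᴹ w)

      ≈⇒∼ : ∀ {v w} → v ≈ᴹ w → v ∼ w
      ≈⇒∼ {v} {w} p = resp (≈ᴹ-sym (≈ᴹ-trans (+ᴹ-congʳ p) (-ᴹ‿inverseʳ w))) 0∈

      neg-swap : ∀ v w → -ᴹ (v +ᴹ -ᴹ w) ≈ᴹ w +ᴹ -ᴹ v
      neg-swap v w = ≈ᴹ-trans (≈ᴹ-sym (⁻¹-∙-comm v (-ᴹ w)))
        (≈ᴹ-trans (+ᴹ-comm _ _) (+ᴹ-congʳ (⁻¹-involutive w)))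

      telescope : ∀ u v w → (u +ᴹ -ᴹ v) +ᴹ (v +ᴹ -ᴹ w) ≈ᴹ u +ᴹ -ᴹ w
      telescope u v w = ≈ᴹ-trans (≈ᴹ-sym (+ᴹ-assoc _ v (-ᴹ w)))
        (+ᴹ-congʳ (≈ᴹ-trans (+ᴹ-assoc u (-ᴹ v) v) (≈ᴹ-trans (+ᴹ-congˡ (-ᴹ‿inverseˡ v)) (+ᴹ-identityʳ u))))

      ∼-trans : ∀ {u v w} → u ∼ v → v ∼ w → u ∼ w
      ∼-trans p q = resp (telescope _ _ _) (+∈ p q)

      sum-diff : ∀ v w x y → (v +ᴹ -ᴹ w) +ᴹ (x +ᴹ -ᴹ y) ≈ᴹ (v +ᴹ x) +ᴹ -ᴹ (w +ᴹ y)
      sum-diff v w x y = ≈ᴹ-trans (interchange v (-ᴹ w) x (-ᴹ y)) (+ᴹ-congˡ (⁻¹-∙-comm w y))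

      additive⇒diff : (f : Carrierᴹ → Carrierᴹ) → (∀ {v w} → v ≈ᴹ w → f v ≈ᴹ f w) →
        f 0ᴹ ≈ᴹ 0ᴹ → (∀ v w → f (v +ᴹ w) ≈ᴹ f v +ᴹ f w) → ∀ v w → f (v +ᴹ -ᴹ w) ≈ᴹ f v +ᴹ -ᴹ f w
      additive⇒diff f f-cong f-0 f-+ v w = ≈ᴹ-trans (f-+ v (-ᴹ w))
        (+ᴹ-congˡ (uniqueʳ‿-ᴹ (f w) (f (-ᴹ w))
          (≈ᴹ-trans (≈ᴹ-sym (f-+ w (-ᴹ w))) (≈ᴹ-trans (f-cong (-ᴹ‿inverseʳ w)) f-0))))

      *-diff : ∀ c v w → c *ₗ (v +ᴹ -ᴹ w) ≈ᴹ c *ₗ v +ᴹ -ᴹ (c *ₗ w)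
      *-diff c = additive⇒diff (c *ₗ_) *ₗ-congˡ (*ₗ-zeroʳ c) (*ₗ-distribˡ c)

      ▷-0 : ∀ g → g ▷ 0ᴹ ≈ᴹ 0ᴹ
      ▷-0 g = ≈ᴹ-trans (▷-cong (Group.refl G) (≈ᴹ-sym (*ₗ-zeroˡ 0ᴹ)))
        (≈ᴹ-trans (▷-*ₗ g 0# 0ᴹ) (*ₗ-zeroˡ _))

      ▷-diff : ∀ g v w → g ▷ (v +ᴹ -ᴹ w) ≈ᴹ (g ▷ v) +ᴹ -ᴹ (g ▷ w)
      ▷-diff g = additive⇒diff (g ▷_) (▷-cong (Group.refl G)) (▷-0 g) (▷-+ᴹ g)

    infix 4 _≅_
    record _≅_ (V W : GModule G) : Set where
      private
        module V = GModule V
        module W = GModule W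
      open LeftModuleMorphisms V.rawLeftModule W.rawLeftModule
      field
        ⟦_⟧                    : V.Carrierᴹ → W.Carrierᴹ
        isLeftModuleIsomorphism : IsLeftModuleIsomorphism ⟦_⟧
        equivariant            : ∀ g v → ⟦ g V.▷ v ⟧ W.≈ᴹ g W.▷ ⟦ v ⟧

    record IsFiltration (V : GModule G) (F : ℕ → Pred (GModule.Carrierᴹ V) 0ℓ) : Set where
      open GModule V
      field
        isSubmodule : ∀ i → IsSubmodule V (F i)
        bottom      : ∀ {v} → F 0 v → v ≈ᴹ 0ᴹ
        ascending   : ∀ i → F i ⊆ F (suc i)

      -- F (suc i) / F i
      gradedPiece : ℕ → GModule G
      gradedPiece i = quotient (submodule V (isSubmodule (suc i))) {F i ∘ proj₁} record
        { resp = resp ; 0∈ = 0∈ ; +∈ = +∈ ; *∈ = λ c → *∈ c ; ▷∈ = λ g → ▷∈ g }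
        where open IsSubmodule (isSubmodule i)

  -- Column vectors of length 2, with SL(2,ℤ) acting by matrix multiplication.
  columnVectors : RingHomomorphism (CommutativeRing.rawRing ℤₚ.+-*-commutativeRing) rawRing → GModule SL₂ℤ
  columnVectors ℤ→K = record
    { space = record
      { Carrierᴹ = 𝕂 × 𝕂
      ; _≈ᴹ_ = λ { (x , y) (x′ , y′) → x ≈ x′ × y ≈ y′ }
      ; _+ᴹ_ = λ { (x , y) (x′ , y′) → x + x′ , y + y′ }
      ; _*ₗ_ = λ { z (x , y) → z * x , z * y }
      ; 0ᴹ   = 0# , 0#
      ; -ᴹ_  = λ { (x , y) → - x , - y }
      ; isLeftModule = record
        { isLeftSemimodule = record
          { +ᴹ-isCommutativeMonoid = record
            { isMonoid = record
              { isSemigroup = record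
                { isMagma = record
                  { isEquivalence = record
                    { refl  = refl , refl
                    ; sym   = λ { (p , q) → sym p , sym q }
                    ; trans = λ { (p , q) (p′ , q′) → trans p p′ , trans q q′ }
                    }
                  ; ∙-cong = λ { (p , q) (p′ , q′) → +-cong p p′ , +-cong q q′ }
                  }
                ; assoc = λ _ _ _ → +-assoc _ _ _ , +-assoc _ _ _
                }
              ; identity = (λ _ → +-identityˡ _ , +-identityˡ _) , (λ _ → +-identityʳ _ , +-identityʳ _)
              }
            ; comm = λ _ _ → +-comm _ _ , +-comm _ _
            }
          ; isPreleftSemimodule = record
            { *ₗ-cong = λ { p (q , r) → *-cong p q , *-cong p r }
            ; *ₗ-zeroˡ = λ _ → zeroˡ _ , zeroˡ _
            ; *ₗ-distribʳ = λ _ _ _ → distribʳ _ _ _ , distribʳ _ _ _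
            ; *ₗ-identityˡ = λ _ → *-identityˡ _ , *-identityˡ _
            ; *ₗ-assoc = λ _ _ _ → *-assoc _ _ _ , *-assoc _ _ _
            ; *ₗ-zeroʳ = λ _ → zeroʳ _ , zeroʳ _
            ; *ₗ-distribˡ = λ _ _ _ → distribˡ _ _ _ , distribˡ _ _ _
            }
          }
        ; -ᴹ‿cong = λ { (p , q) → -‿cong p , -‿cong q }
        ; -ᴹ‿inverse = (λ _ → -‿inverseˡ _ , -‿inverseˡ _) , (λ _ → -‿inverseʳ _ , -‿inverseʳ _)
        }
      }
    ; _▷_    = λ { (sl₂ a b c d _) (x , y) → ι a * x + ι b * y , ι c * x + ι d * y }
    ; ▷-cong = λ { (entries≡ ≡.refl ≡.refl ≡.refl ≡.refl) (p , q) →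
        +-cong (*-congˡ p) (*-congˡ q) , +-cong (*-congˡ p) (*-congˡ q) }
    ; ▷-+ᴹ   = λ { (sl₂ a b c d _) (x , y) (x′ , y′) → row-+ (ι a) (ι b) x y x′ y′ , row-+ (ι c) (ι d) x y x′ y′ }
    ; ▷-*ₗ   = λ { (sl₂ a b c d _) z (x , y) → row-* (ι a) (ι b) z x y , row-* (ι c) (ι d) z x y }
    ; ▷-ε    = λ { (x , y) →
        trans (+-cong (trans (*-congʳ ι-1) (*-identityˡ x)) (trans (*-congʳ ι-0) (zeroˡ y))) (+-identityʳ x)
      , trans (+-cong (trans (*-congʳ ι-0) (zeroˡ x)) (trans (*-congʳ ι-1) (*-identityˡ y))) (+-identityˡ y) }
    ; ▷-∙    = λ { (sl₂ a b c d _) (sl₂ a′ b′ c′ d′ _) (x , y) →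
        row-∙ a b a′ b′ c′ d′ x y , row-∙ c d a′ b′ c′ d′ x y }
    }
    where
    open RingHomomorphism ℤ→K using () renaming
      (⟦_⟧ to ι; +-homo to ι-+; *-homo to ι-*; 0#-homo to ι-0; 1#-homo to ι-1)
    open import Algebra.Properties.CommutativeSemigroup +-commutativeSemigroup using (interchange)
    open import Algebra.Properties.CommutativeSemigroup *-commutativeSemigroup using (x∙yz≈y∙xz)

    abstract
      row-+ : ∀ a b x y x′ y′ → a * (x + x′) + b * (y + y′) ≈ (a * x + b * y) + (a * x′ + b * y′)
      row-+ a b x y x′ y′ = trans (+-cong (distribˡ a x x′) (distribˡ b y y′)) (interchange _ _ _ _)

      row-* : ∀ a b z x y → a * (z * x) + b * (z * y) ≈ z * (a * x + b * y)
      row-* a b z x y = trans (+-cong (x∙yz≈y∙xz a z x) (x∙yz≈y∙xz b z y)) (sym (distribˡ z _ _))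

      entry-* : ∀ a b a′ c′ x → ι (a ℤ.* a′ ℤ.+ b ℤ.* c′) * x
        ≈ ι a * (ι a′ * x) + ι b * (ι c′ * x)
      entry-* a b a′ c′ x = trans
        (*-congʳ (trans (ι-+ (a ℤ.* a′) (b ℤ.* c′)) (+-cong (ι-* a a′) (ι-* b c′))))
        (trans (distribʳ x _ _) (+-cong (*-assoc _ _ _) (*-assoc _ _ _)))

      row-∙ : ∀ a b a′ b′ c′ d′ x y →
        ι (a ℤ.* a′ ℤ.+ b ℤ.* c′) * x + ι (a ℤ.* b′ ℤ.+ b ℤ.* d′) * y
          ≈ ι a * (ι a′ * x + ι b′ * y) + ι b * (ι c′ * x + ι d′ * y)
      row-∙ a b a′ b′ c′ d′ x y = trans (+-cong (entry-* a b a′ c′ x) (entry-* a b b′ d′ y))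
        (trans (interchange _ _ _ _) (+-cong (sym (distribˡ (ι a) _ _)) (sym (distribˡ (ι b) _ _))))

  -- E consists of the finitely supported sequences.  Indices start at 0, so that index n
  -- stands for the natural number n + 1 of the 1-based convention.

  record E : Set where
    field
      coeff  : ℕ → 𝕂
      bound  : ℕ
      finite : ∀ i → bound ℕ.≤ i → coeff i ≈ 0#
  open E public

  infix 4 _≈ᴱ_
  infixl 6 _+ᴱ_
  infixr 7 _*ᴱ_

  _≈ᴱ_ : E → E → Set
  v ≈ᴱ w = ∀ i → coeff v i ≈ coeff w i

  0ᴱ : E
  0ᴱ = record { coeff = λ _ → 0# ; bound = 0 ; finite = λ _ _ → refl }

  _+ᴱ_ : E → E → E
  v +ᴱ w = record
    { coeff  = λ i → coeff v i + coeff w i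
    ; bound  = bound v ⊔ bound w
    ; finite = λ i p → trans
        (+-cong (finite v i (ℕₚ.m⊔n≤o⇒m≤o (bound v) (bound w) p))
                (finite w i (ℕₚ.m⊔n≤o⇒n≤o (bound v) (bound w) p)))
        (+-identityˡ 0#)
    }

  _*ᴱ_ : 𝕂 → E → E
  c *ᴱ v = record
    { coeff  = λ i → c * coeff v i
    ; bound  = bound v
    ; finite = λ i p → trans (*-congˡ (finite v i p)) (zeroʳ c)
    }

  -ᴱ_ : E → E
  -ᴱ v = record
    { coeff  = λ i → - coeff v i
    ; bound  = bound v
    ; finite = λ i p → trans (-‿cong (finite v i p)) -0#≈0#
    }

  E-space : VectorSpace
  E-space = record
    { Carrierᴹ = E ; _≈ᴹ_ = _≈ᴱ_ ; _+ᴹ_ = _+ᴱ_ ; _*ₗ_ = _*ᴱ_ ; 0ᴹ = 0ᴱ ; -ᴹ_ = -ᴱ_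
    ; isLeftModule = record
      { isLeftSemimodule = record
        { +ᴹ-isCommutativeMonoid = record
          { isMonoid = record
            { isSemigroup = record
              { isMagma = record
                { isEquivalence = record
                  { refl  = λ _ → refl
                  ; sym   = λ p i → sym (p i)
                  ; trans = λ p q i → trans (p i) (q i)
                  }
                ; ∙-cong = λ p q i → +-cong (p i) (q i)
                }
              ; assoc = λ _ _ _ _ → +-assoc _ _ _
              }
            ; identity = (λ _ _ → +-identityˡ _) , (λ _ _ → +-identityʳ _)
            }
          ; comm = λ _ _ _ → +-comm _ _
          }
        ; isPreleftSemimodule = record
          { *ₗ-cong = λ p q i → *-cong p (q i)
          ; *ₗ-zeroˡ = λ _ _ → zeroˡ _
          ; *ₗ-distribʳ = λ _ _ _ _ → distribʳ _ _ _
          ; *ₗ-identityˡ = λ _ _ → *-identityˡ _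
          ; *ₗ-assoc = λ _ _ _ _ → *-assoc _ _ _
          ; *ₗ-zeroʳ = λ _ _ → zeroʳ _
          ; *ₗ-distribˡ = λ _ _ _ _ → distribˡ _ _ _
          }
        }
      ; -ᴹ‿cong = λ p i → -‿cong (p i)
      ; -ᴹ‿inverse = (λ _ _ → -‿inverseˡ _) , (λ _ _ → -‿inverseʳ _)
      }
    }

  e : ℕ → E
  e n = record
    { coeff  = λ i → if does (i ℕₚ.≟ n) then 1# else 0#
    ; bound  = suc n
    ; finite = λ i p → reflexive (cong (λ b → if b then 1# else 0#) (dec-false (i ℕₚ.≟ n) (ℕₚ.<⇒≢ p ∘ ≡.sym)))
    }

  -- A matrix with finitely many non-zero entries in each column is the same as
  -- a sequence of columns M j = M e_j in E.
  𝒜 : Set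
  𝒜 = ℕ → E

  entry : 𝒜 → ℕ → ℕ → 𝕂
  entry M i j = coeff (M j) i

  -- Σ_k v_k M_k for a sequence M of vectors and a finitely supported v.
  module _ (V : VectorSpace) where
    open LeftModule V
    open import Algebra.Properties.CommutativeMonoid.Sum +ᴹ-commutativeMonoid
      using (sum; sum-cong-≋; ∑-distrib-+)

    combination : E → (ℕ → Carrierᴹ) → Carrierᴹ
    combination v M = sum {bound v} (λ k → coeff v (toℕ k) *ₗ M (toℕ k))

    private
      Σ< : ℕ → (ℕ → Carrierᴹ) → Carrierᴹ
      Σ< n f = sum {n} (f ∘ toℕ)

      Σ<-zero : ∀ n f → (∀ k → f k ≈ᴹ 0ᴹ) → Σ< n f ≈ᴹ 0ᴹ
      Σ<-zero zero    f f≈0 = ≈ᴹ-refl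
      Σ<-zero (suc n) f f≈0 = ≈ᴹ-trans (+ᴹ-cong (f≈0 0) (Σ<-zero n (f ∘ suc) (f≈0 ∘ suc))) (+ᴹ-identityˡ 0ᴹ)

      Σ<-extend : ∀ {n m} → n ℕ.≤ m → ∀ f → (∀ k → n ℕ.≤ k → f k ≈ᴹ 0ᴹ) → Σ< m f ≈ᴹ Σ< n f
      Σ<-extend {m = m} ℕ.z≤n f f≈0 = Σ<-zero m f (λ k → f≈0 k ℕ.z≤n)
      Σ<-extend (ℕ.s≤s n≤m)   f f≈0 = +ᴹ-congˡ (Σ<-extend n≤m (f ∘ suc) (λ k p → f≈0 (suc k) (ℕ.s≤s p)))

      Σ<-*ₗ : ∀ n c f → Σ< n (λ k → c *ₗ f k) ≈ᴹ c *ₗ Σ< n f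
      Σ<-*ₗ zero    c f = ≈ᴹ-sym (*ₗ-zeroʳ c)
      Σ<-*ₗ (suc n) c f = ≈ᴹ-trans (+ᴹ-congˡ (Σ<-*ₗ n c (f ∘ suc))) (≈ᴹ-sym (*ₗ-distribˡ c (f 0) _))

    combination-extend : ∀ v M {m} → bound v ℕ.≤ m →
      combination v M ≈ᴹ sum {m} (λ k → coeff v (toℕ k) *ₗ M (toℕ k))
    combination-extend v M p = ≈ᴹ-sym (Σ<-extend p (λ k → coeff v k *ₗ M k)
      (λ k q → ≈ᴹ-trans (*ₗ-cong (finite v k q) ≈ᴹ-refl) (*ₗ-zeroˡ (M k))))

    combination-cong : ∀ {v w M N} → v ≈ᴱ w → (∀ k → M k ≈ᴹ N k) → combination v M ≈ᴹ combination w N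
    combination-cong {v} {w} {M} {N} p q = ≈ᴹ-trans (combination-extend v M (ℕₚ.m≤m⊔n (bound v) (bound w)))
      (≈ᴹ-trans (sum-cong-≋ {bound v ⊔ bound w} (λ k → *ₗ-cong (p (toℕ k)) (q (toℕ k))))
        (≈ᴹ-sym (combination-extend w N (ℕₚ.m≤n⊔m (bound v) (bound w)))))

    combination-+ˡ : ∀ v w M → combination (v +ᴱ w) M ≈ᴹ combination v M +ᴹ combination w M
    combination-+ˡ v w M = ≈ᴹ-trans
      (sum-cong-≋ {bound v ⊔ bound w} (λ k → *ₗ-distribʳ (M (toℕ k)) (coeff v (toℕ k)) (coeff w (toℕ k))))
      (≈ᴹ-trans
        (∑-distrib-+ {bound v ⊔ bound w} (λ k → coeff v (toℕ k) *ₗ M (toℕ k)) (λ k → coeff w (toℕ k) *ₗ M (toℕ k)))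
        (+ᴹ-cong (≈ᴹ-sym (combination-extend v M (ℕₚ.m≤m⊔n (bound v) (bound w))))
                 (≈ᴹ-sym (combination-extend w M (ℕₚ.m≤n⊔m (bound v) (bound w))))))

    combination-+ʳ : ∀ v M N → combination v (λ k → M k +ᴹ N k) ≈ᴹ combination v M +ᴹ combination v N
    combination-+ʳ v M N = ≈ᴹ-trans
      (sum-cong-≋ {bound v} (λ k → *ₗ-distribˡ (coeff v (toℕ k)) (M (toℕ k)) (N (toℕ k))))
      (∑-distrib-+ {bound v} (λ k → coeff v (toℕ k) *ₗ M (toℕ k)) (λ k → coeff v (toℕ k) *ₗ N (toℕ k)))

    combination-*ˡ : ∀ c v M → combination (c *ᴱ v) M ≈ᴹ c *ₗ combination v M
    combination-*ˡ c v M = ≈ᴹ-trans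
      (sum-cong-≋ {bound v} (λ k → *ₗ-assoc c (coeff v (toℕ k)) (M (toℕ k))))
      (Σ<-*ₗ (bound v) c (λ k → coeff v k *ₗ M k))

    combination-image : ∀ (f : Carrierᴹ → Carrierᴹ) → f 0ᴹ ≈ᴹ 0ᴹ →
      (∀ x y → f (x +ᴹ y) ≈ᴹ f x +ᴹ f y) → (∀ c x → f (c *ₗ x) ≈ᴹ c *ₗ f x) →
      ∀ v M → f (combination v M) ≈ᴹ combination v (f ∘ M)
    combination-image f f-0 f-+ f-* v M = ≈ᴹ-trans (image (bound v) (λ k → coeff v k *ₗ M k))
      (sum-cong-≋ {bound v} (λ k → f-* (coeff v (toℕ k)) (M (toℕ k))))
      where
      image : ∀ n g → f (Σ< n g) ≈ᴹ Σ< n (f ∘ g)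
      image zero    g = f-0
      image (suc n) g = ≈ᴹ-trans (f-+ (g 0) _) (+ᴹ-congˡ (image n (g ∘ suc)))

  infixr 7 _·_
  infixl 7 _*𝒜_

  _·_ : 𝒜 → E → E
  M · v = combination E-space v M

  _*𝒜_ : 𝒜 → 𝒜 → 𝒜
  (M *𝒜 N) j = M · N j

  private
    module Coefficients where
      open import Algebra.Properties.CommutativeMonoid.Sum +-commutativeMonoid
        using (sum; sum-cong-≋; sum-replicate-zero)

      coeff-combination : ∀ v (M : 𝒜) i → coeff (M · v) i ≈ sum {bound v} (λ k → coeff v (toℕ k) * coeff (M (toℕ k)) i)
      coeff-combination v M i = go (bound v) (λ k → coeff v (toℕ k) *ᴱ M (toℕ k))
        where
        open import Algebra.Properties.CommutativeMonoid.Sum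
          (LeftModule.+ᴹ-commutativeMonoid E-space) using () renaming (sum to sumᴱ)
        go : ∀ n (f : Fin n → E) → coeff (sumᴱ f) i ≈ sum (λ k → coeff (f k) i)
        go zero    f = refl
        go (suc n) f = +-congˡ (go n (f ∘ Fin.suc))

      sum-zero : ∀ n (f : Fin n → 𝕂) → (∀ k → f k ≈ 0#) → sum f ≈ 0#
      sum-zero n f f≈0 = trans (sum-cong-≋ f≈0) (sum-replicate-zero n)

      rowˡ : ∀ n (c : ℕ → 𝕂) → (∀ k → n ℕ.≤ k → c k ≈ 0#) →
        ∀ i → sum {n} (λ k → c (toℕ k) * coeff (e (toℕ k)) i) ≈ c i
      rowˡ zero    c c≈0 i       = sym (c≈0 i ℕ.z≤n)
      rowˡ (suc n) c c≈0 zero    = trans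
        (+-cong (*-identityʳ (c 0)) (sum-zero n _ (λ k → zeroʳ (c (suc (toℕ k)))))) (+-identityʳ (c 0))
      rowˡ (suc n) c c≈0 (suc i) = trans
        (+-cong (zeroʳ (c 0)) (rowˡ n (c ∘ suc) (λ k p → c≈0 (suc k) (ℕ.s≤s p)) i))
        (+-identityˡ _)

      rowʳ : ∀ n (c : ℕ → 𝕂) → sum {suc n} (λ k → coeff (e n) (toℕ k) * c (toℕ k)) ≈ c n
      rowʳ zero    c = trans (+-identityʳ _) (*-identityˡ _)
      rowʳ (suc n) c = trans (+-cong (zeroˡ _) (rowʳ n (c ∘ suc))) (+-identityˡ _)

  abstract
    ·-cong : ∀ {M N v w} → (∀ j → M j ≈ᴱ N j) → v ≈ᴱ w → M · v ≈ᴱ N · w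
    ·-cong {M} {N} {v} {w} p q = combination-cong E-space {v} {w} {M} {N} q p

    ·-+ : ∀ M v w → M · (v +ᴱ w) ≈ᴱ M · v +ᴱ M · w
    ·-+ M v w = combination-+ˡ E-space v w M

    +-· : ∀ M N v → (λ j → M j +ᴱ N j) · v ≈ᴱ M · v +ᴱ N · v
    +-· M N v = combination-+ʳ E-space v M N

    ·-*ᴱ : ∀ M c v → M · (c *ᴱ v) ≈ᴱ c *ᴱ M · v
    ·-*ᴱ M c v = combination-*ˡ E-space c v M

    ·-assoc : ∀ M N v → (M *𝒜 N) · v ≈ᴱ M · (N · v)
    ·-assoc M N v i = sym (combination-image E-space (M ·_) (λ _ → refl) (·-+ M) (·-*ᴱ M) v N i)

    ·-identity : ∀ v → e · v ≈ᴱ v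
    ·-identity v i = trans (Coefficients.coeff-combination v e i)
      (Coefficients.rowˡ (bound v) (coeff v) (finite v) i)

    ·-e : ∀ M j → M · e j ≈ᴱ M j
    ·-e M j i = trans (Coefficients.coeff-combination (e j) M i)
      (Coefficients.rowʳ j (λ k → coeff (M k) i))

  𝒜-ring : Ring 0ℓ 0ℓ
  𝒜-ring = record
    { Carrier = 𝒜
    ; _≈_ = λ M N → ∀ j → M j ≈ᴱ N j
    ; _+_ = λ M N j → M j +ᴱ N j
    ; _*_ = _*𝒜_
    ; -_  = λ M j → -ᴱ M j
    ; 0#  = λ _ → 0ᴱ
    ; 1#  = e
    ; isRing = record
      { +-isAbelianGroup = record
        { isGroup = record
          { isMonoid = record
            { isSemigroup = record
              { isMagma = record
                { isEquivalence = record
                  { refl  = λ _ _ → refl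
                  ; sym   = λ p j i → sym (p j i)
                  ; trans = λ p q j i → trans (p j i) (q j i)
                  }
                ; ∙-cong = λ p q j i → +-cong (p j i) (q j i)
                }
              ; assoc = λ _ _ _ _ _ → +-assoc _ _ _
              }
            ; identity = (λ _ _ _ → +-identityˡ _) , (λ _ _ _ → +-identityʳ _)
            }
          ; inverse = (λ _ _ _ → -‿inverseˡ _) , (λ _ _ _ → -‿inverseʳ _)
          ; ⁻¹-cong = λ p j i → -‿cong (p j i)
          }
        ; comm = λ _ _ _ _ → +-comm _ _
        }
      ; *-cong = λ {M} {M′} {N} {N′} p q j → ·-cong {M} {M′} {N j} {N′ j} p (q j)
      ; *-assoc = λ L M N j → ·-assoc L M (N j)
      ; *-identity = (λ M j → ·-identity (M j)) , ·-e
      ; distrib = (λ L M N j → ·-+ L (M j) (N j)) , (λ L M N j → +-· M N (L j))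
      }
    }

  𝒜ˣ : Group 0ℓ 0ℓ
  𝒜ˣ = unitGroup (Ring.*-monoid 𝒜-ring)

  matrix : ∀ {G : RawGroup 0ℓ 0ℓ} → GroupHomomorphism G (Group.rawGroup 𝒜ˣ) → RawGroup.Carrier G → 𝒜
  matrix τ g = value (GroupHomomorphism.⟦_⟧ τ g)

  via : ∀ (G : Group 0ℓ 0ℓ) → GroupHomomorphism (Group.rawGroup G) (Group.rawGroup 𝒜ˣ) → GModule G
  via G τ = record
    { space  = E-space
    ; _▷_    = λ g v → matrix τ g · v
    ; ▷-cong = λ {g} {h} {v} {w} p q → ·-cong {value ⟦ g ⟧} {value ⟦ h ⟧} {v} {w} (⟦⟧-cong p) q
    ; ▷-+ᴹ   = λ g → ·-+ (value ⟦ g ⟧)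
    ; ▷-*ₗ   = λ g → ·-*ᴱ (value ⟦ g ⟧)
    ; ▷-ε    = λ v i → trans (·-cong {value ⟦ Group.ε G ⟧} {e} {v} {v} ε-homo (λ _ → refl) i) (·-identity v i)
    ; ▷-∙    = λ g h v i → trans
        (·-cong {value ⟦ Group._∙_ G g h ⟧} {value ⟦ g ⟧ *𝒜 value ⟦ h ⟧} {v} {v} (homo g h) (λ _ → refl) i)
        (·-assoc (value ⟦ g ⟧) (value ⟦ h ⟧) v i)
    }
    where open GroupHomomorphism τ

  J∞ : 𝒜
  J∞ j = record
    { coeff  = λ i → if does (j ℕₚ.≟ i) ∨ does (j ℕₚ.≟ suc i) then 1# else 0#
    ; bound  = suc j
    ; finite = λ i p → reflexive (cong (λ b → if b then 1# else 0#) (cong₂ _∨_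
        (dec-false (j ℕₚ.≟ i) (ℕₚ.<⇒≢ p))
        (dec-false (j ℕₚ.≟ suc i) (ℕₚ.<⇒≢ (ℕₚ.m≤n⇒m≤1+n p)))))
    }

open LinearAlgebra ℂ-commutativeRing public

E⟨_⟩ : ℕ → Pred E 0ℓ
E⟨ i ⟩ = Span E-space {2 ℕ.* i} (e ∘ toℕ)

private
  abstract
    /1-toℚᵘ : ∀ n → ℚ.toℚᵘ (n ℚ./ 1) ℚᵘ.≃ mkℚᵘ n 0
    /1-toℚᵘ n = ℚₚ.toℚᵘ-fromℚᵘ (mkℚᵘ n 0)

    /1-+ : ∀ m n → (m ℤ.+ n) ℚ./ 1 ≡ (m ℚ./ 1) ℚ.+ (n ℚ./ 1)
    /1-+ m n = ℚₚ.toℚᵘ-injective (ℚᵘₚ.≃-trans (/1-toℚᵘ (m ℤ.+ n)) (ℚᵘₚ.≃-sym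
      (ℚᵘₚ.≃-trans (ℚₚ.toℚᵘ-homo-+ (m ℚ./ 1) (n ℚ./ 1))
        (ℚᵘₚ.≃-trans (ℚᵘₚ.+-cong (/1-toℚᵘ m) (/1-toℚᵘ n)) (*≡* (over-1 m n))))))
      where
      over-1 : ∀ m n → (m ℤ.* 1ℤ ℤ.+ n ℤ.* 1ℤ) ℤ.* 1ℤ ≡ (m ℤ.+ n) ℤ.* 1ℤ
      over-1 = ℤ-solver.solve-∀

    /1-* : ∀ m n → (m ℤ.* n) ℚ./ 1 ≡ (m ℚ./ 1) ℚ.* (n ℚ./ 1)
    /1-* m n = ℚₚ.toℚᵘ-injective (ℚᵘₚ.≃-trans (/1-toℚᵘ (m ℤ.* n)) (ℚᵘₚ.≃-sym
      (ℚᵘₚ.≃-trans (ℚₚ.toℚᵘ-homo-* (m ℚ./ 1) (n ℚ./ 1))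
        (ℚᵘₚ.*-cong (/1-toℚᵘ m) (/1-toℚᵘ n)))))

module _ where
  open CommutativeRing ℂ-commutativeRing
  private
    module ℝᴿ = CommutativeRing ℝ-commutativeRing
    open Complexification ℝ-commutativeRing using (real-+; real-*)

  fromℤ-cong : ∀ {m n} → m ≡ n → fromℤ m ≈ fromℤ n
  fromℤ-cong p = reflexive (cong fromℤ p)

  fromℤ-+ : ∀ m n → fromℤ (m ℤ.+ n) ≈ fromℤ m + fromℤ n
  fromℤ-+ m n = trans
    (≡⇒≈ℝ {fromℚ ((m ℤ.+ n) ℚ./ 1)} {fromℚ (m ℚ./ 1) +ℝ fromℚ (n ℚ./ 1)} (λ _ → /1-+ m n) ,ᶜ ℝᴿ.refl)
    (real-+ (fromℚ (m ℚ./ 1)) (fromℚ (n ℚ./ 1)))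

  fromℤ-* : ∀ m n → fromℤ (m ℤ.* n) ≈ fromℤ m * fromℤ n
  fromℤ-* m n = trans
    (≡⇒≈ℝ {fromℚ ((m ℤ.* n) ℚ./ 1)} {fromℚ (m ℚ./ 1) *ℝ fromℚ (n ℚ./ 1)} (λ _ → /1-* m n) ,ᶜ ℝᴿ.refl)
    (real-* (fromℚ (m ℚ./ 1)) (fromℚ (n ℚ./ 1)))

  fromℤ-neg : ∀ n → fromℤ (ℤ.- n) ≈ - fromℤ n
  fromℤ-neg n = uniqueʳ-⁻¹ (fromℤ n) (fromℤ (ℤ.- n))
    (trans (sym (fromℤ-+ n (ℤ.- n))) (fromℤ-cong (ℤₚ.+-inverseʳ n)))

  ℤ→ℂ : RingHomomorphism (CommutativeRing.rawRing ℤₚ.+-*-commutativeRing) rawRing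
  ℤ→ℂ = record
    { ⟦_⟧ = fromℤ
    ; isRingHomomorphism = record
      { isSemiringHomomorphism = record
        { isNearSemiringHomomorphism = record
          { +-isMonoidHomomorphism = record
            { isMagmaHomomorphism = record
              { isRelHomomorphism = record { cong = fromℤ-cong }
              ; homo = fromℤ-+
              }
            ; ε-homo = refl
            }
          ; *-homo = fromℤ-*
          }
        ; 1#-homo = refl
        }
      ; -‿homo = fromℤ-neg
      }
    }

standard : GModule SL₂ℤ
standard = columnVectors ℤ→ℂ

module Submission where

-- Let N shift the basis down, so that J∞ = J = 1 + N.  On the dual ℤ[[t]] of the lattice
-- spanned by the eₙ, N is multiplication by t.  A matrix W with J W J = W + J commutes
-- with s = N²J⁻¹ = J + J⁻¹ − 2 and W² commutes with N, so W is determined by its first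
-- row, and W² = −1 has only to be checked in the first row.  Choose that row to be −tκ,
-- where κ = 1 − sκ² is the Catalan series in −s.  On the basis 1, t of ℤ[[t]] over ℤ[[s]],
-- W then acts by 1 ↦ −tκ and t ↦ 1 + sκ, and W² = −(κ + sκ²) = −1.  The relations W² = −1
-- and (W J)³ = −1 give the representation, as SL(2,ℤ) = ⟨σ, ρ ∣ σ² = ρ³, σ⁴ = 1⟩.
-- The rows of W obey a linear recursion with bounded integer coefficients, and so do the
-- powers of κ, from κᵐ⁺¹ = κᵐ − sκᵐ⁺²; hence integrality and the exponential bound.

open import Level using (0ℓ)
open import Algebra.Bundles using (CommutativeRing; Group; Monoid; Ring)
open import Algebra.Module.Bundles using (LeftModule)
open import Algebra.Morphism.Bundles using (GroupHomomorphism; RingHomomorphism)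
open import Data.Bool.Base using (Bool; true; false; not; if_then_else_; _∨_)
open import Data.Empty using (⊥; ⊥-elim)
open import Data.Fin.Base as Fin using (Fin; toℕ)
import Data.Fin.Properties as Finₚ
open import Data.Integer.Base as ℤ using (ℤ; +_; -[1+_]; 0ℤ; 1ℤ; -1ℤ)
import Data.Integer.DivMod as ℤ-DivMod
import Data.Integer.Properties as ℤₚ
import Data.Integer.Tactic.RingSolver as ℤ-solver
open import Data.List.Base using (List; []; _∷_; _++_)
open import Data.Nat.Base as ℕ using (ℕ; zero; suc)
import Data.Nat.Properties as ℕₚ
import Data.Nat.Tactic.RingSolver as ℕ-solver
open import Data.Product using (Σ-syntax; _×_; _,_; proj₁; proj₂)
open import Data.Rational.Base as ℚ using (ℚ; 0ℚ)
import Data.Rational.Properties as ℚₚ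
open import Data.Rational.Unnormalised.Base as ℚᵘ using (mkℚᵘ)
import Data.Rational.Unnormalised.Properties as ℚᵘₚ
open import Data.Sum.Base using (_⊎_; inj₁; inj₂)
open import Function.Base using (_∘_)
open import Relation.Binary.PropositionalEquality as ≡ using (_≡_; _≢_; cong; cong₂; subst; subst₂)
open import Relation.Nullary.Decidable using (does; dec-false; dec-true)

open import Defs using (module LinearAlgebra; SL₂; sl₂; _*SL₂_; module _≈SL₂_; _≈SL₂_; entries≡; SL₂ℤ; S; T)

-- The presentation of SL(2,ℤ)

-- The relation `J W J = W + J` is the minimal polynomial of `S T` in disguise: `(S T)² = S T − 1`
-- reads `W J W J = W J − 1`, and `W² = −1` lets the left factor `W` be cancelled. What it gains is
-- linearity in `W`. Written as `N W = J (1 − W N)`, it gives every row of `W` below the first from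
-- earlier columns and leaves the first row free. The quadratic equation `W² = −1` then has to be
-- met by that row alone. For a row `−t f` with `f` a series in `s`, the first row of `W²` comes out
-- as `−(f + s f²)`, so `f + s f² = 1`, which forces `f = κ`. The filtration is not imposed: the
-- linear recursion makes the subdiagonal of `W` alternate between 1 and 0, and each zero closes a 2
-- by 2 block. Block `k` is `Tᵏ S T⁻ᵏ` rather than `S`, hence a twist in the isomorphism with the
-- standard module. No formula for the image of a general matrix is available, so each statement
-- about all of SL(2,ℤ) is reduced to generators. The construction lives over ℤ, which makes
-- integrality automatic, and is carried to ℂ entry by entry.

data Generator : Set where
  σ ρ : Generator

Word : Set
Word = List Generator

-- The elements ±ρᵉ P σᶠ, with e < 3 and P a product of the matrices
-- upper = (1 1; 0 1) = σ³ρ and lower = (1 0; 1 1) = σ³ρ².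
data Elementary : Set where
  upper lower : Elementary

data Rotation : Set where
  ρ⁰ ρ¹ ρ² : Rotation

record NormalForm : Set where
  constructor normal
  field
    negative : Bool
    rotation : Rotation
    positive : List Elementary
    flipped  : Bool

infixr 5 _◁_

-- The rules are `σ upper = ρ`, `σ lower = ρ²`, `σ ρ = −upper`, `σ ρ² = −lower` and `σ² = ρ³ = −1`,
-- all consequences of the two relations once -1 is read as the central element `σ²`.
_◁_ : Generator → NormalForm → NormalForm
σ ◁ normal n ρ⁰ []          false = normal n ρ⁰ [] true
σ ◁ normal n ρ⁰ []          true  = normal (not n) ρ⁰ [] false
σ ◁ normal n ρ⁰ (upper ∷ p) f     = normal n ρ¹ p f
σ ◁ normal n ρ⁰ (lower ∷ p) f     = normal n ρ² p f
σ ◁ normal n ρ¹ p           f     = normal (not n) ρ⁰ (upper ∷ p) f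
σ ◁ normal n ρ² p           f     = normal (not n) ρ⁰ (lower ∷ p) f
ρ ◁ normal n ρ⁰ p           f     = normal n ρ¹ p f
ρ ◁ normal n ρ¹ p           f     = normal n ρ² p f
ρ ◁ normal n ρ² p           f     = normal (not n) ρ⁰ p f

normalise : Word → NormalForm
normalise []      = normal false ρ⁰ [] false
normalise (x ∷ w) = x ◁ normalise w

-- Since `σ⁴ = 1` and `ρ⁶ = σ⁴ = 1`, the powers `σ³` and `ρ⁵` serve as inverses. Words therefore
-- need no inverse letters and can be evaluated in a monoid.
inverse : Word → Word
inverse []      = []
inverse (σ ∷ w) = inverse w ++ σ ∷ σ ∷ σ ∷ []
inverse (ρ ∷ w) = inverse w ++ ρ ∷ ρ ∷ ρ ∷ ρ ∷ ρ ∷ []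

module Evaluation (M : Monoid 0ℓ 0ℓ) (s r : Monoid.Carrier M) where
  open Monoid M

  letter : Generator → Carrier
  letter σ = s
  letter ρ = r

  eval : Word → Carrier
  eval []      = ε
  eval (x ∷ w) = letter x ∙ eval w

  eval-++ : ∀ v w → eval (v ++ w) ≈ eval v ∙ eval w
  eval-++ []      w = sym (identityˡ _)
  eval-++ (x ∷ v) w = trans (∙-congˡ (eval-++ v w)) (sym (assoc _ _ _))

  z : Carrier
  z = s ∙ s

  signed : Bool → Carrier → Carrier
  signed false x = x
  signed true  x = z ∙ x

  rotated : Rotation → Carrier → Carrier
  rotated ρ⁰ x = x
  rotated ρ¹ x = r ∙ x
  rotated ρ² x = (r ∙ r) ∙ x

  elementary : Elementary → Carrier
  elementary upper = z ∙ (s ∙ r)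
  elementary lower = z ∙ (s ∙ (r ∙ r))

  core : List Elementary → Bool → Carrier
  core []          false = ε
  core []          true  = s ∙ ε
  core (x ∷ p)     f     = elementary x ∙ core p f

  evalNF : NormalForm → Carrier
  evalNF (normal n e p f) = signed n (rotated e (core p f))

  module Relations (r³≈s² : r ∙ (r ∙ r) ≈ s ∙ s) (s⁴≈ε : z ∙ z ≈ ε) where

    ss : ∀ x → s ∙ (s ∙ x) ≈ z ∙ x
    ss x = sym (assoc s s x)

    zz : ∀ x → z ∙ (z ∙ x) ≈ x
    zz x = trans (sym (assoc z z x)) (trans (∙-congʳ s⁴≈ε) (identityˡ x))

    rrr : ∀ x → r ∙ (r ∙ (r ∙ x)) ≈ z ∙ x
    rrr x = trans (∙-congˡ (sym (assoc r r x))) (trans (sym (assoc r (r ∙ r) x)) (∙-congʳ r³≈s²))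

    -- As `z` is both `s²` and `r³`, it commutes with `s` and with `r`; signs can always be moved to
    -- the front.
    sz : ∀ x → s ∙ (z ∙ x) ≈ z ∙ (s ∙ x)
    sz x = trans (∙-congˡ (sym (ss x))) (ss (s ∙ x))

    rz : ∀ x → r ∙ (z ∙ x) ≈ z ∙ (r ∙ x)
    rz x = trans (∙-congˡ (sym (rrr x))) (rrr (r ∙ x))

    signed-cong : ∀ n {x y} → x ≈ y → signed n x ≈ signed n y
    signed-cong false p = p
    signed-cong true  p = ∙-congˡ p

    signed-signed : ∀ n x → signed n (signed n x) ≈ x
    signed-signed false x = refl
    signed-signed true  x = zz x

    signed-not : ∀ n x → signed (not n) x ≈ signed n (z ∙ x)
    signed-not false x = refl
    signed-not true  x = sym (zz x)

    signed-not-z : ∀ n x → signed (not n) (z ∙ x) ≈ signed n x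
    signed-not-z false x = zz x
    signed-not-z true  x = refl

    s-signed : ∀ n x → s ∙ signed n x ≈ signed n (s ∙ x)
    s-signed false x = refl
    s-signed true  x = sz x

    r-signed : ∀ n x → r ∙ signed n x ≈ signed n (r ∙ x)
    r-signed false x = refl
    r-signed true  x = rz x

    zsx : ∀ y x → (z ∙ (s ∙ y)) ∙ x ≈ z ∙ (s ∙ (y ∙ x))
    zsx y x = trans (assoc z (s ∙ y) x) (∙-congˡ (assoc s y x))

    szsx : ∀ y x → s ∙ ((z ∙ (s ∙ y)) ∙ x) ≈ y ∙ x
    szsx y x = trans (∙-congˡ (zsx y x)) (trans (sz (s ∙ (y ∙ x))) (trans (∙-congˡ (ss (y ∙ x))) (zz (y ∙ x))))

    signed-not-zs : ∀ n y x → signed (not n) ((z ∙ (s ∙ y)) ∙ x) ≈ s ∙ signed n (y ∙ x)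
    signed-not-zs n y x = trans (signed-cong (not n) (zsx y x))
      (trans (signed-not-z n (s ∙ (y ∙ x))) (sym (s-signed n (y ∙ x))))

    evalNF-◁ : ∀ x n → evalNF (x ◁ n) ≈ letter x ∙ evalNF n
    evalNF-◁ σ (normal n ρ⁰ []          false) = sym (s-signed n ε)
    evalNF-◁ σ (normal n ρ⁰ []          true)  =
      trans (signed-not n ε) (sym (trans (s-signed n (s ∙ ε)) (signed-cong n (ss ε))))
    evalNF-◁ σ (normal n ρ⁰ (upper ∷ p) f)     = sym (trans (s-signed n _) (signed-cong n (szsx r _)))
    evalNF-◁ σ (normal n ρ⁰ (lower ∷ p) f)     = sym (trans (s-signed n _) (signed-cong n (szsx (r ∙ r) _)))
    evalNF-◁ σ (normal n ρ¹ p           f)     = signed-not-zs n r _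
    evalNF-◁ σ (normal n ρ² p           f)     = signed-not-zs n (r ∙ r) _
    evalNF-◁ ρ (normal n ρ⁰ p           f)     = sym (r-signed n _)
    evalNF-◁ ρ (normal n ρ¹ p           f)     = trans (signed-cong n (assoc r r _)) (sym (r-signed n _))
    evalNF-◁ ρ (normal n ρ² p           f)     = trans (signed-not n _)
      (sym (trans (r-signed n _) (signed-cong n (trans (sym (assoc r (r ∙ r) _)) (∙-congʳ r³≈s²)))))

    evalNF-normalise : ∀ w → evalNF (normalise w) ≈ eval w
    evalNF-normalise []      = refl
    evalNF-normalise (x ∷ w) = trans (evalNF-◁ x (normalise w)) (∙-congˡ (evalNF-normalise w))

    eval-inverseˡ : ∀ w → eval (inverse w ++ w) ≈ ε
    eval-inverseˡ w = trans (eval-++ (inverse w) w) (cancel w)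
      where
      append : ∀ v u {x} → eval u ∙ x ≈ ε → ∀ y → eval (v ++ u) ∙ (x ∙ y) ≈ eval v ∙ y
      append v u {x} p y = trans (∙-congʳ (eval-++ v u)) (trans (assoc _ _ _)
        (∙-congˡ (trans (sym (assoc _ _ _)) (trans (∙-congʳ p) (identityˡ y)))))

      cancel : ∀ w → eval (inverse w) ∙ eval w ≈ ε
      cancel []      = identityˡ ε
      cancel (σ ∷ w) = trans (append (inverse w) (σ ∷ σ ∷ σ ∷ []) s³s (eval w)) (cancel w)
        where
        s³s : eval (σ ∷ σ ∷ σ ∷ []) ∙ s ≈ ε
        s³s = trans (∙-congʳ (trans (ss _) (∙-congˡ (identityʳ s)))) (trans (assoc _ _ _) s⁴≈ε)
      cancel (ρ ∷ w) = trans (append (inverse w) (ρ ∷ ρ ∷ ρ ∷ ρ ∷ ρ ∷ []) r⁵r (eval w)) (cancel w)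
        where
        r⁵r : eval (ρ ∷ ρ ∷ ρ ∷ ρ ∷ ρ ∷ []) ∙ r ≈ ε
        r⁵r = trans (∙-congʳ (trans (rrr _) (∙-congˡ (∙-congˡ (identityʳ r)))))
          (trans (assoc _ _ _) (trans (∙-congˡ (trans (assoc r r r) r³≈s²)) s⁴≈ε))

-- SL₂ without the determinant proofs, so that equality becomes propositional.
record Matrix₂ : Set where
  constructor mat
  field
    a b c d : ℤ

infixl 7 _*₂_

_*₂_ : Matrix₂ → Matrix₂ → Matrix₂
mat a b c d *₂ mat a′ b′ c′ d′ = mat
  (a ℤ.* a′ ℤ.+ b ℤ.* c′) (a ℤ.* b′ ℤ.+ b ℤ.* d′)
  (c ℤ.* a′ ℤ.+ d ℤ.* c′) (c ℤ.* b′ ℤ.+ d ℤ.* d′)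

mat-≡ : ∀ {a a′ b b′ c c′ d d′} → a ≡ a′ → b ≡ b′ → c ≡ c′ → d ≡ d′ → mat a b c d ≡ mat a′ b′ c′ d′
mat-≡ ≡.refl ≡.refl ≡.refl ≡.refl = ≡.refl

*₂-monoid : Monoid 0ℓ 0ℓ
*₂-monoid = record
  { Carrier = Matrix₂
  ; _≈_     = _≡_
  ; _∙_     = _*₂_
  ; ε       = mat 1ℤ 0ℤ 0ℤ 1ℤ
  ; isMonoid = record
    { isSemigroup = record
      { isMagma = record { isEquivalence = ≡.isEquivalence ; ∙-cong = cong₂ _*₂_ }
      ; assoc = λ { (mat a b c d) (mat a′ b′ c′ d′) (mat a″ b″ c″ d″) → mat-≡
          (row a b a′ b′ c′ d′ a″ c″) (row a b a′ b′ c′ d′ b″ d″)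
          (row c d a′ b′ c′ d′ a″ c″) (row c d a′ b′ c′ d′ b″ d″) }
      }
    ; identity = (λ { (mat a b c d) → mat-≡ (1x+0y a c) (1x+0y b d) (0x+1y a c) (0x+1y b d) })
               , (λ { (mat a b c d) → mat-≡ (x1+y0 a b) (x0+y1 a b) (x1+y0 c d) (x0+y1 c d) })
    }
  }
  where
  row : ∀ a b a′ b′ c′ d′ e f →
    (a ℤ.* a′ ℤ.+ b ℤ.* c′) ℤ.* e ℤ.+ (a ℤ.* b′ ℤ.+ b ℤ.* d′) ℤ.* f
      ≡ a ℤ.* (a′ ℤ.* e ℤ.+ b′ ℤ.* f) ℤ.+ b ℤ.* (c′ ℤ.* e ℤ.+ d′ ℤ.* f)
  row = ℤ-solver.solve-∀
  1x+0y : ∀ x y → 1ℤ ℤ.* x ℤ.+ 0ℤ ℤ.* y ≡ x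
  1x+0y = ℤ-solver.solve-∀
  0x+1y : ∀ x y → 0ℤ ℤ.* x ℤ.+ 1ℤ ℤ.* y ≡ y
  0x+1y = ℤ-solver.solve-∀
  x1+y0 : ∀ x y → x ℤ.* 1ℤ ℤ.+ y ℤ.* 0ℤ ≡ x
  x1+y0 = ℤ-solver.solve-∀
  x0+y1 : ∀ x y → x ℤ.* 0ℤ ℤ.+ y ℤ.* 1ℤ ≡ y
  x0+y1 = ℤ-solver.solve-∀

module Matrix = Evaluation *₂-monoid (mat 0ℤ -1ℤ 1ℤ 0ℤ) (mat 0ℤ -1ℤ 1ℤ 1ℤ)
open Matrix.Relations ≡.refl ≡.refl using () renaming
  (signed-signed to *₂-signed-signed; evalNF-normalise to *₂-evalNF-normalise; eval-inverseˡ to *₂-eval-inverseˡ)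

-- Only the trivial normal form evaluates to the identity matrix

module Positivity where
  open Matrix
  open Matrix₂

  x+y : ∀ x y → x ℤ.+ y ≡ 1ℤ ℤ.* x ℤ.+ 1ℤ ℤ.* y
  x+y = ℤ-solver.solve-∀
  x+0 : ∀ x y → x ≡ 1ℤ ℤ.* x ℤ.+ 0ℤ ℤ.* y
  x+0 = ℤ-solver.solve-∀
  0+y : ∀ x y → y ≡ 0ℤ ℤ.* x ℤ.+ 1ℤ ℤ.* y
  0+y = ℤ-solver.solve-∀
  -[x+y] : ∀ x y → (ℤ.- x) ℤ.+ (ℤ.- y) ≡ ℤ.- (1ℤ ℤ.* x ℤ.+ 1ℤ ℤ.* y)
  -[x+y] = ℤ-solver.solve-∀
  -[x+0] : ∀ x y → ℤ.- x ≡ ℤ.- (1ℤ ℤ.* x ℤ.+ 0ℤ ℤ.* y)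
  -[x+0] = ℤ-solver.solve-∀
  -[0+y] : ∀ x y → ℤ.- y ≡ ℤ.- (0ℤ ℤ.* x ℤ.+ 1ℤ ℤ.* y)
  -[0+y] = ℤ-solver.solve-∀
  -x-y′ : ∀ x y → (ℤ.- x) ℤ.+ (ℤ.- y) ≡ -1ℤ ℤ.* x ℤ.+ -1ℤ ℤ.* y
  -x-y′ = ℤ-solver.solve-∀
  y′ : ∀ x y → y ≡ ℤ.- (0ℤ ℤ.* x ℤ.+ -1ℤ ℤ.* y)
  y′ = ℤ-solver.solve-∀

  data Quadrant₁ : ℤ → ℤ → Set where
    quadrant₁ : ∀ m n → Quadrant₁ (+ suc m) (+ n)

  data Quadrant₂ : ℤ → ℤ → Set where
    quadrant₂ : ∀ m n → Quadrant₂ (+ m) (+ suc n)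

  -- The sign patterns of P and of P S for a product P of the matrices upper and lower: they
  -- force a nonzero off-diagonal entry in every nontrivial (S T)ᵉ P Sᶠ.
  Shape : Bool → Matrix₂ → Set
  Shape false X = Quadrant₁ (a X) (c X) × Quadrant₂ (b X) (d X)
  Shape true  X = Quadrant₂ (a X) (c X) × Quadrant₁ (ℤ.- b X) (ℤ.- d X)

  upper₁ : ∀ {x y} → Quadrant₁ x y → Quadrant₁ (x ℤ.+ y) y
  upper₁ (quadrant₁ m n) = quadrant₁ (m ℕ.+ n) n
  upper₂ : ∀ {x y} → Quadrant₂ x y → Quadrant₂ (x ℤ.+ y) y
  upper₂ (quadrant₂ m n) = quadrant₂ (m ℕ.+ suc n) n
  lower₁ : ∀ {x y} → Quadrant₁ x y → Quadrant₁ x (x ℤ.+ y)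
  lower₁ (quadrant₁ m n) = quadrant₁ m (suc m ℕ.+ n)
  lower₂ : ∀ {x y} → Quadrant₂ x y → Quadrant₂ x (x ℤ.+ y)
  lower₂ (quadrant₂ m n) = subst (Quadrant₂ (+ m)) (cong +_ (≡.sym (ℕₚ.+-suc m n))) (quadrant₂ m (m ℕ.+ n))

  Shape-upper : ∀ f X → Shape f X → Shape f (elementary upper *₂ X)
  Shape-upper false X (p , q) =
      subst₂ Quadrant₁ (x+y (a X) (c X)) (0+y (a X) (c X)) (upper₁ p)
    , subst₂ Quadrant₂ (x+y (b X) (d X)) (0+y (b X) (d X)) (upper₂ q)
  Shape-upper true X (p , q) =
      subst₂ Quadrant₂ (x+y (a X) (c X)) (0+y (a X) (c X)) (upper₂ p)
    , subst₂ Quadrant₁ (-[x+y] (b X) (d X)) (-[0+y] (b X) (d X)) (upper₁ q)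

  Shape-lower : ∀ f X → Shape f X → Shape f (elementary lower *₂ X)
  Shape-lower false X (p , q) =
      subst₂ Quadrant₁ (x+0 (a X) (c X)) (x+y (a X) (c X)) (lower₁ p)
    , subst₂ Quadrant₂ (x+0 (b X) (d X)) (x+y (b X) (d X)) (lower₂ q)
  Shape-lower true X (p , q) =
      subst₂ Quadrant₂ (x+0 (a X) (c X)) (x+y (a X) (c X)) (lower₂ p)
    , subst₂ Quadrant₁ (-[x+0] (b X) (d X)) (-[x+y] (b X) (d X)) (lower₁ q)

  Shape-core : ∀ p f → Shape f (core p f)
  Shape-core []          false = quadrant₁ 0 0 , quadrant₂ 0 0
  Shape-core []          true  = quadrant₂ 0 0 , quadrant₁ 0 0
  Shape-core (upper ∷ p) false = Shape-upper false (core p false) (Shape-core p false)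
  Shape-core (upper ∷ p) true  = Shape-upper true (core p true) (Shape-core p true)
  Shape-core (lower ∷ p) false = Shape-lower false (core p false) (Shape-core p false)
  Shape-core (lower ∷ p) true  = Shape-lower true (core p true) (Shape-core p true)

  Diagonal : Matrix₂ → Set
  Diagonal X = b X ≡ 0ℤ × c X ≡ 0ℤ

  Quadrant₁-x : ∀ {x y} → Quadrant₁ x y → x ≡ 0ℤ → ⊥
  Quadrant₁-x (quadrant₁ _ _) ()
  Quadrant₂-y : ∀ {x y} → Quadrant₂ x y → y ≡ 0ℤ → ⊥
  Quadrant₂-y (quadrant₂ _ _) ()

  Trivial : Rotation → List Elementary → Bool → Set
  Trivial e p f = (e ≡ ρ⁰) × (p ≡ []) × (f ≡ false)

  -- In each nontrivial case some off-diagonal entry is, up to sign, an entry or a sum of two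
  -- entries that `Shape-core` makes strictly positive. Asking for a diagonal matrix instead of the
  -- identity disposes of the sign ±1 at the same time.
  diagonal⇒trivial : ∀ e p f → Diagonal (rotated e (core p f)) → Trivial e p f
  diagonal⇒trivial ρ⁰ []          false _ = ≡.refl , ≡.refl , ≡.refl
  diagonal⇒trivial ρ⁰ (upper ∷ p) false D = ⊥-elim (Quadrant₂-y (lower₂ (proj₂ (Shape-core p false)))
    (≡.trans (x+y (b X) (d X)) (proj₁ D)))
    where X = core p false
  diagonal⇒trivial ρ⁰ (lower ∷ p) false D = ⊥-elim (Quadrant₁-x (upper₁ (proj₁ (Shape-core p false)))
    (≡.trans (x+y (a X) (c X)) (proj₂ D)))
    where X = core p false
  diagonal⇒trivial ρ⁰ p           true  D =
    ⊥-elim (Quadrant₁-x (proj₂ (Shape-core p true)) (cong ℤ.-_ (proj₁ D)))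
  diagonal⇒trivial ρ¹ p           false D = ⊥-elim (Quadrant₂-y (proj₂ (Shape-core p false))
    (≡.trans (y′ (b X) (d X)) (cong ℤ.-_ (proj₁ D))))
    where X = core p false
  diagonal⇒trivial ρ¹ p           true  D = ⊥-elim (Quadrant₂-y (lower₂ (proj₁ (Shape-core p true)))
    (≡.trans (x+y (a X) (c X)) (proj₂ D)))
    where X = core p true
  diagonal⇒trivial ρ² p           false D = ⊥-elim (Quadrant₁-x (proj₁ (Shape-core p false))
    (≡.trans (x+0 (a X) (c X)) (proj₂ D)))
    where X = core p false
  diagonal⇒trivial ρ² p           true  D = ⊥-elim (Quadrant₁-x (upper₁ (proj₂ (Shape-core p true)))
    (≡.trans (-x-y′ (b X) (d X)) (proj₁ D)))
    where X = core p true

  evalNF-injective-ε : ∀ n → evalNF n ≡ mat 1ℤ 0ℤ 0ℤ 1ℤ → n ≡ normal false ρ⁰ [] false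
  evalNF-injective-ε (normal n e p f) X≡ε
    with diagonal⇒trivial e p f (subst Diagonal (≡.sym eq) (signed-diagonal n))
    where
    eq : rotated e (core p f) ≡ signed n (mat 1ℤ 0ℤ 0ℤ 1ℤ)
    eq = ≡.trans (≡.sym (*₂-signed-signed n _)) (cong (signed n) X≡ε)
    signed-diagonal : ∀ n → Diagonal (signed n (mat 1ℤ 0ℤ 0ℤ 1ℤ))
    signed-diagonal false = ≡.refl , ≡.refl
    signed-diagonal true  = ≡.refl , ≡.refl
  evalNF-injective-ε (normal false .ρ⁰ .[] .false) _  | ≡.refl , ≡.refl , ≡.refl = ≡.refl
  evalNF-injective-ε (normal true  .ρ⁰ .[] .false) () | ≡.refl , ≡.refl , ≡.refl

entries : SL₂ → Matrix₂
entries (sl₂ a b c d _) = mat a b c d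

-- Generation by the Euclidean algorithm on the first column

module Euclid where
  -- Words for `T` and `T⁻¹`: with `ρ = S T` one has `σ³ρ = S⁴T = T` and `ρ⁵σ = ρ⁻¹S = T⁻¹`.
  up down : Word
  up   = σ ∷ σ ∷ σ ∷ ρ ∷ []
  down = ρ ∷ ρ ∷ ρ ∷ ρ ∷ ρ ∷ σ ∷ []

  translate : ℤ → Word → Word
  translate (+ zero)       w = w
  translate (+ suc n)      w = up ++ translate (+ n) w
  translate -[1+ zero ]    w = down ++ w
  translate -[1+ suc n ]   w = down ++ translate -[1+ n ] w

  private
    step-row : ∀ ε q x y → 1ℤ ℤ.* (x ℤ.+ q ℤ.* y) ℤ.+ ε ℤ.* y ≡ x ℤ.+ (ε ℤ.+ q) ℤ.* y
    step-row = ℤ-solver.solve-∀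
    step-row₀ : ∀ ε x y → 1ℤ ℤ.* x ℤ.+ ε ℤ.* y ≡ x ℤ.+ ε ℤ.* y
    step-row₀ = ℤ-solver.solve-∀
    0x+1y : ∀ x y → 0ℤ ℤ.* x ℤ.+ 1ℤ ℤ.* y ≡ y
    0x+1y = ℤ-solver.solve-∀
    x+0y : ∀ x y → x ≡ x ℤ.+ 0ℤ ℤ.* y
    x+0y = ℤ-solver.solve-∀

  eval-translate : ∀ q w {a b c d} → Matrix.eval w ≡ mat a b c d →
    Matrix.eval (translate q w) ≡ mat (a ℤ.+ q ℤ.* c) (b ℤ.+ q ℤ.* d) c d
  eval-translate (+ zero) w {a} {b} {c} {d} eq = ≡.trans eq (mat-≡ (x+0y a c) (x+0y b d) ≡.refl ≡.refl)
  eval-translate (+ suc n) w {a} {b} {c} {d} eq = ≡.trans (Matrix.eval-++ up (translate (+ n) w))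
    (≡.trans (cong (Matrix.eval up *₂_) (eval-translate (+ n) w eq))
      (mat-≡ (step-row 1ℤ (+ n) a c) (step-row 1ℤ (+ n) b d) (0x+1y (a ℤ.+ (+ n) ℤ.* c) c) (0x+1y (b ℤ.+ (+ n) ℤ.* d) d)))
  eval-translate -[1+ zero ] w {a} {b} {c} {d} eq = ≡.trans (Matrix.eval-++ down w)
    (≡.trans (cong (Matrix.eval down *₂_) eq)
      (mat-≡ (step-row₀ -1ℤ a c) (step-row₀ -1ℤ b d) (0x+1y a c) (0x+1y b d)))
  eval-translate -[1+ suc n ] w {a} {b} {c} {d} eq = ≡.trans (Matrix.eval-++ down (translate -[1+ n ] w))
    (≡.trans (cong (Matrix.eval down *₂_) (eval-translate -[1+ n ] w eq))
      (mat-≡ (step-row -1ℤ -[1+ n ] a c) (step-row -1ℤ -[1+ n ] b d)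
        (0x+1y (a ℤ.+ -[1+ n ] ℤ.* c) c) (0x+1y (b ℤ.+ -[1+ n ] ℤ.* d) d)))

  private
    triangular : ∀ a b d → a ℤ.* d ℤ.- b ℤ.* 0ℤ ≡ a ℤ.* d
    triangular = ℤ-solver.solve-∀
    1+b0 : ∀ b → 1ℤ ≡ 1ℤ ℤ.+ b ℤ.* 0ℤ
    1+b0 = ℤ-solver.solve-∀
    0+b1 : ∀ b → b ≡ 0ℤ ℤ.+ b ℤ.* 1ℤ
    0+b1 = ℤ-solver.solve-∀
    -1-b0 : ∀ b → -1ℤ ≡ -1ℤ ℤ.+ (ℤ.- b) ℤ.* 0ℤ
    -1-b0 = ℤ-solver.solve-∀
    0-b-1 : ∀ b → b ≡ 0ℤ ℤ.+ (ℤ.- b) ℤ.* -1ℤ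
    0-b-1 = ℤ-solver.solve-∀
    det-step : ∀ q r b c d → c ℤ.* (q ℤ.* d ℤ.- b) ℤ.- d ℤ.* (ℤ.- r) ≡ (r ℤ.+ q ℤ.* c) ℤ.* d ℤ.- b ℤ.* c
    det-step = ℤ-solver.solve-∀
    top-left : ∀ q r c → r ℤ.+ q ℤ.* c ≡ (0ℤ ℤ.* c ℤ.+ -1ℤ ℤ.* (ℤ.- r)) ℤ.+ q ℤ.* c
    top-left = ℤ-solver.solve-∀
    top-right : ∀ q b d → b ≡ (0ℤ ℤ.* d ℤ.+ -1ℤ ℤ.* (q ℤ.* d ℤ.- b)) ℤ.+ q ℤ.* d
    top-right = ℤ-solver.solve-∀
    bottom : ∀ x y → 1ℤ ℤ.* x ℤ.+ 0ℤ ℤ.* y ≡ x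
    bottom = ℤ-solver.solve-∀

    units : ∀ a d → a ℤ.* d ≡ 1ℤ → (a ≡ 1ℤ × d ≡ 1ℤ) ⊎ (a ≡ -1ℤ × d ≡ -1ℤ)
    units a d ad≡1 = cases a d ad≡1 (ℕₚ.m*n≡1⇒m≡1 ℤ.∣ a ∣ ℤ.∣ d ∣ ∣a∣∣d∣≡1) (ℕₚ.m*n≡1⇒n≡1 ℤ.∣ a ∣ ℤ.∣ d ∣ ∣a∣∣d∣≡1)
      where
      ∣a∣∣d∣≡1 : ℤ.∣ a ∣ ℕ.* ℤ.∣ d ∣ ≡ 1
      ∣a∣∣d∣≡1 = ≡.trans (≡.sym (ℤₚ.abs-* a d)) (cong ℤ.∣_∣ ad≡1)
      cases : ∀ a d → a ℤ.* d ≡ 1ℤ → ℤ.∣ a ∣ ≡ 1 → ℤ.∣ d ∣ ≡ 1 → (a ≡ 1ℤ × d ≡ 1ℤ) ⊎ (a ≡ -1ℤ × d ≡ -1ℤ)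
      cases (+ _)     (+ _)     _  ≡.refl ≡.refl = inj₁ (≡.refl , ≡.refl)
      cases (+ _)     -[1+ _ ]  () ≡.refl ≡.refl
      cases -[1+ _ ]  (+ _)     () ≡.refl ≡.refl
      cases -[1+ _ ]  -[1+ _ ]  _  ≡.refl ≡.refl = inj₂ (≡.refl , ≡.refl)

  Factorisation : Matrix₂ → Set
  Factorisation X = Σ[ w ∈ Word ] Matrix.eval w ≡ X

  mutual
    -- Recursion on `n`, which strictly bounds the lower left entry. When that entry is 0 the
    -- diagonal is 1, 1 or -1, -1, and the matrix is `Tᵇ` or `−T⁻ᵇ`.
    factor : ∀ n a b c d → a ℤ.* d ℤ.- b ℤ.* c ≡ 1ℤ → ℤ.∣ c ∣ ℕ.< n → Factorisation (mat a b c d)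
    factor (suc n) a b (+ zero) d det _ with units a d (≡.trans (≡.sym (triangular a b d)) det)
    ... | inj₁ (≡.refl , ≡.refl) = translate b [] ,
      ≡.trans (eval-translate b [] ≡.refl) (≡.sym (mat-≡ (1+b0 b) (0+b1 b) ≡.refl ≡.refl))
    ... | inj₂ (≡.refl , ≡.refl) = translate (ℤ.- b) (σ ∷ σ ∷ []) ,
      ≡.trans (eval-translate (ℤ.- b) (σ ∷ σ ∷ []) ≡.refl) (≡.sym (mat-≡ (-1-b0 b) (0-b-1 b) ≡.refl ≡.refl))
    factor (suc n) a b c@(+ suc _)  d det (ℕ.s≤s ∣c∣≤n) = divide n a b c d det ∣c∣≤n
    factor (suc n) a b c@(-[1+ _ ]) d det (ℕ.s≤s ∣c∣≤n) = divide n a b c d det ∣c∣≤n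

    -- With `a = r + q c`, the matrix is `T^q S` times one whose first column is `c`, `−r`, and the
    -- remainder `r` is smaller than `c` in absolute value.
    divide : ∀ n a b c d .{{_ : ℤ.NonZero c}} → a ℤ.* d ℤ.- b ℤ.* c ≡ 1ℤ → ℤ.∣ c ∣ ℕ.≤ n → Factorisation (mat a b c d)
    divide n a b c d det ∣c∣≤n = translate q (σ ∷ w) ,
      ≡.trans (eval-translate q (σ ∷ w) (≡.trans (cong (mat 0ℤ -1ℤ 1ℤ 0ℤ *₂_) eq)
        (mat-≡ ≡.refl ≡.refl (bottom c (ℤ.- r)) (bottom d (q ℤ.* d ℤ.- b)))))
      (mat-≡ (≡.sym (≡.trans a≡r+qc (top-left q r c))) (≡.sym (top-right q b d)) ≡.refl ≡.refl)
      where
      q r : ℤ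
      q = a ℤ./ c
      r = + (a ℤ.% c)
      a≡r+qc : a ≡ r ℤ.+ q ℤ.* c
      a≡r+qc = ℤ-DivMod.a≡a%n+[a/n]*n a c
      rest : Factorisation (mat c d (ℤ.- r) (q ℤ.* d ℤ.- b))
      rest = factor n c d (ℤ.- r) (q ℤ.* d ℤ.- b)
        (≡.trans (det-step q r b c d) (≡.trans (cong (λ x → x ℤ.* d ℤ.- b ℤ.* c) (≡.sym a≡r+qc)) det))
        (ℕₚ.<-≤-trans (subst (ℕ._< ℤ.∣ c ∣) (≡.sym (ℤₚ.∣-i∣≡∣i∣ r)) (ℤ-DivMod.n%d<d a c)) ∣c∣≤n)
      w = proj₁ rest
      eq = proj₂ rest

abstract
  factorisation : ∀ X → Euclid.Factorisation (entries X)
  factorisation (sl₂ a b c d det) = Euclid.factor (suc ℤ.∣ c ∣) a b c d det ℕₚ.≤-refl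

word : SL₂ → Word
word X = proj₁ (factorisation X)

eval-word : ∀ X → Matrix.eval (word X) ≡ entries X
eval-word X = proj₂ (factorisation X)

-- From two relations in a monoid to a map on SL(2,ℤ)

record Representation (M : Monoid 0ℓ 0ℓ) (s r : Monoid.Carrier M) : Set₁ where
  open Monoid M
  field
    ⟦_⟧      : SL₂ → Carrier
    ⟦⟧-cong  : ∀ {X Y} → X ≈SL₂ Y → ⟦ X ⟧ ≈ ⟦ Y ⟧
    ⟦⟧-∙     : ∀ X Y → ⟦ X *SL₂ Y ⟧ ≈ ⟦ X ⟧ ∙ ⟦ Y ⟧
    ⟦⟧-ε     : ⟦ Group.ε SL₂ℤ ⟧ ≈ ε
    ⟦S⟧      : ⟦ S ⟧ ≈ s
    ⟦T⟧      : ⟦ T ⟧ ≈ s ∙ (s ∙ (s ∙ r))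
    -- `S` and `S T` generate SL(2,ℤ) as a monoid. A property that relates a matrix to its image can
    -- thus be checked on these two factors without any mention of words.
    ⟦⟧-induction : (P : SL₂ → Carrier → Set) → (∀ {X Y x} → X ≈SL₂ Y → P X x → P Y x) →
      P (Group.ε SL₂ℤ) ε →
      (∀ {X x} → P X x → P (S *SL₂ X) (s ∙ x)) →
      (∀ {X x} → P X x → P (S *SL₂ (T *SL₂ X)) (r ∙ x)) →
      ∀ X → P X ⟦ X ⟧

module Presentation (M : Monoid 0ℓ 0ℓ) (s r : Monoid.Carrier M)
  (r³≈s² : Monoid._≈_ M (Monoid._∙_ M r (Monoid._∙_ M r r)) (Monoid._∙_ M s s))
  (s⁴≈ε : Monoid._≈_ M (Monoid._∙_ M (Monoid._∙_ M s s) (Monoid._∙_ M s s)) (Monoid.ε M)) where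

  open Monoid M
  open Evaluation M s r public
  open Relations r³≈s² s⁴≈ε

  eval-kernel : ∀ w → Matrix.eval w ≡ Monoid.ε *₂-monoid → eval w ≈ ε
  eval-kernel w eq = trans (sym (evalNF-normalise w))
    (reflexive (cong evalNF (Positivity.evalNF-injective-ε (normalise w) (≡.trans (*₂-evalNF-normalise w) eq))))

  -- `M` is only a monoid, so the argument compares one-sided inverses: `eval (inverse w)` is a left
  -- inverse of both values, and it has itself the left inverse `eval (inverse (inverse w))`, to
  -- which both must be equal.
  eval-unique : ∀ v w → Matrix.eval v ≡ Matrix.eval w → eval v ≈ eval w
  eval-unique v w eq = trans (left-inverse v w⁻¹v) (sym (left-inverse w (eval-inverseˡ w)))
    where
    w⁻¹v : eval (inverse w ++ v) ≈ ε
    w⁻¹v = eval-kernel (inverse w ++ v) (≡.trans (Matrix.eval-++ (inverse w) v)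
      (≡.trans (cong (Matrix.eval (inverse w) *₂_) eq)
        (≡.trans (≡.sym (Matrix.eval-++ (inverse w) w)) (*₂-eval-inverseˡ w))))
    left-inverse : ∀ x → eval (inverse w ++ x) ≈ ε → eval x ≈ eval (inverse (inverse w))
    left-inverse x p = trans (sym (identityˡ _)) (trans
      (∙-congʳ (trans (sym (eval-inverseˡ (inverse w))) (eval-++ (inverse (inverse w)) (inverse w))))
      (trans (assoc _ _ _) (trans (∙-congˡ (trans (sym (eval-++ (inverse w) x)) p)) (identityʳ _))))

  ⟦_⟧ : SL₂ → Carrier
  ⟦ X ⟧ = eval (word X)

  ⟦⟧-eval : ∀ X w → Matrix.eval w ≡ entries X → ⟦ X ⟧ ≈ eval w
  ⟦⟧-eval X w eq = eval-unique (word X) w (≡.trans (eval-word X) (≡.sym eq))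

  representation : Representation M s r
  representation = record
    { ⟦_⟧      = ⟦_⟧
    ; ⟦⟧-cong  = λ { {X} {Y} (entries≡ p q r s) →
        ⟦⟧-eval X (word Y) (≡.trans (eval-word Y) (≡.sym (mat-≡ p q r s))) }
    ; ⟦⟧-∙     = λ X Y → trans (⟦⟧-eval (X *SL₂ Y) (word X ++ word Y)
        (≡.trans (Matrix.eval-++ (word X) (word Y)) (cong₂ _*₂_ (eval-word X) (eval-word Y))))
        (eval-++ (word X) (word Y))
    ; ⟦⟧-ε     = ⟦⟧-eval (Group.ε SL₂ℤ) [] ≡.refl
    ; ⟦S⟧      = trans (⟦⟧-eval S (σ ∷ []) ≡.refl) (identityʳ s)
    ; ⟦T⟧      = trans (⟦⟧-eval T (σ ∷ σ ∷ σ ∷ ρ ∷ []) ≡.refl) (∙-congˡ (∙-congˡ (∙-congˡ (identityʳ r))))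
    ; ⟦⟧-induction = λ P resp Pε Ps Pr X →
        resp (entries-injective (≡.trans (entries-product (word X)) (eval-word X))) (induct P Pε Ps Pr (word X))
    }
    where
    product : Word → SL₂
    product []      = Group.ε SL₂ℤ
    product (σ ∷ w) = S *SL₂ product w
    product (ρ ∷ w) = S *SL₂ (T *SL₂ product w)

    entries-product : ∀ w → entries (product w) ≡ Matrix.eval w
    entries-product []      = ≡.refl
    entries-product (σ ∷ w) = cong (mat 0ℤ -1ℤ 1ℤ 0ℤ *₂_) (entries-product w)
    entries-product (ρ ∷ w) = ≡.trans
      (≡.sym (Monoid.assoc *₂-monoid (mat 0ℤ -1ℤ 1ℤ 0ℤ) (mat 1ℤ 1ℤ 0ℤ 1ℤ) (entries (product w))))
      (cong (mat 0ℤ -1ℤ 1ℤ 1ℤ *₂_) (entries-product w))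

    entries-injective : ∀ {X Y} → entries X ≡ entries Y → X ≈SL₂ Y
    entries-injective p = entries≡ (cong Matrix₂.a p) (cong Matrix₂.b p) (cong Matrix₂.c p) (cong Matrix₂.d p)

    induct : ∀ (P : SL₂ → Carrier → Set) → P (Group.ε SL₂ℤ) ε →
      (∀ {X x} → P X x → P (S *SL₂ X) (s ∙ x)) →
      (∀ {X x} → P X x → P (S *SL₂ (T *SL₂ X)) (r ∙ x)) →
      ∀ w → P (product w) (eval w)
    induct P Pε Ps Pr []      = Pε
    induct P Pε Ps Pr (σ ∷ w) = Ps (induct P Pε Ps Pr w)
    induct P Pε Ps Pr (ρ ∷ w) = Pr (induct P Pε Ps Pr w)

-- Quadratic relations in a ring

module QuadraticRelations (A : Ring 0ℓ 0ℓ) where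
  open Ring A
  open import Algebra.Properties.Ring A using (x[y-z]≈xy-xz; [y-z]x≈yx-zx; -‿distribˡ-*; -‿distribʳ-*; -‿involutive)
  open import Algebra.Properties.AbelianGroup +-abelianGroup using (⁻¹-∙-comm)
  open import Algebra.Properties.CommutativeSemigroup +-commutativeSemigroup using (interchange)
  open import Relation.Binary.Reasoning.Setoid setoid

  x+y≈z⇒x≈z-y : ∀ {x y z} → x + y ≈ z → x ≈ z - y
  x+y≈z⇒x≈z-y {x} {y} {z} p = begin
    x              ≈⟨ +-identityʳ x ⟨
    x + 0#         ≈⟨ +-congˡ (-‿inverseʳ y) ⟨
    x + (y - y)    ≈⟨ +-assoc x y (- y) ⟨
    (x + y) - y    ≈⟨ +-congʳ p ⟩
    z - y          ∎

  x+y≈z⇒y≈z-x : ∀ {x y z} → x + y ≈ z → y ≈ z - x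
  x+y≈z⇒y≈z-x p = x+y≈z⇒x≈z-y (trans (+-comm _ _) p)

  x-y≈0⇒x≈y : ∀ {x y} → x - y ≈ 0# → x ≈ y
  x-y≈0⇒x≈y {x} {y} p = begin
    x              ≈⟨ +-identityʳ x ⟨
    x + 0#         ≈⟨ +-congˡ (-‿inverseˡ y) ⟨
    x + (- y + y)  ≈⟨ +-assoc x (- y) y ⟨
    (x - y) + y    ≈⟨ +-congʳ p ⟩
    0# + y         ≈⟨ +-identityˡ y ⟩
    y              ∎

  sub-interchange : ∀ a b c d → (a - b) + (c - d) ≈ (a + c) - (b + d)
  sub-interchange a b c d = trans (interchange a (- b) c (- d)) (+-congˡ (⁻¹-∙-comm b d))

  [-1][-1] : (- 1#) * (- 1#) ≈ 1#
  [-1][-1] = trans (sym (-‿distribˡ-* 1# (- 1#))) (trans (-‿cong (*-identityˡ (- 1#))) (-‿involutive 1#))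

  Commutes : Carrier → Carrier → Set
  Commutes x y = x * y ≈ y * x

  -- NW + JWN = J says JWJ = W + J for J = 1 + N; with V = N U = 1 − J⁻¹ it takes the
  -- symmetric form VW + WN = 1 = NW + WV.
  module Involution (N U W : Carrier)
    (JU≈1 : (1# + N) * U ≈ 1#) (UJ≈1 : U * (1# + N) ≈ 1#)
    (NW+JWN≈J : N * W + (1# + N) * (W * N) ≈ 1# + N) where

    J V : Carrier
    J = 1# + N
    V = N * U

    JN≈NJ : J * N ≈ N * J
    JN≈NJ = trans (distribʳ N 1# N) (trans (+-congʳ (trans (*-identityˡ N) (sym (*-identityʳ N)))) (sym (distribˡ N 1# N)))

    UN≈V : U * N ≈ V
    UN≈V = begin
      U * N              ≈⟨ *-congˡ (trans (sym (*-identityʳ N)) (*-congˡ (sym JU≈1))) ⟩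
      U * (N * (J * U))  ≈⟨ *-congˡ (sym (*-assoc N J U)) ⟩
      U * (N * J * U)    ≈⟨ *-congˡ (*-congʳ (sym JN≈NJ)) ⟩
      U * (J * N * U)    ≈⟨ *-congˡ (*-assoc J N U) ⟩
      U * (J * (N * U))  ≈⟨ *-assoc U J (N * U) ⟨
      U * J * (N * U)    ≈⟨ *-congʳ UJ≈1 ⟩
      1# * (N * U)       ≈⟨ *-identityˡ _ ⟩
      N * U              ∎

    JV≈N : J * V ≈ N
    JV≈N = begin
      J * (N * U)  ≈⟨ *-assoc J N U ⟨
      J * N * U    ≈⟨ *-congʳ JN≈NJ ⟩
      N * J * U    ≈⟨ *-assoc N J U ⟩
      N * (J * U)  ≈⟨ *-congˡ JU≈1 ⟩
      N * 1#       ≈⟨ *-identityʳ N ⟩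
      N            ∎

    U+V≈1 : U + V ≈ 1#
    U+V≈1 = trans (+-congʳ (sym (*-identityˡ U))) (trans (sym (distribʳ U 1# N)) JU≈1)

    VN≈NV : V * N ≈ N * V
    VN≈NV = trans (*-assoc N U N) (*-congˡ UN≈V)

    VW+WN≈1 : V * W + W * N ≈ 1#
    VW+WN≈1 = begin
      V * W + W * N                ≈⟨ +-congʳ (*-congʳ UN≈V) ⟨
      U * N * W + W * N            ≈⟨ +-cong (*-assoc U N W) (sym (*-identityˡ _)) ⟩
      U * (N * W) + 1# * (W * N)   ≈⟨ +-congˡ (*-congʳ UJ≈1) ⟨
      U * (N * W) + U * J * (W * N) ≈⟨ +-congˡ (*-assoc U J (W * N)) ⟩
      U * (N * W) + U * (J * (W * N)) ≈⟨ distribˡ U _ _ ⟨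
      U * (N * W + J * (W * N))    ≈⟨ *-congˡ NW+JWN≈J ⟩
      U * J                        ≈⟨ UJ≈1 ⟩
      1#                           ∎

    NW+WV≈1 : N * W + W * V ≈ 1#
    NW+WV≈1 = begin
      N * W + W * V                        ≈⟨ +-congʳ (trans (sym (*-identityʳ _)) (*-congˡ (sym U+V≈1))) ⟩
      N * W * (U + V) + W * V              ≈⟨ +-congʳ (distribˡ (N * W) U V) ⟩
      (N * W * U + N * W * V) + W * V      ≈⟨ +-assoc _ _ _ ⟩
      N * W * U + (N * W * V + W * V)      ≈⟨ +-congˡ (trans (+-comm _ _) (+-cong (sym (*-identityˡ _)) (*-assoc N W V))) ⟩
      N * W * U + (1# * (W * V) + N * (W * V)) ≈⟨ +-cong (*-congʳ (*-congʳ (sym JV≈N))) (sym (distribʳ (W * V) 1# N)) ⟩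
      J * V * W * U + J * (W * (N * U))    ≈⟨ +-cong (*-congʳ (*-assoc J V W)) (*-congˡ (sym (*-assoc W N U))) ⟩
      J * (V * W) * U + J * (W * N * U)    ≈⟨ +-congˡ (sym (*-assoc J (W * N) U)) ⟩
      J * (V * W) * U + J * (W * N) * U    ≈⟨ distribʳ U _ _ ⟨
      (J * (V * W) + J * (W * N)) * U      ≈⟨ *-congʳ (distribˡ J _ _) ⟨
      J * (V * W + W * N) * U              ≈⟨ *-congʳ (trans (*-congˡ VW+WN≈1) (*-identityʳ J)) ⟩
      J * U                                ≈⟨ JU≈1 ⟩
      1#                                   ∎

    WN≈1-VW : W * N ≈ 1# - V * W
    WN≈1-VW = x+y≈z⇒y≈z-x VW+WN≈1

    NW≈1-WV : N * W ≈ 1# - W * V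
    NW≈1-WV = x+y≈z⇒x≈z-y NW+WV≈1

    x[1-y]≈x-xy : ∀ x y → x * (1# - y) ≈ x - x * y
    x[1-y]≈x-xy x y = trans (x[y-z]≈xy-xz x 1# y) (+-congʳ (*-identityʳ x))

    [1-y]x≈x-yx : ∀ x y → (1# - y) * x ≈ x - y * x
    [1-y]x≈x-yx x y = trans ([y-z]x≈yx-zx x 1# y) (+-congʳ (*-identityˡ x))

    -- The relations `W N = 1 − V W` and `N W = 1 − W V` exchange `N` with `V` when `W` passes; both
    -- sides reduce to `V − V W V`.
    W-commutes-NV : Commutes W (N * V)
    W-commutes-NV = begin
      W * (N * V)           ≈⟨ *-assoc W N V ⟨
      W * N * V             ≈⟨ *-congʳ WN≈1-VW ⟩
      (1# - V * W) * V      ≈⟨ [1-y]x≈x-yx V (V * W) ⟩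
      V - V * W * V         ≈⟨ +-congˡ (-‿cong (*-assoc V W V)) ⟩
      V - V * (W * V)       ≈⟨ x[1-y]≈x-xy V (W * V) ⟨
      V * (1# - W * V)      ≈⟨ *-congˡ NW≈1-WV ⟨
      V * (N * W)           ≈⟨ *-assoc V N W ⟨
      V * N * W             ≈⟨ *-congʳ VN≈NV ⟩
      N * V * W             ∎

    -- Passing one `W` turns `N` into `V`, passing the second turns it back; the common value is
    -- `W − W V W`.
    WW-commutes-N : Commutes (W * W) N
    WW-commutes-N = begin
      W * W * N             ≈⟨ *-assoc W W N ⟩
      W * (W * N)           ≈⟨ *-congˡ WN≈1-VW ⟩
      W * (1# - V * W)      ≈⟨ x[1-y]≈x-xy W (V * W) ⟩
      W - W * (V * W)       ≈⟨ +-congˡ (-‿cong (*-assoc W V W)) ⟨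
      W - W * V * W         ≈⟨ [1-y]x≈x-yx W (W * V) ⟨
      (1# - W * V) * W      ≈⟨ *-congʳ NW≈1-WV ⟨
      N * W * W             ≈⟨ *-assoc N W W ⟩
      N * (W * W)           ∎

    -- This is `J W J = W + J` multiplied on the right by `U = J⁻¹`.
    JW≈WU+1 : J * W ≈ W * U + 1#
    JW≈WU+1 = begin
      J * W                           ≈⟨ trans (distribʳ W 1# N) (+-congʳ (*-identityˡ W)) ⟩
      W + N * W                       ≈⟨ +-congʳ (trans (sym (*-identityʳ W)) (*-congˡ (sym U+V≈1))) ⟩
      W * (U + V) + N * W             ≈⟨ +-congʳ (distribˡ W U V) ⟩
      (W * U + W * V) + N * W         ≈⟨ +-assoc _ _ _ ⟩
      W * U + (W * V + N * W)         ≈⟨ +-congˡ (trans (+-comm _ _) NW+WV≈1) ⟩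
      W * U + 1#                      ∎

    R : Carrier
    R = W * J

    module _ (WW≈-1 : W * W ≈ - 1#) where

      -- `R` satisfies `X² − X + 1 = 0`, the characteristic equation of `S T`, and this polynomial
      -- divides `X³ + 1`.
      RR≈-1+R : R * R ≈ - 1# + R
      RR≈-1+R = begin
        W * J * (W * J)              ≈⟨ *-assoc W J (W * J) ⟩
        W * (J * (W * J))            ≈⟨ *-congˡ (*-assoc J W J) ⟨
        W * (J * W * J)              ≈⟨ *-congˡ (*-congʳ JW≈WU+1) ⟩
        W * ((W * U + 1#) * J)       ≈⟨ *-congˡ (distribʳ J (W * U) 1#) ⟩
        W * (W * U * J + 1# * J)     ≈⟨ *-congˡ (+-cong (trans (*-assoc W U J) (trans (*-congˡ UJ≈1) (*-identityʳ W))) (*-identityˡ J)) ⟩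
        W * (W + J)                  ≈⟨ distribˡ W W J ⟩
        W * W + W * J                ≈⟨ +-congʳ WW≈-1 ⟩
        - 1# + R                     ∎

      RRR≈-1 : R * (R * R) ≈ - 1#
      RRR≈-1 = begin
        R * (R * R)                  ≈⟨ *-congˡ RR≈-1+R ⟩
        R * (- 1# + R)               ≈⟨ distribˡ R (- 1#) R ⟩
        R * - 1# + R * R             ≈⟨ +-cong (trans (sym (-‿distribʳ-* R 1#)) (-‿cong (*-identityʳ R))) RR≈-1+R ⟩
        - R + (- 1# + R)             ≈⟨ +-assoc (- R) (- 1#) R ⟨
        (- R + - 1#) + R             ≈⟨ +-congʳ (+-comm (- R) (- 1#)) ⟩
        (- 1# + - R) + R             ≈⟨ +-assoc (- 1#) (- R) R ⟩
        - 1# + (- R + R)             ≈⟨ +-congˡ (-‿inverseˡ R) ⟩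
        - 1# + 0#                    ≈⟨ +-identityʳ _ ⟩
        - 1#                         ∎

  -- The sequence 1, κ, κ², … for κ = 1 − κ² s is the only solution of a linear recursion,
  -- so κ commutes with everything that commutes with s.
  module PowersOf (s : Carrier)
    (unique : ∀ (C : ℕ → Carrier) → C 0 ≈ 0# → (∀ m → C (suc m) + C (2 ℕ.+ m) * s ≈ C m) → ∀ m → C m ≈ 0#)
    (B : ℕ → Carrier) (B₀≈1 : B 0 ≈ 1#) (B-step : ∀ m → B (suc m) + B (2 ℕ.+ m) * s ≈ B m) where

    B-commutes : ∀ {X} → Commutes X s → ∀ m → Commutes (B m) X
    B-commutes {X} Xs m = x-y≈0⇒x≈y (unique (λ m → B m * X - X * B m) base step m)
      where
      base : B 0 * X - X * B 0 ≈ 0#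
      base = trans (+-cong (trans (*-congʳ B₀≈1) (*-identityˡ X)) (-‿cong (trans (*-congˡ B₀≈1) (*-identityʳ X)))) (-‿inverseʳ X)
      step : ∀ m → (B (suc m) * X - X * B (suc m)) + (B (2 ℕ.+ m) * X - X * B (2 ℕ.+ m)) * s ≈ B m * X - X * B m
      step m = begin
        (B₁ * X - X * B₁) + (B₂ * X - X * B₂) * s          ≈⟨ +-congˡ ([y-z]x≈yx-zx s (B₂ * X) (X * B₂)) ⟩
        (B₁ * X - X * B₁) + (B₂ * X * s - X * B₂ * s)      ≈⟨ sub-interchange _ _ _ _ ⟩
        (B₁ * X + B₂ * X * s) - (X * B₁ + X * B₂ * s)      ≈⟨ +-cong (+-congˡ (trans (*-assoc B₂ X s) (trans (*-congˡ Xs) (sym (*-assoc B₂ s X)))))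
                                                                    (-‿cong (+-congˡ (*-assoc X B₂ s))) ⟩
        (B₁ * X + B₂ * s * X) - (X * B₁ + X * (B₂ * s))    ≈⟨ +-cong (distribʳ X B₁ (B₂ * s)) (-‿cong (distribˡ X B₁ (B₂ * s))) ⟨
        (B₁ + B₂ * s) * X - X * (B₁ + B₂ * s)              ≈⟨ +-cong (*-congʳ (B-step m)) (-‿cong (*-congˡ (B-step m))) ⟩
        B m * X - X * B m                                  ∎
        where
        B₁ = B (suc m)
        B₂ = B (2 ℕ.+ m)

    κ : Carrier
    κ = B 1

    -- The differences `κ Bₘ − Bₘ₊₁` solve the homogeneous recursion and start at 0. So `B 2` is
    -- identified with `κ²` by uniqueness, without multiplying out any series.
    κB≈B : ∀ m → κ * B m ≈ B (suc m)
    κB≈B m = x-y≈0⇒x≈y (unique (λ m → κ * B m - B (suc m)) base step m)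
      where
      base : κ * B 0 - B 1 ≈ 0#
      base = trans (+-congʳ (trans (*-congˡ B₀≈1) (*-identityʳ κ))) (-‿inverseʳ κ)
      step : ∀ m → (κ * B (suc m) - B (2 ℕ.+ m)) + (κ * B (2 ℕ.+ m) - B (3 ℕ.+ m)) * s ≈ κ * B m - B (suc m)
      step m = begin
        (κ * B₁ - B₂) + (κ * B₂ - B₃) * s            ≈⟨ +-congˡ ([y-z]x≈yx-zx s (κ * B₂) B₃) ⟩
        (κ * B₁ - B₂) + (κ * B₂ * s - B₃ * s)        ≈⟨ sub-interchange _ _ _ _ ⟩
        (κ * B₁ + κ * B₂ * s) - (B₂ + B₃ * s)        ≈⟨ +-cong (+-congˡ (*-assoc κ B₂ s)) (-‿cong (B-step (suc m))) ⟩
        (κ * B₁ + κ * (B₂ * s)) - B₁                 ≈⟨ +-congʳ (distribˡ κ B₁ (B₂ * s)) ⟨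
        κ * (B₁ + B₂ * s) - B₁                       ≈⟨ +-congʳ (*-congˡ (B-step m)) ⟩
        κ * B m - B₁                                 ∎
        where
        B₁ = B (suc m)
        B₂ = B (2 ℕ.+ m)
        B₃ = B (3 ℕ.+ m)

    κ+κκs≈1 : κ + κ * κ * s ≈ 1#
    κ+κκs≈1 = trans (+-congˡ (*-congʳ (κB≈B 1))) (trans (B-step 0) B₀≈1)

  -- Here `π` plays the projection onto the first basis vector: left multiplication by `π` retains
  -- the first row of a matrix. The hypothesis on `π * W` says that the first row of `W` is `−tκ`,
  -- and `Toeplitz-determined` that an element commuting with `N` is known from its first row.
  module InvolutionSquare (N U W : Carrier)
    (JU≈1 : (1# + N) * U ≈ 1#) (UJ≈1 : U * (1# + N) ≈ 1#)
    (NW+JWN≈J : N * W + (1# + N) * (W * N) ≈ 1# + N)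
    (unique : ∀ (C : ℕ → Carrier) → C 0 ≈ 0# →
      (∀ m → C (suc m) + C (2 ℕ.+ m) * (N * (N * U)) ≈ C m) → ∀ m → C m ≈ 0#)
    (B : ℕ → Carrier) (B₀≈1 : B 0 ≈ 1#)
    (B-step : ∀ m → B (suc m) + B (2 ℕ.+ m) * (N * (N * U)) ≈ B m)
    (π : Carrier) (πW+πNB₁≈0 : π * W + π * (N * B 1) ≈ 0#)
    (Toeplitz-determined : ∀ X → X * N ≈ N * X → π * X ≈ 0# → X ≈ 0#) where

    open Involution N U W JU≈1 UJ≈1 NW+JWN≈J public
    open PowersOf (N * V) unique B B₀≈1 B-step

    s : Carrier
    s = N * V

    πW≈-πNκ : π * W ≈ - (π * (N * κ))
    πW≈-πNκ = trans (x+y≈z⇒x≈z-y πW+πNB₁≈0) (+-identityˡ _)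

    NκVκ≈κκs : N * κ * (V * κ) ≈ κ * κ * s
    NκVκ≈κκs = begin
      N * κ * (V * κ)      ≈⟨ *-congʳ (B-commutes N-commutes-s 1) ⟨
      κ * N * (V * κ)      ≈⟨ *-assoc κ N (V * κ) ⟩
      κ * (N * (V * κ))    ≈⟨ *-congˡ (*-assoc N V κ) ⟨
      κ * (s * κ)          ≈⟨ *-congˡ (B-commutes refl 1) ⟨
      κ * (κ * s)          ≈⟨ *-assoc κ κ s ⟨
      κ * κ * s            ∎
      where
      N-commutes-s : Commutes N s
      N-commutes-s = trans (*-congˡ (sym VN≈NV)) (sym (*-assoc N V N))

    -- Moving `κ` to the right of `W` leaves `N W = 1 − W V`, where the first row of `W` appears a
    -- second time. The outcome is `−π (κ + κ² s)`, and the quadratic equation for `κ` finishes the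
    -- computation.
    πWW≈-π : π * (W * W) ≈ - π
    πWW≈-π = begin
      π * (W * W)                              ≈⟨ *-assoc π W W ⟨
      π * W * W                                ≈⟨ *-congʳ πW≈-πNκ ⟩
      - (π * (N * κ)) * W                      ≈⟨ -‿distribˡ-* _ _ ⟨
      - (π * (N * κ) * W)                      ≈⟨ -‿cong (trans (*-assoc π (N * κ) W) (*-congˡ (*-assoc N κ W))) ⟩
      - (π * (N * (κ * W)))                    ≈⟨ -‿cong (*-congˡ (*-congˡ (B-commutes W-commutes-NV 1))) ⟩
      - (π * (N * (W * κ)))                    ≈⟨ -‿cong (*-congˡ (trans (sym (*-assoc N W κ)) (trans (*-congʳ NW≈1-WV) ([1-y]x≈x-yx κ (W * V))))) ⟩
      - (π * (κ - W * V * κ))                  ≈⟨ -‿cong (x[y-z]≈xy-xz π κ (W * V * κ)) ⟩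
      - (π * κ - π * (W * V * κ))              ≈⟨ -‿cong (+-congˡ (-‿cong (trans (*-congˡ (*-assoc W V κ)) (sym (*-assoc π W (V * κ)))))) ⟩
      - (π * κ - π * W * (V * κ))              ≈⟨ -‿cong (+-congˡ (-‿cong (*-congʳ πW≈-πNκ))) ⟩
      - (π * κ - (- (π * (N * κ)) * (V * κ)))  ≈⟨ -‿cong (+-congˡ (trans (-‿cong (sym (-‿distribˡ-* _ _))) (-‿involutive _))) ⟩
      - (π * κ + π * (N * κ) * (V * κ))        ≈⟨ -‿cong (+-congˡ (trans (*-assoc π (N * κ) (V * κ)) (*-congˡ NκVκ≈κκs))) ⟩
      - (π * κ + π * (κ * κ * s))              ≈⟨ -‿cong (distribˡ π _ _) ⟨
      - (π * (κ + κ * κ * s))                  ≈⟨ -‿cong (trans (*-congˡ κ+κκs≈1) (*-identityʳ π)) ⟩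
      - π                                      ∎

    WW≈-1 : W * W ≈ - 1#
    WW≈-1 = trans (x+y≈z⇒x≈z-y (Toeplitz-determined (W * W + 1#) commutes vanishes)) (+-identityˡ _)
      where
      commutes : Commutes (W * W + 1#) N
      commutes = trans (distribʳ N (W * W) 1#) (trans
        (+-cong WW-commutes-N (trans (*-identityˡ N) (sym (*-identityʳ N)))) (sym (distribˡ N (W * W) 1#)))
      vanishes : π * (W * W + 1#) ≈ 0#
      vanishes = trans (distribˡ π (W * W) 1#) (trans (+-cong πWW≈-π (*-identityʳ π)) (-‿inverseˡ π))

    representation : Representation *-monoid W R
    representation = Presentation.representation *-monoid W R
      (trans (RRR≈-1 WW≈-1) (sym WW≈-1)) (trans (*-cong WW≈-1 WW≈-1) [-1][-1])

    open Representation representation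

    ⟦T⟧≈J : ⟦ T ⟧ ≈ J
    ⟦T⟧≈J = begin
      ⟦ T ⟧                     ≈⟨ ⟦T⟧ ⟩
      W * (W * (W * (W * J)))   ≈⟨ *-assoc W W _ ⟨
      W * W * (W * (W * J))     ≈⟨ *-congˡ (*-assoc W W J) ⟨
      W * W * (W * W * J)       ≈⟨ *-assoc (W * W) (W * W) J ⟨
      W * W * (W * W) * J       ≈⟨ *-congʳ (trans (*-cong WW≈-1 WW≈-1) [-1][-1]) ⟩
      1# * J                    ≈⟨ *-identityˡ J ⟩
      J                         ∎

-- The matrix W

module Operators (K : CommutativeRing 0ℓ 0ℓ) where
  open CommutativeRing K hiding (zero) renaming (Carrier to 𝕂)
  open LinearAlgebra K
  open import Algebra.Properties.CommutativeSemigroup +-commutativeSemigroup using (interchange)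
  private module 𝒜R = Ring 𝒜-ring
  open import Relation.Binary.Reasoning.Setoid setoid

  record IsLinear (f : E → E) : Set where
    field
      0-homo : f 0ᴱ ≈ᴱ 0ᴱ
      +-homo : ∀ v w → f (v +ᴱ w) ≈ᴱ f v +ᴱ f w
      *-homo : ∀ c v → f (c *ᴱ v) ≈ᴱ c *ᴱ f v
      f-cong : ∀ {v w} → v ≈ᴱ w → f v ≈ᴱ f w

  linear-· : ∀ f → IsLinear f → ∀ v → (f ∘ e) · v ≈ᴱ f v
  linear-· f lin v i = trans (sym (combination-image E-space f 0-homo +-homo *-homo v e i))
    (f-cong (·-identity v) i)
    where open IsLinear lin

  ·-0 : ∀ M {v} → v ≈ᴱ 0ᴱ → M · v ≈ᴱ 0ᴱ
  ·-0 M {v} p = ·-cong {M} {M} {v} {0ᴱ} (λ _ _ → refl) p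

  ·-congʳ : ∀ M {v w} → v ≈ᴱ w → M · v ≈ᴱ M · w
  ·-congʳ M {v} {w} p = ·-cong {M} {M} {v} {w} (λ _ _ → refl) p

  shift : E → E
  shift v = record
    { coeff  = coeff v ∘ suc
    ; bound  = bound v
    ; finite = λ i p → finite v (suc i) (ℕₚ.m≤n⇒m≤1+n p)
    }

  cons : 𝕂 → E → E
  cons c v = record
    { coeff  = λ { zero → c ; (suc i) → coeff v i }
    ; bound  = suc (bound v)
    ; finite = λ { (suc i) (ℕ.s≤s p) → finite v i p }
    }

  head : E → E
  head v = coeff v 0 *ᴱ e 0

  N π : 𝒜
  N = shift ∘ e
  π = head ∘ e

  N· : ∀ v → N · v ≈ᴱ shift v
  N· = linear-· shift record
    { 0-homo = λ _ → refl ; +-homo = λ _ _ _ → refl ; *-homo = λ _ _ _ → refl ; f-cong = λ p i → p (suc i) }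

  π· : ∀ v → π · v ≈ᴱ head v
  π· = linear-· head record
    { 0-homo = λ _ → zeroˡ _ ; +-homo = λ v w i → distribʳ _ _ _ ; *-homo = λ c v i → *-assoc _ _ _
    ; f-cong = λ p i → *-congʳ (p 0) }

  J : 𝒜
  J = e 𝒜R.+ N

  step : E → E
  step v = v +ᴱ shift v

  J· : ∀ v → J · v ≈ᴱ step v
  J· v i = trans (+-· e N v i) (+-cong (·-identity v i) (N· v i))

  shift-e₀ : shift (e 0) ≈ᴱ 0ᴱ
  shift-e₀ _ = refl

  J∞≈J : J∞ 𝒜R.≈ J
  J∞≈J = entry-≈
    where
    δ : ℕ → ℕ → 𝕂
    δ i j = if does (i ℕₚ.≟ j) then 1# else 0#
    entry-≈ : ∀ j i → (if does (j ℕₚ.≟ i) ∨ does (j ℕₚ.≟ suc i) then 1# else 0#) ≈ δ i j + δ (suc i) j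
    entry-≈ zero          zero    = sym (+-identityʳ 1#)
    entry-≈ zero          (suc i) = sym (+-identityʳ 0#)
    entry-≈ (suc zero)    zero    = sym (+-identityˡ 1#)
    entry-≈ (suc (suc j)) zero    = sym (+-identityʳ 0#)
    entry-≈ (suc j)       (suc i) = entry-≈ j i

  -- The inverse of `J`, from `J e_{j+1} = e_{j+1} + e_j` solved column by column: column `j` is the
  -- alternating sum of `e_j, e_{j−1}, …, e_0`.
  U : 𝒜
  U zero    = e 0
  U (suc j) = e (suc j) +ᴱ -ᴱ U j

  J·U : ∀ j → step (U j) ≈ᴱ e j
  J·U zero    i = +-identityʳ _
  J·U (suc j) i = begin
    (δ′ + - u) + (coeff (e j) i + - coeff (U j) (suc i))  ≈⟨ interchange _ _ _ _ ⟩
    (δ′ + coeff (e j) i) + (- u + - coeff (U j) (suc i))  ≈⟨ +-congˡ (⁻¹-∙-comm _ _) ⟩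
    (δ′ + coeff (e j) i) + - coeff (step (U j)) i         ≈⟨ +-congˡ (-‿cong (J·U j i)) ⟩
    (δ′ + coeff (e j) i) + - coeff (e j) i                ≈⟨ +-assoc _ _ _ ⟩
    δ′ + (coeff (e j) i + - coeff (e j) i)                ≈⟨ +-congˡ (-‿inverseʳ _) ⟩
    δ′ + 0#                                               ≈⟨ +-identityʳ _ ⟩
    δ′                                                    ∎
    where
    open import Algebra.Properties.AbelianGroup +-abelianGroup using (⁻¹-∙-comm)
    δ′ = coeff (e (suc j)) i
    u  = coeff (U j) i

  JU≈1 : J 𝒜R.* U 𝒜R.≈ 𝒜R.1#
  JU≈1 j i = trans (J· (U j) i) (J·U j i)

  ·-J : ∀ M j → M · J j ≈ᴱ M j +ᴱ M · shift (e j)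
  ·-J M j i = trans (·-+ M (e j) (shift (e j)) i) (+-congʳ (·-e M j i))

  ·-shift-e : ∀ M j → M · shift (e (suc j)) ≈ᴱ M j
  ·-shift-e M j i = trans (·-congʳ M {shift (e (suc j))} {e j} (λ _ → refl) i) (·-e M j i)

  UJ≈1 : U 𝒜R.* J 𝒜R.≈ 𝒜R.1#
  UJ≈1 zero    i = trans (·-J U 0 i) (trans (+-congˡ (·-0 U {shift (e 0)} shift-e₀ i)) (+-identityʳ _))
  UJ≈1 (suc j) i = trans (·-J U (suc j) i) (trans (+-congˡ (·-shift-e U j i))
    (trans (+-assoc _ _ _) (trans (+-congˡ (-‿inverseˡ _)) (+-identityʳ _))))

  -- Column j of κᵐ, from (κᵐ⁺¹ − κᵐ) J = −κᵐ⁺² N².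
  B-column : ℕ → ℕ → E
  B-column zero          m       = e 0
  B-column (suc j)       zero    = e (suc j)
  B-column (suc zero)    (suc m) = (B-column 1 m +ᴱ B-column 0 m) +ᴱ -ᴱ B-column 0 (suc m)
  B-column (suc (suc j)) (suc m) = (B-column (suc (suc j)) m +ᴱ B-column (suc j) m)
    +ᴱ -ᴱ (B-column (suc j) (suc m) +ᴱ B-column j (suc (suc m)))

  B : ℕ → 𝒜
  B m j = B-column j m

  s : 𝒜
  s = N 𝒜R.* (N 𝒜R.* U)

  NN-column : ∀ j → (N 𝒜R.* N) (2 ℕ.+ j) ≈ᴱ e j
  NN-column j = N· (shift (e (2 ℕ.+ j)))

  NN-column₀ : (N 𝒜R.* N) 0 ≈ᴱ 0ᴱ
  NN-column₀ = N· (shift (e 0))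

  NN-column₁ : (N 𝒜R.* N) 1 ≈ᴱ 0ᴱ
  NN-column₁ = N· (shift (e 1))

  *J-column₀ : ∀ X → (X 𝒜R.* J) 0 ≈ᴱ X 0
  *J-column₀ X i = trans (·-J X 0 i) (trans (+-congˡ (·-0 X {shift (e 0)} shift-e₀ i)) (+-identityʳ _))

  *J-column : ∀ X j → (X 𝒜R.* J) (suc j) ≈ᴱ X (suc j) +ᴱ X j
  *J-column X j i = trans (·-J X (suc j) i) (+-congˡ (·-shift-e X j i))

  module _ (X Y : 𝒜) where
    recursion-column₀ : (X 𝒜R.* J 𝒜R.+ Y 𝒜R.* (N 𝒜R.* N)) 0 ≈ᴱ X 0
    recursion-column₀ i = trans (+-cong (*J-column₀ X i) (·-0 Y {(N 𝒜R.* N) 0} NN-column₀ i)) (+-identityʳ _)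

    recursion-column₁ : (X 𝒜R.* J 𝒜R.+ Y 𝒜R.* (N 𝒜R.* N)) 1 ≈ᴱ X 1 +ᴱ X 0
    recursion-column₁ i = trans (+-cong (*J-column X 0 i) (·-0 Y {(N 𝒜R.* N) 1} NN-column₁ i)) (+-identityʳ _)

    recursion-column : ∀ j → (X 𝒜R.* J 𝒜R.+ Y 𝒜R.* (N 𝒜R.* N)) (2 ℕ.+ j) ≈ᴱ (X (2 ℕ.+ j) +ᴱ X (suc j)) +ᴱ Y j
    recursion-column j i = +-cong (*J-column X (suc j) i)
      (trans (·-congʳ Y {(N 𝒜R.* N) (2 ℕ.+ j)} {e j} (NN-column j) i) (·-e Y j i))

  x-y+y≈x : ∀ x y → (x + - y) + y ≈ x
  x-y+y≈x x y = trans (+-assoc _ _ _) (trans (+-congˡ (-‿inverseˡ y)) (+-identityʳ x))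

  -- Multiplying the recursion by the invertible `J` replaces `s`, whose columns are long
  -- alternating sums, by `N²`; each column of the identity then involves at most two earlier
  -- columns.
  B-step-J : ∀ m → B (suc m) 𝒜R.* J 𝒜R.+ B (2 ℕ.+ m) 𝒜R.* (N 𝒜R.* N) 𝒜R.≈ B m 𝒜R.* J
  B-step-J m zero          i = trans (recursion-column₀ (B (suc m)) (B (2 ℕ.+ m)) i) (sym (*J-column₀ (B m) i))
  B-step-J m (suc zero)    i = trans (recursion-column₁ (B (suc m)) (B (2 ℕ.+ m)) i)
    (trans (x-y+y≈x _ _) (sym (*J-column (B m) 0 i)))
  B-step-J m (suc (suc j)) i = trans (recursion-column (B (suc m)) (B (2 ℕ.+ m)) j i)
    (trans (+-assoc _ _ _) (trans (x-y+y≈x _ _) (sym (*J-column (B m) (suc j) i))))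

  sJ≈NN : s 𝒜R.* J 𝒜R.≈ N 𝒜R.* N
  sJ≈NN = 𝒜R.trans {s 𝒜R.* J} {N 𝒜R.* (N 𝒜R.* U 𝒜R.* J)} {N 𝒜R.* N} (𝒜R.*-assoc N (N 𝒜R.* U) J)
    (𝒜R.*-congˡ {N} {N 𝒜R.* U 𝒜R.* J} {N}
      (𝒜R.trans {N 𝒜R.* U 𝒜R.* J} {N 𝒜R.* (U 𝒜R.* J)} {N} (𝒜R.*-assoc N U J)
        (𝒜R.trans {N 𝒜R.* (U 𝒜R.* J)} {N 𝒜R.* 𝒜R.1#} {N}
          (𝒜R.*-congˡ {N} {U 𝒜R.* J} {𝒜R.1#} UJ≈1) (𝒜R.*-identityʳ N))))

  private
    [X+Ys]J≈XJ+YNN : ∀ X Y → (X 𝒜R.+ Y 𝒜R.* s) 𝒜R.* J 𝒜R.≈ X 𝒜R.* J 𝒜R.+ Y 𝒜R.* (N 𝒜R.* N)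
    [X+Ys]J≈XJ+YNN X Y j i = trans (𝒜R.distribʳ J X (Y 𝒜R.* s) j i)
      (+-congˡ (trans (𝒜R.*-assoc Y s J j i) (𝒜R.*-congˡ {Y} {s 𝒜R.* J} {N 𝒜R.* N} sJ≈NN j i)))

    XJU≈X : ∀ X → X 𝒜R.* J 𝒜R.* U 𝒜R.≈ X
    XJU≈X X j i = trans (𝒜R.*-assoc X J U j i)
      (trans (𝒜R.*-congˡ {X} {J 𝒜R.* U} {𝒜R.1#} JU≈1 j i) (𝒜R.*-identityʳ X j i))

  B-step : ∀ m → B (suc m) 𝒜R.+ B (2 ℕ.+ m) 𝒜R.* s 𝒜R.≈ B m
  B-step m j i = begin
    coeff (X j) i                          ≈⟨ XJU≈X X j i ⟨
    coeff ((X 𝒜R.* J 𝒜R.* U) j) i          ≈⟨ 𝒜R.*-congʳ {U} {X 𝒜R.* J} {B m 𝒜R.* J}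
                                                (λ j i → trans ([X+Ys]J≈XJ+YNN (B (suc m)) (B (2 ℕ.+ m)) j i) (B-step-J m j i)) j i ⟩
    coeff ((B m 𝒜R.* J 𝒜R.* U) j) i        ≈⟨ XJU≈X (B m) j i ⟩
    coeff (B m j) i                        ∎
    where
    X = B (suc m) 𝒜R.+ B (2 ℕ.+ m) 𝒜R.* s

  -- Induction on the column, then on `m`. The term of higher index `m + 2` is no obstruction,
  -- because right multiplication by `N²` makes it enter only through the column two places to the
  -- left.
  recursion-unique : ∀ (C : ℕ → 𝒜) → C 0 𝒜R.≈ 𝒜R.0# →
    (∀ m → C (suc m) 𝒜R.+ C (2 ℕ.+ m) 𝒜R.* s 𝒜R.≈ C m) → ∀ m → C m 𝒜R.≈ 𝒜R.0#
  recursion-unique C C₀≈0 C-step m j = vanish j m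
    where
    C-step-J : ∀ m → C (suc m) 𝒜R.* J 𝒜R.+ C (2 ℕ.+ m) 𝒜R.* (N 𝒜R.* N) 𝒜R.≈ C m 𝒜R.* J
    C-step-J m j i = trans (sym ([X+Ys]J≈XJ+YNN (C (suc m)) (C (2 ℕ.+ m)) j i))
      (𝒜R.*-congʳ {J} {C (suc m) 𝒜R.+ C (2 ℕ.+ m) 𝒜R.* s} {C m} (C-step m) j i)

    x+0≈y+0 : ∀ {x y a b} → x + a ≈ y + b → a ≈ 0# → b ≈ 0# → x ≈ y
    x+0≈y+0 {x} {y} p a≈0 b≈0 = trans (sym (trans (+-congˡ a≈0) (+-identityʳ x))) (trans p (trans (+-congˡ b≈0) (+-identityʳ y)))

    vanish : ∀ j m → C m j ≈ᴱ 0ᴱ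
    vanish j zero = C₀≈0 j
    vanish zero (suc m) i = trans (sym (recursion-column₀ (C (suc m)) (C (2 ℕ.+ m)) i))
      (trans (C-step-J m 0 i) (trans (*J-column₀ (C m) i) (vanish zero m i)))
    vanish (suc zero) (suc m) i = trans (x+0≈y+0
      (trans (sym (recursion-column₁ (C (suc m)) (C (2 ℕ.+ m)) i)) (trans (C-step-J m 1 i) (*J-column (C m) 0 i)))
      (vanish zero (suc m) i) (vanish zero m i)) (vanish (suc zero) m i)
    vanish (suc (suc j)) (suc m) i = trans (x+0≈y+0
      (x+0≈y+0 (trans (sym (recursion-column (C (suc m)) (C (2 ℕ.+ m)) j i))
          (trans (C-step-J m (2 ℕ.+ j) i) (trans (*J-column (C m) (suc j) i) (sym (+-identityʳ _)))))
        (vanish j (2 ℕ.+ m) i) refl)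
      (vanish (suc j) (suc m) i) (vanish (suc j) m i)) (vanish (suc (suc j)) m i)

  -- The first row is −tκ, and the other ones solve N W = J (1 − W N).
  W : 𝒜
  W zero    = cons (- coeff (B 1 0) 1) (step (e 0))
  W (suc j) = cons (- coeff (B 1 (suc j)) 1) (step (e (suc j) +ᴱ -ᴱ W j))

  NW+JWN≈J : N 𝒜R.* W 𝒜R.+ J 𝒜R.* (W 𝒜R.* N) 𝒜R.≈ J
  NW+JWN≈J zero i = trans (+-cong (N· (W 0) i) (·-0 J {(W 𝒜R.* N) 0} (·-0 W {shift (e 0)} shift-e₀) i)) (+-identityʳ _)
  NW+JWN≈J (suc j) i = trans (+-cong (N· (W (suc j)) i)
      (trans (·-congʳ J {(W 𝒜R.* N) (suc j)} {W j} (·-shift-e W j) i) (J· (W j) i)))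
    (trans (interchange _ _ _ _) (+-cong (x-y+y≈x _ _) (x-y+y≈x _ _)))

  πW+πNB₁≈0 : π 𝒜R.* W 𝒜R.+ π 𝒜R.* (N 𝒜R.* B 1) 𝒜R.≈ 𝒜R.0#
  πW+πNB₁≈0 j i = begin
    coeff (π · W j) i + coeff (π · (N · B 1 j)) i                         ≈⟨ +-cong (π· (W j) i) (π· (N · B 1 j) i) ⟩
    coeff (W j) 0 * coeff (e 0) i + coeff (N · B 1 j) 0 * coeff (e 0) i   ≈⟨ distribʳ _ _ _ ⟨
    (coeff (W j) 0 + coeff (N · B 1 j) 0) * coeff (e 0) i                 ≈⟨ *-congʳ (trans (+-cong (row₀ j) (N· (B 1 j) 0)) (-‿inverseˡ _)) ⟩
    0# * coeff (e 0) i                                                    ≈⟨ zeroˡ _ ⟩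
    0#                                                                    ∎
    where
    row₀ : ∀ j → coeff (W j) 0 ≈ - coeff (B 1 j) 1
    row₀ zero    = refl
    row₀ (suc j) = refl

  -- Entrywise, `X N = N X` says that `X` is constant along diagonals and zero below the main one,
  -- so every row is the first row shifted.
  Toeplitz-determined : ∀ X → X 𝒜R.* N 𝒜R.≈ N 𝒜R.* X → π 𝒜R.* X 𝒜R.≈ 𝒜R.0# → X 𝒜R.≈ 𝒜R.0#
  Toeplitz-determined X XN≈NX πX≈0 = λ j i → entry-≈ i j
    where
    entry-≈ : ∀ i j → coeff (X j) i ≈ 0#
    entry-≈ zero    j       = trans (sym (trans (π· (X j) 0) (*-identityʳ _))) (πX≈0 j 0)
    entry-≈ (suc i) zero    = trans (sym (N· (X 0) i)) (trans (sym (XN≈NX 0 i)) (·-0 X {shift (e 0)} shift-e₀ i))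
    entry-≈ (suc i) (suc j) = trans (sym (N· (X (suc j)) i))
      (trans (sym (XN≈NX (suc j) i)) (trans (·-shift-e X j i) (entry-≈ i j)))

  private
    B₀≈1 : B 0 𝒜R.≈ 𝒜R.1#
    B₀≈1 zero    i = refl
    B₀≈1 (suc j) i = refl

  open QuadraticRelations.InvolutionSquare 𝒜-ring N U W JU≈1 UJ≈1 NW+JWN≈J
    recursion-unique B B₀≈1 B-step π πW+πNB₁≈0 Toeplitz-determined
    using (R; representation; ⟦T⟧≈J) public

-- Diagonal blocks and growth of `W` over ℤ

module IntegerMatrices where

  open LinearAlgebra ℤₚ.+-*-commutativeRing using (coeff; e; 𝒜-ring; J∞) renaming (𝒜 to 𝒜ᶻ)

  double : ℕ → ℕ
  double zero    = zero
  double (suc k) = suc (suc (double k))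

  -- The four block entries are those of `Tᵏ S T⁻ᵏ`; `below` is the subdiagonal zero that separates
  -- this block from the next.
  record Block (W : 𝒜ᶻ) (k : ℕ) : Set where
    private n = double k
    field
      lower-left  : coeff (W n) (suc n) ≡ 1ℤ
      below       : coeff (W (suc n)) (2 ℕ.+ n) ≡ 0ℤ
      upper-left  : coeff (W n) n ≡ + k
      lower-right : coeff (W (suc n)) (suc n) ≡ ℤ.- (+ k)
      upper-right : coeff (W (suc n)) n ≡ ℤ.- (1ℤ ℤ.+ + k ℤ.* + k)

  record IntegralModel : Set₁ where
    field
      W R            : 𝒜ᶻ
      representation : Representation (Ring.*-monoid 𝒜-ring) W R
      WJ∞≈R          : Ring._≈_ 𝒜-ring (Ring._*_ 𝒜-ring W J∞) R
      ⟦T⟧≈J∞         : Ring._≈_ 𝒜-ring (Representation.⟦_⟧ representation T) J∞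
      W-lower        : ∀ j i → suc j ℕ.< i → coeff (W j) i ≡ 0ℤ
      W-block        : ∀ k → Block W k
      W-bound        : ∀ j i → ℤ.∣ coeff (W j) i ∣ ℕ.≤ 4 ℕ.^ suc j

  private
    module O = Operators ℤₚ.+-*-commutativeRing
    open O using (W; B; B-column)

    e-diagonal : ∀ n → coeff (e n) n ≡ 1ℤ
    e-diagonal n = cong (λ b → if b then 1ℤ else 0ℤ) (dec-true (n ℕₚ.≟ n) ≡.refl)

    e-off-diagonal : ∀ n i → i ≢ n → coeff (e n) i ≡ 0ℤ
    e-off-diagonal n i i≢n = cong (λ b → if b then 1ℤ else 0ℤ) (dec-false (i ℕₚ.≟ n) i≢n)

    ∣e∣≤1 : ∀ n i → ℤ.∣ coeff (e n) i ∣ ℕ.≤ 1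
    ∣e∣≤1 n i with does (i ℕₚ.≟ n)
    ... | true  = ℕₚ.≤-refl
    ... | false = ℕ.z≤n

    W-step : ∀ j i {p q r s} → coeff (e (suc j)) i ≡ p → coeff (W j) i ≡ q →
      coeff (e (suc j)) (suc i) ≡ r → coeff (W j) (suc i) ≡ s →
      coeff (W (suc j)) (suc i) ≡ (p ℤ.- q) ℤ.+ (r ℤ.- s)
    W-step j i ≡.refl ≡.refl ≡.refl ≡.refl = ≡.refl

    W-lower : ∀ j i → suc j ℕ.< i → coeff (W j) i ≡ 0ℤ
    W-lower zero    (suc i) (ℕ.s≤s 0<i) = cong₂ ℤ._+_ (e-off-diagonal 0 i (ℕₚ.>⇒≢ 0<i)) (e-off-diagonal 0 (suc i) λ ())
    W-lower (suc j) (suc i) (ℕ.s≤s p)   = W-step j i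
      (e-off-diagonal (suc j) i (ℕₚ.>⇒≢ p)) (W-lower j i p)
      (e-off-diagonal (suc j) (suc i) (ℕₚ.>⇒≢ (ℕₚ.m<n⇒m<1+n p))) (W-lower j (suc i) (ℕₚ.m<n⇒m<1+n p))

    -- Along the subdiagonal the recursion is `w ↦ 1 − w`. Started at 1, it alternates 1, 0, 1, 0,
    -- ..., which is why the filtration grows by two dimensions at a time.
    below-diagonal : ∀ j → coeff (W (suc j)) (2 ℕ.+ j) ≡ (1ℤ ℤ.- coeff (W j) (suc j)) ℤ.+ (0ℤ ℤ.- 0ℤ)
    below-diagonal j = W-step j (suc j) (e-diagonal (suc j)) ≡.refl
      (e-off-diagonal (suc j) (2 ℕ.+ j) ℕₚ.1+n≢n) (W-lower j (2 ℕ.+ j) ℕₚ.≤-refl)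

    diagonal : ∀ j → coeff (W (suc j)) (suc j) ≡ (0ℤ ℤ.- coeff (W j) j) ℤ.+ (1ℤ ℤ.- coeff (W j) (suc j))
    diagonal j = W-step j j (e-off-diagonal (suc j) j (ℕₚ.1+n≢n ∘ ≡.sym)) ≡.refl (e-diagonal (suc j)) ≡.refl

    above-diagonal : ∀ j → coeff (W (2 ℕ.+ j)) (suc j) ≡ (0ℤ ℤ.- coeff (W (suc j)) j) ℤ.+ (0ℤ ℤ.- coeff (W (suc j)) (suc j))
    above-diagonal j = W-step (suc j) j (e-off-diagonal (2 ℕ.+ j) j (ℕₚ.<⇒≢ (ℕₚ.m<n⇒m<1+n (ℕₚ.n<1+n j)))) ≡.refl
      (e-off-diagonal (2 ℕ.+ j) (suc j) (ℕₚ.<⇒≢ (ℕₚ.n<1+n (suc j)))) ≡.refl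

    upper-right-step : ∀ k → (0ℤ ℤ.- ((0ℤ ℤ.- (ℤ.- (1ℤ ℤ.+ k ℤ.* k))) ℤ.+ (0ℤ ℤ.- (ℤ.- k)))) ℤ.+ (0ℤ ℤ.- (1ℤ ℤ.+ k))
      ≡ ℤ.- (1ℤ ℤ.+ (1ℤ ℤ.+ k) ℤ.* (1ℤ ℤ.+ k))
    upper-right-step = ℤ-solver.solve-∀

    upper-left-step : ∀ k → (0ℤ ℤ.- (ℤ.- k)) ℤ.+ (1ℤ ℤ.- 0ℤ) ≡ 1ℤ ℤ.+ k
    upper-left-step = ℤ-solver.solve-∀

    lower-right-step : ∀ k → (0ℤ ℤ.- (1ℤ ℤ.+ k)) ℤ.+ (1ℤ ℤ.- 1ℤ) ≡ ℤ.- (1ℤ ℤ.+ k)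
    lower-right-step = ℤ-solver.solve-∀

    W-block : ∀ k → Block W k
    W-block zero    = record
      -- The upper entries 0 and -1 belong to the first row `−tκ`, a series that starts with `−t`;
      -- they make block 0 equal to `S`.
      { lower-left = ≡.refl ; below = ≡.refl ; upper-left = ≡.refl ; lower-right = ≡.refl ; upper-right = ≡.refl }
    W-block (suc k) = record
      { lower-left  = lower-left′
      ; below       = ≡.trans (below-diagonal (2 ℕ.+ n)) (cong (λ x → (1ℤ ℤ.- x) ℤ.+ 0ℤ) lower-left′)
      ; upper-left  = upper-left′
      ; lower-right = ≡.trans (diagonal (2 ℕ.+ n)) (≡.trans
          (cong₂ (λ x y → (0ℤ ℤ.- x) ℤ.+ (1ℤ ℤ.- y)) upper-left′ lower-left′) (lower-right-step (+ k)))
      ; upper-right = ≡.trans (above-diagonal (suc n)) (≡.trans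
          (cong₂ (λ x y → (0ℤ ℤ.- x) ℤ.+ (0ℤ ℤ.- y))
            (≡.trans (above-diagonal n) (cong₂ (λ x y → (0ℤ ℤ.- x) ℤ.+ (0ℤ ℤ.- y)) upper-right lower-right))
            upper-left′)
          (upper-right-step (+ k)))
      }
      where
      n = double k
      open Block (W-block k)
      lower-left′ : coeff (W (2 ℕ.+ n)) (3 ℕ.+ n) ≡ 1ℤ
      lower-left′ = ≡.trans (below-diagonal (suc n)) (cong (λ x → (1ℤ ℤ.- x) ℤ.+ 0ℤ) below)
      upper-left′ : coeff (W (2 ℕ.+ n)) (2 ℕ.+ n) ≡ + suc k
      upper-left′ = ≡.trans (diagonal (suc n)) (≡.trans
        (cong₂ (λ x y → (0ℤ ℤ.- x) ℤ.+ (1ℤ ℤ.- y)) lower-right below) (upper-left-step (+ k)))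

    ∣x-y∣≤ : ∀ {x y m n} → ℤ.∣ x ∣ ℕ.≤ m → ℤ.∣ y ∣ ℕ.≤ n → ℤ.∣ x ℤ.- y ∣ ℕ.≤ m ℕ.+ n
    ∣x-y∣≤ {x} {y} p q = ℕₚ.≤-trans (ℤₚ.∣i-j∣≤∣i∣+∣j∣ x y) (ℕₚ.+-mono-≤ p q)

    ∣x+y∣≤ : ∀ {x y m n} → ℤ.∣ x ∣ ℕ.≤ m → ℤ.∣ y ∣ ℕ.≤ n → ℤ.∣ x ℤ.+ y ∣ ℕ.≤ m ℕ.+ n
    ∣x+y∣≤ {x} {y} p q = ℕₚ.≤-trans (ℤₚ.∣i+j∣≤∣i∣+∣j∣ x y) (ℕₚ.+-mono-≤ p q)

    1≤4^ : ∀ n → 1 ℕ.≤ 4 ℕ.^ n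
    1≤4^ n = ℕₚ.m^n>0 4 n

    growth₁ : ∀ x → (4 ℕ.* x ℕ.+ x) ℕ.+ 4 ℕ.* x ℕ.≤ 4 ℕ.* (4 ℕ.* x)
    growth₁ x = subst ((4 ℕ.* x ℕ.+ x) ℕ.+ 4 ℕ.* x ℕ.≤_) (total x) (ℕₚ.m≤m+n _ (7 ℕ.* x))
      where
      total : ∀ x → ((4 ℕ.* x ℕ.+ x) ℕ.+ 4 ℕ.* x) ℕ.+ 7 ℕ.* x ≡ 4 ℕ.* (4 ℕ.* x)
      total = ℕ-solver.solve-∀

    growth₂ : ∀ x → (4 ℕ.* (4 ℕ.* x) ℕ.+ 4 ℕ.* x) ℕ.+ (4 ℕ.* (4 ℕ.* x) ℕ.+ 4 ℕ.* (4 ℕ.* x)) ℕ.≤ 4 ℕ.* (4 ℕ.* (4 ℕ.* x))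
    growth₂ x = subst ((4 ℕ.* (4 ℕ.* x) ℕ.+ 4 ℕ.* x) ℕ.+ (4 ℕ.* (4 ℕ.* x) ℕ.+ 4 ℕ.* (4 ℕ.* x)) ℕ.≤_) (total x) (ℕₚ.m≤m+n _ (12 ℕ.* x))
      where
      total : ∀ x → ((4 ℕ.* (4 ℕ.* x) ℕ.+ 4 ℕ.* x) ℕ.+ (4 ℕ.* (4 ℕ.* x) ℕ.+ 4 ℕ.* (4 ℕ.* x))) ℕ.+ 12 ℕ.* x ≡ 4 ℕ.* (4 ℕ.* (4 ℕ.* x))
      total = ℕ-solver.solve-∀

    growth₃ : ∀ {x} → 1 ℕ.≤ x → (1 ℕ.+ x) ℕ.+ (1 ℕ.+ x) ℕ.≤ 4 ℕ.* x
    growth₃ {x} 1≤x = subst ((1 ℕ.+ x) ℕ.+ (1 ℕ.+ x) ℕ.≤_) (total x) (ℕₚ.+-mono-≤ 1+x≤2x 1+x≤2x)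
      where
      1+x≤2x : 1 ℕ.+ x ℕ.≤ x ℕ.+ x
      1+x≤2x = ℕₚ.+-monoˡ-≤ x 1≤x
      total : ∀ x → (x ℕ.+ x) ℕ.+ (x ℕ.+ x) ≡ 4 ℕ.* x
      total = ℕ-solver.solve-∀

    -- The column index and the exponent are weighted together, since the recursion trades one for
    -- the other. In units of `4^(j+m)` the four terms add up to 16 + 4 + 16 + 16 = 52, below the
    -- required 64; 4 is the least integer `b` with `3b + 1 ≤ b²`.
    B-bound : ∀ j m i → ℤ.∣ coeff (B m j) i ∣ ℕ.≤ 4 ℕ.^ (j ℕ.+ m)
    B-bound zero          m       i = ℕₚ.≤-trans (∣e∣≤1 0 i) (1≤4^ m)
    B-bound (suc j)       zero    i = ℕₚ.≤-trans (∣e∣≤1 (suc j) i) (1≤4^ (suc j ℕ.+ 0))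
    B-bound (suc zero)    (suc m) i = ℕₚ.≤-trans
      (∣x-y∣≤ {coeff (B m 1) i ℤ.+ coeff (B m 0) i} (∣x+y∣≤ {coeff (B m 1) i} (B-bound 1 m i) (B-bound 0 m i)) (B-bound 0 (suc m) i))
      (growth₁ (4 ℕ.^ m))
    B-bound (suc (suc j)) (suc m) i = ℕₚ.≤-trans
      (∣x-y∣≤ {coeff (B m (2 ℕ.+ j)) i ℤ.+ coeff (B m (suc j)) i}
        (∣x+y∣≤ {coeff (B m (2 ℕ.+ j)) i} (B-bound (suc (suc j)) m i) (B-bound (suc j) m i))
        (∣x+y∣≤ {coeff (B (suc m) (suc j)) i} (B-bound (suc j) (suc m) i) (B-bound j (suc (suc m)) i)))
      (subst₂ (λ p q → (4 ℕ.^ (2 ℕ.+ (j ℕ.+ m)) ℕ.+ 4 ℕ.^ (1 ℕ.+ (j ℕ.+ m))) ℕ.+ (4 ℕ.^ suc p ℕ.+ 4 ℕ.^ q) ℕ.≤ 4 ℕ.^ (2 ℕ.+ p))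
        (≡.sym (ℕₚ.+-suc j m)) (≡.sym (≡.trans (ℕₚ.+-suc j (suc m)) (cong suc (ℕₚ.+-suc j m))))
        (growth₂ (4 ℕ.^ (j ℕ.+ m))))

    -- The first row inherits the bound for `κ = B 1`. In the other rows an entry combines two
    -- entries of the previous column and two of the identity, so a bound `x ≥ 1` becomes
    -- `2 (1 + x) ≤ 4x`.
    W-bound : ∀ j i → ℤ.∣ coeff (W j) i ∣ ℕ.≤ 4 ℕ.^ suc j
    W-bound zero    zero    = ℕ.z≤n
    W-bound zero    (suc i) = ℕₚ.≤-trans (∣x+y∣≤ {coeff (e 0) i} (∣e∣≤1 0 i) (∣e∣≤1 0 (suc i))) (ℕₚ.m≤m+n 2 2)
    W-bound (suc j) zero    = subst₂ ℕ._≤_ (≡.sym (ℤₚ.∣-i∣≡∣i∣ (coeff (B 1 (suc j)) 1)))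
      (cong (4 ℕ.^_) (ℕₚ.+-comm (suc j) 1)) (B-bound (suc j) 1 1)
    W-bound (suc j) (suc i) = ℕₚ.≤-trans
      (∣x+y∣≤ {coeff (e (suc j)) i ℤ.- coeff (W j) i}
        (∣x-y∣≤ {coeff (e (suc j)) i} (∣e∣≤1 (suc j) i) (W-bound j i))
        (∣x-y∣≤ {coeff (e (suc j)) (suc i)} (∣e∣≤1 (suc j) (suc i)) (W-bound j (suc i))))
      (growth₃ (1≤4^ (suc j)))

  abstract
    integralModel : IntegralModel
    integralModel = record
      { W = W
      ; R = O.R
      ; representation = O.representation
      ; WJ∞≈R = Ring.*-congˡ 𝒜-ring {W} {J∞} {O.J} O.J∞≈J
      ; ⟦T⟧≈J∞ = λ j i → ≡.trans (O.⟦T⟧≈J j i) (≡.sym (O.J∞≈J j i))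
      ; W-lower = W-lower
      ; W-block = W-block
      ; W-bound = W-bound
      }

open IntegerMatrices

-- Extension of scalars and the filtration

2*≡double : ∀ k → 2 ℕ.* k ≡ double k
2*≡double zero    = ≡.refl
2*≡double (suc k) = cong suc (≡.trans (ℕₚ.+-suc k (k ℕ.+ 0)) (cong suc (2*≡double k)))

-- Abstract, so that comparing inverses never normalises the determinant proofs they store.
abstract
  adjugate : SL₂ → SL₂
  adjugate = Group._⁻¹ SL₂ℤ

  ⁻¹≈adjugate : ∀ X → Group._⁻¹ SL₂ℤ X ≈SL₂ adjugate X
  ⁻¹≈adjugate X = entries≡ ≡.refl ≡.refl ≡.refl ≡.refl

  adjugate-inverseˡ : ∀ X → (adjugate X *SL₂ X) ≈SL₂ Group.ε SL₂ℤ
  adjugate-inverseˡ X = entries≡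
    (_≈SL₂_.a≡ (Group.inverseˡ SL₂ℤ X)) (_≈SL₂_.b≡ (Group.inverseˡ SL₂ℤ X))
    (_≈SL₂_.c≡ (Group.inverseˡ SL₂ℤ X)) (_≈SL₂_.d≡ (Group.inverseˡ SL₂ℤ X))

  adjugate-inverseʳ : ∀ X → (X *SL₂ adjugate X) ≈SL₂ Group.ε SL₂ℤ
  adjugate-inverseʳ X = entries≡
    (_≈SL₂_.a≡ (Group.inverseʳ SL₂ℤ X)) (_≈SL₂_.b≡ (Group.inverseʳ SL₂ℤ X))
    (_≈SL₂_.c≡ (Group.inverseʳ SL₂ℤ X)) (_≈SL₂_.d≡ (Group.inverseʳ SL₂ℤ X))

module BaseChange (L : CommutativeRing 0ℓ 0ℓ)
  (ℤ→L : RingHomomorphism (CommutativeRing.rawRing ℤₚ.+-*-commutativeRing) (CommutativeRing.rawRing L)) where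

  open CommutativeRing L hiding (zero) renaming (Carrier to 𝕂)
  open RingHomomorphism ℤ→L using () renaming
    (⟦_⟧ to ι; ⟦⟧-cong to ι-cong; +-homo to ι-+; *-homo to ι-*; 0#-homo to ι-0; 1#-homo to ι-1; -‿homo to ι-neg)
  open LinearAlgebra L
  private
    module Z = LinearAlgebra ℤₚ.+-*-commutativeRing
    module 𝒜R = Ring 𝒜-ring
    module 𝒜Z = Ring Z.𝒜-ring
    module Eᴸ = LeftModule E-space
  open import Algebra.Properties.CommutativeMonoid.Sum Eᴸ.+ᴹ-commutativeMonoid using (sum)
  open import Algebra.Properties.CommutativeMonoid.Sum
    (LeftModule.+ᴹ-commutativeMonoid Z.E-space) using () renaming (sum to sumᶻ)
  open import Algebra.Properties.Ring ring using (-0#≈0#; x[y-z]≈xy-xz; -‿distribʳ-*; -1*x≈-x)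
  open import Algebra.Properties.AbelianGroup +-abelianGroup using (⁻¹-∙-comm)
  open import Algebra.Properties.CommutativeSemigroup +-commutativeSemigroup using (interchange)
  open import Algebra.Properties.CommutativeSemigroup *-commutativeSemigroup using (x∙yz≈y∙xz)
  open import Relation.Binary.Reasoning.Setoid setoid

  extendᴱ : Z.E → E
  extendᴱ v = record
    { coeff  = ι ∘ Z.coeff v
    ; bound  = Z.bound v
    ; finite = λ i p → trans (ι-cong (Z.finite v i p)) ι-0
    }

  extend : Z.𝒜 → 𝒜
  extend M = extendᴱ ∘ M

  extend-· : ∀ M v → extend M · extendᴱ v ≈ᴱ extendᴱ (M Z.· v)
  extend-· M v = extend-sum (Z.bound v) (λ k → Z.coeff v (toℕ k) Z.*ᴱ M (toℕ k)) _
    (λ k i → sym (ι-* (Z.coeff v (toℕ k)) (Z.coeff (M (toℕ k)) i)))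
    where
    extend-sum : ∀ n (f : Fin n → Z.E) (g : Fin n → E) → (∀ k → g k ≈ᴱ extendᴱ (f k)) → sum g ≈ᴱ extendᴱ (sumᶻ f)
    extend-sum zero    f g p i = sym ι-0
    extend-sum (suc n) f g p i = trans (+-cong (p Fin.zero i) (extend-sum n (f ∘ Fin.suc) (g ∘ Fin.suc) (p ∘ Fin.suc) i))
      (sym (ι-+ (Z.coeff (f Fin.zero) i) (Z.coeff (sumᶻ (f ∘ Fin.suc)) i)))

  extend-cong : ∀ {M N} → M 𝒜Z.≈ N → extend M 𝒜R.≈ extend N
  extend-cong p j i = ι-cong (p j i)

  extend-* : ∀ M N → extend (M 𝒜Z.* N) 𝒜R.≈ extend M 𝒜R.* extend N
  extend-* M N j i = sym (extend-· M (N j) i)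

  ι-indicator : ∀ b → ι (if b then 1ℤ else 0ℤ) ≈ (if b then 1# else 0#)
  ι-indicator true  = ι-1
  ι-indicator false = ι-0

  extend-1 : extend 𝒜Z.1# 𝒜R.≈ 𝒜R.1#
  extend-1 j i = ι-indicator (does (i ℕₚ.≟ j))

  extend-J∞ : extend Z.J∞ 𝒜R.≈ J∞
  extend-J∞ j i = ι-indicator (does (j ℕₚ.≟ i) ∨ does (j ℕₚ.≟ suc i))

  -- The subspaces of the filtration as vanishing conditions on coordinates

  Supported : ℕ → E → Set
  Supported n v = ∀ i → n ℕ.≤ i → coeff v i ≈ 0#

  Supported-resp : ∀ {n v w} → v ≈ᴱ w → Supported n v → Supported n w
  Supported-resp p s i q = trans (sym (p i)) (s i q)

  Supported-+ : ∀ {n} v w → Supported n v → Supported n w → Supported n (v +ᴱ w)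
  Supported-+ v w s t i q = trans (+-cong (s i q) (t i q)) (+-identityˡ 0#)

  Supported-* : ∀ {n} c v → Supported n v → Supported n (c *ᴱ v)
  Supported-* c v s i q = trans (*-congˡ (s i q)) (zeroʳ c)

  Supported-sum : ∀ {n m} (f : Fin m → E) → (∀ k → Supported n (f k)) → Supported n (sum f)
  Supported-sum {m = zero}  f s i q = refl
  Supported-sum {m = suc m} f s = Supported-+ (f Fin.zero) (sum (f ∘ Fin.suc)) (s Fin.zero) (Supported-sum (f ∘ Fin.suc) (s ∘ Fin.suc))

  -- The same coefficients with the recorded bound reset to `n`, so that a matrix product with this
  -- vector runs over the first `n` columns exactly.
  truncate : ∀ n v → Supported n v → E
  truncate n v s = record { coeff = coeff v ; bound = n ; finite = s }

  Supported⇒Span : ∀ {n v} → Supported n v → Span E-space {n} (e ∘ toℕ) v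
  Supported⇒Span {n} {v} s = coeff v ∘ toℕ , λ i → sym (·-identity (truncate n v s) i)

  Span⇒Supported : ∀ {n v} → Span E-space {n} (e ∘ toℕ) v → Supported n v
  Span⇒Supported {n} {v} (c , eq) = Supported-resp {n} {sum (λ k → c k *ᴱ e (toℕ k))} {v} (λ i → sym (eq i))
    (Supported-sum (λ k → c k *ᴱ e (toℕ k))
      (λ k → Supported-* (c k) (e (toℕ k)) (λ i q → finite (e (toℕ k)) i (ℕₚ.≤-trans (Finₚ.toℕ<n k) q))))

  Preserves : 𝒜 → ℕ → Set
  Preserves M n = ∀ v → Supported n v → Supported n (M · v)

  columns⇒Preserves : ∀ M n → (∀ j → j ℕ.< n → Supported n (M j)) → Preserves M n
  columns⇒Preserves M n s v t = Supported-resp {n} {M · truncate n v t} {M · v}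
    (·-cong {M} {M} {truncate n v t} {v} (λ _ _ → refl) (λ _ → refl))
    (Supported-sum {n} {n} (λ k → coeff v (toℕ k) *ᴱ M (toℕ k))
      (λ k → Supported-* (coeff v (toℕ k)) (M (toℕ k)) (s (toℕ k) (Finₚ.toℕ<n k))))

  e-diagonal : ∀ n → coeff (e n) n ≈ 1#
  e-diagonal zero    = refl
  e-diagonal (suc n) = e-diagonal n

  e-above : ∀ n → coeff (e (suc n)) n ≈ 0#
  e-above zero    = refl
  e-above (suc n) = e-above n

  ·-congʳ : ∀ M {v w} → v ≈ᴱ w → M · v ≈ᴱ M · w
  ·-congʳ M {v} {w} p = ·-cong {M} {M} {v} {w} (λ _ _ → refl) p

  module Peel (n : ℕ) (v : E) (s : Supported (suc n) v) where
    rest : E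
    rest = v +ᴱ -ᴱ (coeff v n *ᴱ e n)

    rest-Supported : Supported n rest
    rest-Supported i n≤i with ℕₚ.m≤n⇒m<n∨m≡n n≤i
    ... | inj₁ n<i    = trans (+-cong (s i n<i) (trans (-‿cong (trans (*-congˡ (finite (e n) i n<i)) (zeroʳ _))) -0#≈0#)) (+-identityˡ 0#)
    ... | inj₂ ≡.refl = trans (+-congˡ (-‿cong (trans (*-congˡ (e-diagonal n)) (*-identityʳ _)))) (-‿inverseʳ _)

    decomposition : v ≈ᴱ rest +ᴱ coeff v n *ᴱ e n
    decomposition i = sym (trans (+-assoc _ _ _) (trans (+-congˡ (-‿inverseˡ _)) (+-identityʳ _)))

    M·v : ∀ M → M · v ≈ᴱ M · rest +ᴱ coeff v n *ᴱ M n
    M·v M i = begin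
      coeff (M · v) i                                        ≈⟨ ·-congʳ M {v} {rest +ᴱ coeff v n *ᴱ e n} decomposition i ⟩
      coeff (M · (rest +ᴱ coeff v n *ᴱ e n)) i               ≈⟨ ·-+ M rest (coeff v n *ᴱ e n) i ⟩
      coeff (M · rest) i + coeff (M · (coeff v n *ᴱ e n)) i  ≈⟨ +-congˡ (trans (·-*ᴱ M (coeff v n) (e n) i) (*-congˡ (·-e M n i))) ⟩
      coeff (M · rest) i + coeff v n * coeff (M n) i         ∎

  -- After the two top coordinates are split off, the rest of `v` is sent by `M` to a vector
  -- vanishing from `n` on. Modulo that subspace, only the last two columns count.
  top-coefficients : ∀ M n → Preserves M n → ∀ v → Supported (2 ℕ.+ n) v → ∀ i → n ℕ.≤ i →
    coeff (M · v) i ≈ coeff v n * coeff (M n) i + coeff v (suc n) * coeff (M (suc n)) i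
  top-coefficients M n pres v s i n≤i = begin
    coeff (M · v) i                                                            ≈⟨ P.M·v M i ⟩
    coeff (M · P.rest) i + y * coeff (M (suc n)) i                             ≈⟨ +-congʳ (Q.M·v M i) ⟩
    (coeff (M · Q.rest) i + coeff P.rest n * coeff (M n) i) + y * coeff (M (suc n)) i
      ≈⟨ +-congʳ (+-cong (pres Q.rest Q.rest-Supported i n≤i) (*-congʳ rest-n)) ⟩
    (0# + x * coeff (M n) i) + y * coeff (M (suc n)) i                         ≈⟨ +-congʳ (+-identityˡ _) ⟩
    x * coeff (M n) i + y * coeff (M (suc n)) i                                ∎
    where
    module P = Peel (suc n) v s
    module Q = Peel n P.rest P.rest-Supported
    x = coeff v n
    y = coeff v (suc n)
    rest-n : coeff P.rest n ≈ x
    rest-n = trans (+-congˡ (trans (-‿cong (trans (*-congˡ (e-above n)) (zeroʳ y))) -0#≈0#)) (+-identityʳ x)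

  std : GModule SL₂ℤ
  std = columnVectors ℤ→L
  module std = GModule std

  -- The (2k)-th and (2k+1)-th coordinates, twisted by T⁻ᵏ because W acts on the graded
  -- piece as Tᵏ S T⁻ᵏ.
  grade : ℕ → E → 𝕂 × 𝕂
  grade k v = coeff v (double k) - ι (+ k) * coeff v (suc (double k)) , coeff v (suc (double k))

  grade-cong : ∀ k {v w} → v ≈ᴱ w → grade k v std.≈ᴹ grade k w
  grade-cong k p = +-cong (p _) (-‿cong (*-congˡ (p _))) , p _

  -- The two conditions are kept together because closure under products needs both: equivariance of
  -- `M` is applied to `N · v`, which must first be known to remain in the same step of the
  -- filtration.
  record ActsAs (X : SL₂) (M : Z.𝒜) : Set where
    field
      preserves   : ∀ k → Preserves (extend M) (double k)
      equivariant : ∀ k v → Supported (double (suc k)) v → grade k (extend M · v) std.≈ᴹ X std.▷ grade k v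

  open ActsAs

  ActsAs-resp : ∀ {X Y M N} → X ≈SL₂ Y → M 𝒜Z.≈ N → ActsAs X M → ActsAs Y N
  ActsAs-resp {X} {Y} {M} {N} p q a = record
    { preserves   = λ k v s → Supported-resp {double k} {extend M · v} {extend N · v} (eq v) (preserves a k v s)
    ; equivariant = λ k v s → std.≈ᴹ-trans (grade-cong k {extend N · v} {extend M · v} (λ i → sym (eq v i)))
        (std.≈ᴹ-trans (equivariant a k v s) (std.▷-cong {X} {Y} {grade k v} {grade k v} p (std.≈ᴹ-refl {grade k v})))
    }
    where
    eq : ∀ v → extend M · v ≈ᴱ extend N · v
    eq v = ·-cong {extend M} {extend N} {v} {v} (extend-cong {M} {N} q) (λ _ → refl)

  ActsAs-ε : ActsAs (Group.ε SL₂ℤ) 𝒜Z.1#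
  ActsAs-ε = record
    { preserves   = λ k v s → Supported-resp {double k} {v} {extend 𝒜Z.1# · v} (λ i → sym (eq v i)) s
    ; equivariant = λ k v s → std.≈ᴹ-trans (grade-cong k {extend 𝒜Z.1# · v} {v} (eq v)) (std.≈ᴹ-sym (std.▷-ε (grade k v)))
    }
    where
    eq : ∀ v → extend 𝒜Z.1# · v ≈ᴱ v
    eq v i = trans (·-cong {extend 𝒜Z.1#} {e} {v} {v} extend-1 (λ _ → refl) i) (·-identity v i)

  ActsAs-∙ : ∀ {X Y M N} → ActsAs X M → ActsAs Y N → ActsAs (X *SL₂ Y) (M 𝒜Z.* N)
  ActsAs-∙ {X} {Y} {M} {N} a b = record
    { preserves   = λ k v s → Supported-resp {double k} {extend M · (extend N · v)} {extend (M 𝒜Z.* N) · v}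
        (λ i → sym (eq v i)) (preserves a k (extend N · v) (preserves b k v s))
    ; equivariant = λ k v s → std.≈ᴹ-trans
        (grade-cong k {extend (M 𝒜Z.* N) · v} {extend M · (extend N · v)} (eq v))
        (std.≈ᴹ-trans (equivariant a k (extend N · v) (preserves b (suc k) v s))
          (std.≈ᴹ-trans (std.▷-cong {X} {X} {grade k (extend N · v)} {Y std.▷ grade k v} (Group.refl SL₂ℤ) (equivariant b k v s))
            (std.≈ᴹ-sym (std.▷-∙ X Y (grade k v)))))
    }
    where
    eq : ∀ v → extend (M 𝒜Z.* N) · v ≈ᴱ extend M · (extend N · v)
    eq v i = trans (·-cong {extend (M 𝒜Z.* N)} {extend M 𝒜R.* extend N} {v} {v} (extend-* M N) (λ _ → refl) i)
      (·-assoc (extend M) (extend N) v i)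

  x-y+y≈x : ∀ x y → (x - y) + y ≈ x
  x-y+y≈x x y = trans (+-assoc _ _ _) (trans (+-congˡ (-‿inverseˡ y)) (+-identityʳ x))

  ι0*x≈0 : ∀ x → ι 0ℤ * x ≈ 0#
  ι0*x≈0 x = trans (*-congʳ ι-0) (zeroˡ x)

  ι1*x≈x : ∀ x → ι 1ℤ * x ≈ x
  ι1*x≈x x = trans (*-congʳ ι-1) (*-identityˡ x)

  J∞-diagonal : ∀ n → Z.coeff (Z.J∞ n) n ≡ 1ℤ
  J∞-diagonal zero    = ≡.refl
  J∞-diagonal (suc n) = J∞-diagonal n

  J∞-above-diagonal : ∀ n → Z.coeff (Z.J∞ (suc n)) n ≡ 1ℤ
  J∞-above-diagonal zero    = ≡.refl
  J∞-above-diagonal (suc n) = J∞-above-diagonal n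

  x*1 : ∀ x {m} → m ≡ 1ℤ → x * ι m ≈ x
  x*1 x p = trans (*-congˡ (trans (ι-cong p) ι-1)) (*-identityʳ x)

  x*0 : ∀ x {m} → m ≡ 0ℤ → x * ι m ≈ 0#
  x*0 x p = trans (*-congˡ (trans (ι-cong p) ι-0)) (zeroʳ x)

  -- The blocks of `J∞` are all equal to `T`, and the twist by `T⁻ᵏ` commutes with `T`, so it leaves
  -- this action unchanged.
  ActsAs-J∞ : ActsAs T Z.J∞
  ActsAs-J∞ = record
    { preserves   = λ k → J-preserves (double k)
    ; equivariant = J-equivariant
    }
    where
    J-preserves : ∀ n → Preserves (extend Z.J∞) n
    J-preserves n = columns⇒Preserves (extend Z.J∞) n
      (λ j j<n i n≤i → trans (ι-cong (Z.finite (Z.J∞ j) i (ℕₚ.≤-trans j<n n≤i))) ι-0)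

    J-equivariant : ∀ k v → Supported (double (suc k)) v → grade k (extend Z.J∞ · v) std.≈ᴹ T std.▷ grade k v
    J-equivariant k v s =
        (begin
          coeff (extend Z.J∞ · v) n - c * coeff (extend Z.J∞ · v) (suc n)  ≈⟨ +-cong top (-‿cong (*-congˡ bottom)) ⟩
          (x + y) - c * y                    ≈⟨ +-assoc x y (- (c * y)) ⟩
          x + (y - c * y)                    ≈⟨ +-congˡ (+-comm y (- (c * y))) ⟩
          x + (- (c * y) + y)                ≈⟨ +-assoc x (- (c * y)) y ⟨
          (x - c * y) + y                    ≈⟨ +-cong (ι1*x≈x (x - c * y)) (ι1*x≈x y) ⟨
          ι 1ℤ * (x - c * y) + ι 1ℤ * y      ∎)
      , trans bottom (sym (trans (+-cong (ι0*x≈0 (x - c * y)) (ι1*x≈x y)) (+-identityˡ y)))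
      where
      n = double k
      c = ι (+ k)
      x = coeff v n
      y = coeff v (suc n)
      top : coeff (extend Z.J∞ · v) n ≈ x + y
      top = trans (top-coefficients (extend Z.J∞) n (J-preserves n) v s n ℕₚ.≤-refl)
        (+-cong (x*1 x (J∞-diagonal n)) (x*1 y (J∞-above-diagonal n)))
      bottom : coeff (extend Z.J∞ · v) (suc n) ≈ y
      bottom = trans (top-coefficients (extend Z.J∞) n (J-preserves n) v s (suc n) (ℕₚ.n≤1+n n))
        (trans (+-cong (x*0 x (Z.finite (Z.J∞ n) (suc n) ℕₚ.≤-refl)) (x*1 y (J∞-diagonal (suc n)))) (+-identityˡ y))

  F : ℕ → E → Set
  F i = Span E-space {2 ℕ.* i} (e ∘ toℕ)

  F⇒Supported : ∀ k {v} → F k v → Supported (double k) v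
  F⇒Supported k {v} p = subst (λ n → Supported n v) (2*≡double k) (Span⇒Supported {2 ℕ.* k} {v} p)

  Supported⇒F : ∀ k {v} → Supported (double k) v → F k v
  Supported⇒F k {v} s = Supported⇒Span {2 ℕ.* k} {v} (subst (λ n → Supported n v) (≡.sym (2*≡double k)) s)

  grade-+ : ∀ k v w → grade k (v +ᴱ w) std.≈ᴹ (grade k v std.+ᴹ grade k w)
  grade-+ k v w = trans (+-congˡ (trans (-‿cong (distribˡ (ι (+ k)) _ _)) (sym (⁻¹-∙-comm _ _)))) (interchange _ _ _ _) , refl

  grade-* : ∀ k c v → grade k (c *ᴱ v) std.≈ᴹ (c std.*ₗ grade k v)
  grade-* k c v = trans (+-congˡ (-‿cong (x∙yz≈y∙xz (ι (+ k)) c _))) (sym (x[y-z]≈xy-xz c _ _)) , refl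

  grade-Supported : ∀ k v → Supported (double k) v → grade k v std.≈ᴹ std.0ᴹ
  grade-Supported k v s = trans (+-cong (s (double k) ℕₚ.≤-refl)
      (trans (-‿cong (trans (*-congˡ (s (suc (double k)) (ℕₚ.n≤1+n _))) (zeroʳ _))) -0#≈0#)) (+-identityˡ 0#)
    , s (suc (double k)) (ℕₚ.n≤1+n _)

  grade-neg : ∀ k v → grade k (-ᴱ v) std.≈ᴹ (std.-ᴹ grade k v)
  grade-neg k v = trans (+-congˡ (-‿cong (sym (-‿distribʳ-* _ _)))) (⁻¹-∙-comm _ _) , refl

  grade-∼ : ∀ k v w → Supported (double k) (v +ᴱ -ᴱ w) → grade k v std.≈ᴹ grade k w
  grade-∼ k v w s = std.≈ᴹ-trans (grade-cong k {v} {(v +ᴱ -ᴱ w) +ᴱ w} (λ i → sym (x-y+y≈x _ _)))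
    (std.≈ᴹ-trans (grade-+ k (v +ᴱ -ᴱ w) w)
      (std.≈ᴹ-trans (std.+ᴹ-congʳ {grade k w} (grade-Supported k (v +ᴱ -ᴱ w) s)) (std.+ᴹ-identityˡ (grade k w))))

  grade-injective : ∀ k v w → Supported (double (suc k)) v → Supported (double (suc k)) w →
    grade k v std.≈ᴹ grade k w → Supported (double k) (v +ᴱ -ᴱ w)
  grade-injective k v w s t (p , q) i n≤i = trans (+-congʳ (equal (ℕₚ.m≤n⇒m<n∨m≡n n≤i))) (-‿inverseʳ _)
    where
    equal : _ → coeff v i ≈ coeff w i
    equal (inj₂ ≡.refl) = begin
      coeff v i                                                     ≈⟨ x-y+y≈x _ _ ⟨
      (coeff v i - c * coeff v (suc i)) + c * coeff v (suc i)       ≈⟨ +-cong p (*-congˡ q) ⟩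
      (coeff w i - c * coeff w (suc i)) + c * coeff w (suc i)       ≈⟨ x-y+y≈x _ _ ⟩
      coeff w i                                                     ∎
      where c = ι (+ k)
    equal (inj₁ n<i) with ℕₚ.m≤n⇒m<n∨m≡n n<i
    ... | inj₁ 1+n<i   = trans (s i 1+n<i) (sym (t i 1+n<i))
    ... | inj₂ ≡.refl  = q

  -- A section of `grade k`: the vector `Tᵏ (a, b)` placed in coordinates `2k` and `2k + 1`, which
  -- undoes the twist.
  lift : ℕ → 𝕂 × 𝕂 → E
  lift k (a , b) = (a + ι (+ k) * b) *ᴱ e (double k) +ᴱ b *ᴱ e (suc (double k))

  lift-Supported : ∀ k p → Supported (double (suc k)) (lift k p)
  lift-Supported k (a , b) = Supported-+ {double (suc k)} (_ *ᴱ e n) (b *ᴱ e (suc n))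
    (Supported-* _ (e n) (λ i q → finite (e n) i (ℕₚ.≤-trans (ℕₚ.n≤1+n _) q)))
    (Supported-* b (e (suc n)) (finite (e (suc n))))
    where n = double k

  grade-lift : ∀ k p → grade k (lift k p) std.≈ᴹ p
  grade-lift k (a , b) = (begin
      coeff v n - c * coeff v (suc n)      ≈⟨ +-cong top (-‿cong (*-congˡ bottom)) ⟩
      (a + c * b) - c * b                  ≈⟨ +-assoc a (c * b) (- (c * b)) ⟩
      a + (c * b - c * b)                  ≈⟨ +-congˡ (-‿inverseʳ _) ⟩
      a + 0#                               ≈⟨ +-identityʳ a ⟩
      a                                    ∎) , bottom
    where
    n = double k
    c = ι (+ k)
    v = lift k (a , b)
    top : coeff v n ≈ a + c * b
    top = trans (+-cong (trans (*-congˡ (e-diagonal n)) (*-identityʳ _)) (trans (*-congˡ (e-above n)) (zeroʳ b))) (+-identityʳ _)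
    bottom : coeff v (suc n) ≈ b
    bottom = trans (+-cong (trans (*-congˡ (finite (e n) (suc n) ℕₚ.≤-refl)) (zeroʳ _))
      (trans (*-congˡ (e-diagonal (suc n))) (*-identityʳ b))) (+-identityˡ b)

  module _ (model : IntegralModel) where
    open IntegralModel model
    open Representation representation

    W-preserves : ∀ k → Preserves (extend W) (double k)
    W-preserves k = columns⇒Preserves (extend W) (double k) (λ j j<n i n≤i → trans (ι-cong (column k j i j<n n≤i)) ι-0)
      where
      column : ∀ k j i → j ℕ.< double k → double k ℕ.≤ i → Z.coeff (W j) i ≡ 0ℤ
      column (suc k) j i j<n n≤i with ℕₚ.m≤n⇒m<n∨m≡n (ℕₚ.≤-trans j<n n≤i)
      ... | inj₁ 1+j<i = W-lower j i 1+j<i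
      -- The remaining position is the subdiagonal entry under the last column of the preceding
      -- block, where the alternating sequence takes the value 0.
      ... | inj₂ ≡.refl with ≡.refl ← ℕₚ.≤-antisym j<n n≤i = Block.below (W-block k)

    ActsAs-W : ActsAs S W
    ActsAs-W = record
      { preserves   = W-preserves
      ; equivariant = W-equivariant
      }
      where
      W-equivariant : ∀ k v → Supported (double (suc k)) v → grade k (extend W · v) std.≈ᴹ S std.▷ grade k v
      W-equivariant k v s =
          (begin
            coeff (extend W · v) n - c * coeff (extend W · v) (suc n)     ≈⟨ +-cong top (-‿cong (*-congˡ bottom)) ⟩
            (x * c - (y + y * (c * c))) - c * (x - y * c)                 ≈⟨ +-congˡ (-‿cong (x[y-z]≈xy-xz c x (y * c))) ⟩
            (x * c - (y + y * (c * c))) - (c * x - c * (y * c))           ≈⟨ +-congˡ (-‿cong (+-cong (*-comm c x) (-‿cong (x∙yz≈y∙xz c y c)))) ⟩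
            (x * c - (y + y * (c * c))) - (x * c - y * (c * c))           ≈⟨ difference (x * c) y (y * (c * c)) ⟩
            - y                                                           ≈⟨ -1*x≈-x y ⟨
            - 1# * y                                                      ≈⟨ *-congʳ (trans (ι-neg 1ℤ) (-‿cong ι-1)) ⟨
            ι -1ℤ * y                                                     ≈⟨ +-identityˡ _ ⟨
            0# + ι -1ℤ * y                                                ≈⟨ +-congʳ (ι0*x≈0 (x - c * y)) ⟨
            ι 0ℤ * (x - c * y) + ι -1ℤ * y                                ∎)
        , (begin
            coeff (extend W · v) (suc n)       ≈⟨ bottom ⟩
            x - y * c                          ≈⟨ +-congˡ (-‿cong (*-comm y c)) ⟩
            x - c * y                          ≈⟨ +-identityʳ _ ⟨
            (x - c * y) + 0#                   ≈⟨ +-cong (ι1*x≈x (x - c * y)) (ι0*x≈0 y) ⟨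
            ι 1ℤ * (x - c * y) + ι 0ℤ * y      ∎)
        where
        open Block (W-block k)
        n = double k
        c = ι (+ k)
        x = coeff v n
        y = coeff v (suc n)
        top : coeff (extend W · v) n ≈ x * c - (y + y * (c * c))
        top = trans (top-coefficients (extend W) n (W-preserves k) v s n ℕₚ.≤-refl)
          (+-cong (*-congˡ (ι-cong upper-left)) (begin
            y * ι (Z.coeff (W (suc n)) n)               ≈⟨ *-congˡ (ι-cong upper-right) ⟩
            y * ι (ℤ.- (1ℤ ℤ.+ + k ℤ.* + k))            ≈⟨ *-congˡ (ι-neg (1ℤ ℤ.+ + k ℤ.* + k)) ⟩
            y * - ι (1ℤ ℤ.+ + k ℤ.* + k)                ≈⟨ -‿distribʳ-* y _ ⟨
            - (y * ι (1ℤ ℤ.+ + k ℤ.* + k))              ≈⟨ -‿cong (*-congˡ (trans (ι-+ 1ℤ (+ k ℤ.* + k)) (+-cong ι-1 (ι-* (+ k) (+ k))))) ⟩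
            - (y * (1# + c * c))                        ≈⟨ -‿cong (trans (distribˡ y 1# (c * c)) (+-congʳ (*-identityʳ y))) ⟩
            - (y + y * (c * c))                         ∎))
        bottom : coeff (extend W · v) (suc n) ≈ x - y * c
        bottom = trans (top-coefficients (extend W) n (W-preserves k) v s (suc n) (ℕₚ.n≤1+n n))
          (+-cong (x*1 x lower-left)
            (trans (*-congˡ (trans (ι-cong lower-right) (ι-neg (+ k)))) (sym (-‿distribʳ-* y c))))
        difference : ∀ a y q → (a - (y + q)) - (a - q) ≈ - y
        difference a y q = begin
          (a - (y + q)) - (a - q)            ≈⟨ +-cong (+-congˡ (⁻¹-∙-comm y q)) (⁻¹-∙-comm a (- q)) ⟨
          (a + (- y - q)) + (- a + - - q)    ≈⟨ interchange a (- y - q) (- a) (- - q) ⟩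
          (a - a) + ((- y - q) - - q)        ≈⟨ +-congʳ (-‿inverseʳ a) ⟩
          0# + ((- y - q) - - q)             ≈⟨ +-identityˡ _ ⟩
          (- y - q) - - q                    ≈⟨ +-assoc (- y) (- q) (- - q) ⟩
          - y + (- q - - q)                  ≈⟨ +-congˡ (-‿inverseʳ (- q)) ⟩
          - y + 0#                           ≈⟨ +-identityʳ (- y) ⟩
          - y                                ∎

    ActsAs-⟦⟧ : ∀ X → ActsAs X ⟦ X ⟧
    ActsAs-⟦⟧ = ⟦⟧-induction ActsAs
      (λ {X} {Y} {M} p a → ActsAs-resp {X} {Y} {M} {M} p (𝒜Z.refl {M}) a)
      ActsAs-ε
      (λ {X} {M} a → ActsAs-∙ {S} {X} {W} {M} ActsAs-W a)
      -- The generator `R` is split as `W J∞`, so that only the actions of `S` and `T` are needed.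
      (λ {X} {M} a → ActsAs-resp {S *SL₂ (T *SL₂ X)} {S *SL₂ (T *SL₂ X)} {W 𝒜Z.* (Z.J∞ 𝒜Z.* M)} {R 𝒜Z.* M}
        (Group.refl SL₂ℤ {S *SL₂ (T *SL₂ X)})
        (𝒜Z.trans {W 𝒜Z.* (Z.J∞ 𝒜Z.* M)} {W 𝒜Z.* Z.J∞ 𝒜Z.* M} {R 𝒜Z.* M}
          (𝒜Z.sym {W 𝒜Z.* Z.J∞ 𝒜Z.* M} {W 𝒜Z.* (Z.J∞ 𝒜Z.* M)} (𝒜Z.*-assoc W Z.J∞ M))
          (𝒜Z.*-congʳ {M} {W 𝒜Z.* Z.J∞} {R} WJ∞≈R))
        (ActsAs-∙ {S} {T *SL₂ X} {W} {Z.J∞ 𝒜Z.* M} ActsAs-W (ActsAs-∙ {T} {X} {Z.J∞} {M} ActsAs-J∞ a)))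

    extend-⟦⟧-∙ : ∀ X Y → extend ⟦ X *SL₂ Y ⟧ 𝒜R.≈ extend ⟦ X ⟧ 𝒜R.* extend ⟦ Y ⟧
    extend-⟦⟧-∙ X Y = 𝒜R.trans {extend ⟦ X *SL₂ Y ⟧} {extend (⟦ X ⟧ 𝒜Z.* ⟦ Y ⟧)} {extend ⟦ X ⟧ 𝒜R.* extend ⟦ Y ⟧}
      (extend-cong {⟦ X *SL₂ Y ⟧} {⟦ X ⟧ 𝒜Z.* ⟦ Y ⟧} (⟦⟧-∙ X Y)) (extend-* ⟦ X ⟧ ⟦ Y ⟧)

    extend-⟦⟧-ε : extend ⟦ Group.ε SL₂ℤ ⟧ 𝒜R.≈ 𝒜R.1#
    extend-⟦⟧-ε = 𝒜R.trans {extend ⟦ Group.ε SL₂ℤ ⟧} {extend 𝒜Z.1#} {𝒜R.1#}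
      (extend-cong {⟦ Group.ε SL₂ℤ ⟧} {𝒜Z.1#} ⟦⟧-ε) extend-1

    cancel : ∀ {X Y} → (X *SL₂ Y) ≈SL₂ Group.ε SL₂ℤ → extend ⟦ X ⟧ 𝒜R.* extend ⟦ Y ⟧ 𝒜R.≈ 𝒜R.1#
    cancel {X} {Y} p = 𝒜R.trans {extend ⟦ X ⟧ 𝒜R.* extend ⟦ Y ⟧} {extend ⟦ X *SL₂ Y ⟧} {𝒜R.1#}
      (𝒜R.sym {extend ⟦ X *SL₂ Y ⟧} {extend ⟦ X ⟧ 𝒜R.* extend ⟦ Y ⟧} (extend-⟦⟧-∙ X Y))
      (𝒜R.trans {extend ⟦ X *SL₂ Y ⟧} {extend ⟦ Group.ε SL₂ℤ ⟧} {𝒜R.1#}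
        (extend-cong {⟦ X *SL₂ Y ⟧} {⟦ Group.ε SL₂ℤ ⟧} (⟦⟧-cong p)) extend-⟦⟧-ε)

    extend-⟦⟧-cong : ∀ {X Y} → X ≈SL₂ Y → extend ⟦ X ⟧ 𝒜R.≈ extend ⟦ Y ⟧
    extend-⟦⟧-cong {X} {Y} p = extend-cong {⟦ X ⟧} {⟦ Y ⟧} (⟦⟧-cong p)

-- The complex representation

open import Defs
open import Data.Nat.Base using (_*_; _^_)
open import Data.Product using (∃-syntax)
open import Data.Rational.Base using (_/_)

-- The modulus of an integer inside ℂ

module Modulus where
  private module ℝᴿ = CommutativeRing ℝ-commutativeRing

  /1-mono-≤ : ∀ {m n} → m ℤ.≤ n → m / 1 ℚ.≤ n / 1
  /1-mono-≤ {m} {n} m≤n = ℚₚ.toℚᵘ-cancel-≤ (ℚᵘₚ.≤-trans (ℚᵘₚ.≤-reflexive (ℚₚ.toℚᵘ-fromℚᵘ (mkℚᵘ m 0)))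
    (ℚᵘₚ.≤-trans (ℚᵘ.*≤* (ℤₚ.*-monoʳ-≤-nonNeg 1ℤ m≤n))
      (ℚᵘₚ.≤-reflexive (ℚᵘₚ.≃-sym (ℚₚ.toℚᵘ-fromℚᵘ (mkℚᵘ n 0))))))

  fromℚ-mono-≤ : ∀ {p q} → p ℚ.≤ q → fromℚ p ≤ℝ fromℚ q
  fromℚ-mono-≤ {p} {q} p≤q = mk≤ λ ε ε>0 → 0 , λ _ _ →
    subst (ℚ._≤ q ℚ.+ ε) (ℚₚ.+-identityʳ p) (ℚₚ.+-mono-≤ p≤q (ℚₚ.<⇒≤ ε>0))

  ∣n∣² : ∀ n → (+ ℤ.∣ n ∣ / 1) ℚ.* (+ ℤ.∣ n ∣ / 1) ≡ (n / 1) ℚ.* (n / 1) ℚ.+ 0ℚ ℚ.* 0ℚ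
  ∣n∣² (+ n)    = ≡.sym (ℚₚ.+-identityʳ _)
  ∣n∣² -[1+ n ] = ≡.sym (≡.trans (ℚₚ.+-identityʳ _)
    (≡.trans (≡.sym (ℚₚ.neg-distribˡ-* q (ℚ.- q)))
      (≡.trans (cong ℚ.-_ (≡.sym (ℚₚ.neg-distribʳ-* q q))) (⁻¹-involutive (q ℚ.* q)))))
    where
    q = + suc n / 1
    open import Algebra.Properties.Group ℚₚ.+-0-group using (⁻¹-involutive)

  -- The square root asked for by the modulus is the rational `∣ n ∣`, so no real root has to be
  -- constructed.
  ∣fromℤ∣≤ : ∀ {z} n {b} → z ≈ℂ fromℤ n → ℤ.∣ n ∣ ℕ.≤ b → ∣ z ∣≤ fromℚ (+ b / 1)
  ∣fromℤ∣≤ {z} n {b} z≈n ∣n∣≤b = fromℚ q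
    , ( fromℚ-mono-≤ {0ℚ} {q} (/1-mono-≤ {0ℤ} {+ ℤ.∣ n ∣} (ℤ.+≤+ ℕ.z≤n))
      , ℝᴿ.trans {fromℚ q *ℝ fromℚ q} {fromℚ p *ℝ fromℚ p +ℝ fromℚ 0ℚ *ℝ fromℚ 0ℚ} {re z *ℝ re z +ℝ im z *ℝ im z}
          (mk≈ (_≈ℝ_.close (ℝᴿ.reflexive (cong fromℚ (∣n∣² n)))))
          (ℝᴿ.sym {re z *ℝ re z +ℝ im z *ℝ im z} {fromℚ p *ℝ fromℚ p +ℝ fromℚ 0ℚ *ℝ fromℚ 0ℚ}
            (ℝᴿ.+-cong {re z *ℝ re z} {fromℚ p *ℝ fromℚ p} {im z *ℝ im z} {fromℚ 0ℚ *ℝ fromℚ 0ℚ}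
              (ℝᴿ.*-cong {re z} {fromℚ p} {re z} {fromℚ p} (re≈ z≈n) (re≈ z≈n))
              (ℝᴿ.*-cong {im z} {fromℚ 0ℚ} {im z} {fromℚ 0ℚ} (im≈ z≈n) (im≈ z≈n)))) )
    , fromℚ-mono-≤ {q} {+ b / 1} (/1-mono-≤ {+ ℤ.∣ n ∣} {+ b} (ℤ.+≤+ ∣n∣≤b))
    where
    p q : ℚ
    p = n / 1
    q = + ℤ.∣ n ∣ / 1

private
  module ℂᴿ = CommutativeRing ℂ-commutativeRing
  open LinearAlgebra ℤₚ.+-*-commutativeRing using () renaming (J∞ to J∞ᶻ; entry to entryᶻ)
  open BaseChange ℂ-commutativeRing ℤ→ℂ
  open IntegralModel integralModel
  open Representation representation

  4^≡2^2* : ∀ n → 4 ^ n ≡ 2 ^ (2 * n)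
  4^≡2^2* = ℕₚ.^-*-assoc 2 2

unit : SL₂ → Group.Carrier 𝒜ˣ
unit X = record
  { value    = extend ⟦ X ⟧
  ; inv      = extend ⟦ adjugate X ⟧
  ; inverseˡ = cancel integralModel {adjugate X} {X} (adjugate-inverseˡ X)
  ; inverseʳ = cancel integralModel {X} {adjugate X} (adjugate-inverseʳ X)
  }

τ : GroupHomomorphism (Group.rawGroup SL₂ℤ) (Group.rawGroup 𝒜ˣ)
τ = record
  { ⟦_⟧ = unit
  ; isGroupHomomorphism = record
    { isMonoidHomomorphism = record
      { isMagmaHomomorphism = record
        { isRelHomomorphism = record { cong = λ {X} {Y} → extend-⟦⟧-cong integralModel {X} {Y} }
        ; homo = extend-⟦⟧-∙ integralModel
        }
      ; ε-homo = extend-⟦⟧-ε integralModel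
      }
    ; ⁻¹-homo = λ X → extend-⟦⟧-cong integralModel {Group._⁻¹ SL₂ℤ X} {adjugate X} (⁻¹≈adjugate X)
    }
  }

filtration : IsFiltration (via SL₂ℤ τ) E⟨_⟩
filtration = record
  { isSubmodule = λ k → record
    { resp = λ {v} {w} p q → Supported⇒F k {w} (Supported-resp {double k} {v} {w} p (F⇒Supported k {v} q))
    ; 0∈   = Supported⇒F k {0ᴱ} (λ _ _ → ℂᴿ.refl)
    ; +∈   = λ {v} {w} p q → Supported⇒F k {v +ᴱ w} (Supported-+ v w (F⇒Supported k {v} p) (F⇒Supported k {w} q))
    ; *∈   = λ c {v} p → Supported⇒F k {c *ᴱ v} (Supported-* c v (F⇒Supported k {v} p))
    ; ▷∈   = λ X {v} p → Supported⇒F k {extend ⟦ X ⟧ · v} (ActsAs.preserves (ActsAs-⟦⟧ integralModel X) k v (F⇒Supported k {v} p))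
    }
  ; bottom    = λ {v} p i → F⇒Supported 0 {v} p i ℕ.z≤n
  ; ascending = λ k {v} p → Supported⇒F (suc k) {v}
      (λ i q → F⇒Supported k {v} p i (ℕₚ.≤-trans (ℕₚ.m≤n+m (double k) 2) q))
  }

gradedPiece≅standard : ∀ k → IsFiltration.gradedPiece filtration k ≅ standard
gradedPiece≅standard k = record
  { ⟦_⟧ = λ v → grade k (proj₁ v)
  ; isLeftModuleIsomorphism = record
    { isLeftModuleMonomorphism = record
      { isLeftModuleHomomorphism = record
        { +ᴹ-isGroupHomomorphism = record
          { isMonoidHomomorphism = record
            { isMagmaHomomorphism = record
              { isRelHomomorphism = record
                { cong = λ {v} {w} p → grade-∼ k (proj₁ v) (proj₁ w) (F⇒Supported k {proj₁ v +ᴱ -ᴱ proj₁ w} p) }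
              ; homo = λ v w → grade-+ k (proj₁ v) (proj₁ w)
              }
            ; ε-homo = grade-Supported k 0ᴱ (λ _ _ → ℂᴿ.refl)
            }
          ; ⁻¹-homo = λ v → grade-neg k (proj₁ v)
          }
        ; *ₗ-homo = λ c v → grade-* k c (proj₁ v)
        }
      ; injective = λ {v} {w} p → Supported⇒F k {proj₁ v +ᴱ -ᴱ proj₁ w}
          (grade-injective k (proj₁ v) (proj₁ w)
            (F⇒Supported (suc k) {proj₁ v} (proj₂ v)) (F⇒Supported (suc k) {proj₁ w} (proj₂ w)) p)
      }
    ; surjective = λ p → (lift k p , Supported⇒F (suc k) {lift k p} (lift-Supported k p)) ,
        λ {z} z∼x → std.≈ᴹ-trans
          (grade-∼ k (proj₁ z) (lift k p) (F⇒Supported k {proj₁ z +ᴱ -ᴱ lift k p} z∼x)) (grade-lift k p)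
    }
  ; equivariant = λ X v → ActsAs.equivariant (ActsAs-⟦⟧ integralModel X) k (proj₁ v) (F⇒Supported (suc k) {proj₁ v} (proj₂ v))
  }

theorem5p1 : Σ[ τ ∈ GroupHomomorphism (Group.rawGroup SL₂ℤ) (Group.rawGroup 𝒜ˣ) ]
    (
    (Σ[ filtration ∈ IsFiltration (via SL₂ℤ τ) E⟨_⟩ ]
    (∀ (i : ℕ) → IsFiltration.gradedPiece filtration i ≅ standard))
    × Ring._≈_ 𝒜-ring (matrix τ T) J∞
    × (∀ (Y : Group.Carrier SL₂ℤ) (i j : ℕ) → ∃[ n ] entry (matrix τ Y) i j ≈ℂ fromℤ n)
    × (Σ[ C ∈ ℕ ] ∀ (i j : ℕ) →
    ∣ entry (matrix τ S) i j ∣≤ fromℚ (+ (2 ^ (C * suc j)) / 1)))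
theorem5p1 = τ
  , (filtration , gradedPiece≅standard)
  , (λ j i → ℂᴿ.trans {entry (extend ⟦ T ⟧) i j} {entry (extend J∞ᶻ) i j} {entry J∞ i j}
      (extend-cong {⟦ T ⟧} {J∞ᶻ} ⟦T⟧≈J∞ j i) (extend-J∞ j i))
  -- The complex matrix is by construction the entrywise image of an integer one, so integrality
  -- holds by reflexivity.
  , (λ Y i j → entryᶻ ⟦ Y ⟧ i j , ℂᴿ.refl {fromℤ (entryᶻ ⟦ Y ⟧ i j)})
  -- `C = 2` because the bound is a power of `4 = 2²`; its exponent `suc j` is the column number
  -- counted from 1.
  , (2 , λ i j → Modulus.∣fromℤ∣≤ (entryᶻ W i j) (extend-cong {⟦ S ⟧} {W} ⟦S⟧ j i)
      (subst (ℤ.∣ entryᶻ W i j ∣ ℕ.≤_) (4^≡2^2* (suc j)) (W-bound j i)))
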